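{- Let $n \geq 2$ and let $q$ be a prime power with $(n,q) \notin \{(2,2),(2,3)\}$, so that $N = L_n(q) = PSL_n(q)$ is a simple group. Put $v = \frac{q^n-1}{q-1}$ and identify a set $X$ of size $v$ with the point set of the projective space $PG(n-1,q)$, on which $N$ acts in its natural way. Let $G$ be a group with $N \leq G \leq \mathrm{Aut}(N)$ acting on $X$ extending this natural action of $N$, and let $\mathcal{D}$ be a non-trivial Steiner quadruple system $\mathrm{SQS}(v)$ with point set $X$. Then $G \leq \mathrm{Aut}(\mathcal{D})$ (i.e. $G$ acts on $\mathcal{D}$ as a group of automorphisms) if and only if, up to isomorphism, $n=2$ and $(\mathcal{D},G)$ is one of the following: (1) $q = 3^d$, the points of $\mathcal{D}$ are the elements of the projective line $\mathbb{F}_{3^d} \cup \{\infty\}$, the blocks are the images of $\mathbb{F}_3 \cup \{\infty\}$ under $PGL_2(3^d)$ with $d \geq 2$ (respectively under $L_2(3^d)$ with $d>1$ odd), and $L_2(3^d) \leq G \leq P\Gamma L_2(3^d)$; (2) $q \equiv 7 \pmod{12}$, the points are the elements of $\mathbb{F}_q \cup \{\infty\}$, the blocks are the images of $\{0,1,\infty,\varepsilon\}$ under $L_2(q)$, where $\varepsilon$ is a primitive sixth root of unity in $\mathbb{F}_q$, and $L_2(q) \leq G \leq P\Sigma L_2(q)$; (3) $q = 3^{2d}$ with $d \geq 1$, the points are the elements of $\mathbb{F}_{3^{2d}} \cup \{\infty\}$, the blocks are the (disjoint) union of the images of $\{0,1,-1,\infty\}$ and of $\{0,1,a,\infty\}$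 under $L_2(3^{2d})$, where $a$ is a non-square in $\mathbb{F}_{3^{2d}}^*$, and $L_2(3^{2d}) \leq G \leq P\Sigma L_2(3^{2d})$. In particular, for $n>2$, $G$ cannot act as a group of automorphisms on any $\mathrm{SQS}(v)$.
   Context: A Steiner quadruple system $\mathrm{SQS}(v)$ is a $3$-$(v,4,1)$ design: a set $X$ of $v$ points together with a family of $4$-subsets (blocks) such that every $3$-subset of $X$ is contained in exactly one block. It is trivial if $v=4$. An automorphism is a permutation of the points mapping blocks to blocks. $L_2(q)$, $PGL_2(q)$, $P\Sigma L_2(q) = L_2(q) \rtimes \mathrm{Gal}(\mathbb{F}_q)$ and $P\Gamma L_2(q)$ act on the projective line $\mathbb{F}_q \cup \{\infty\}$ by (semi)linear fractional transformations. -}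

module Defs where

open import Data.Nat as ℕ using (ℕ; zero; suc; _≤_; _^_; _%_)
open import Data.Nat.Properties using ()
open import Data.Fin as Fin using (Fin; punchIn; toℕ)
open import Data.Fin.Properties using () renaming (_≟_ to _≟ᶠ_)
open import Data.Vec as Vec using (Vec; []; _∷_; lookup; tabulate)
open import Data.Vec.Properties using (≡-dec)
open import Data.List using (List)
open import Data.Bool.ListAction using (any)
open import Data.Bool using (Bool; true; false; if_then_else_; not; _∧_)
open import Data.Product using (Σ; ∃; ∃-syntax; _×_; _,_; proj₁)
open import Data.Sum using (_⊎_)
open import Data.Empty using (⊥)
open import Data.Unit using (⊤)
open import Function using (_∘_)
open import Function.Bundles using (_↔_; Inverse; _⇔_)
open import Function.Definitions using (Injective)
open import Relation.Nullary using (¬_)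
open import Relation.Nullary.Decidable using (⌊_⌋)
open import Relation.Binary.PropositionalEquality using (_≡_; _≢_)
open import Algebra.Structures using (IsCommutativeRing)
open import Data.Nat using () renaming (_≡ᵇ_ to _≡ᵇ_)

-- Finite fields of order q, with carrier Fin q and propositional equality.
-- (Every finite field of order q is isomorphic to such a structure, and the
-- theorem is invariant under field isomorphism.)

record FiniteField (q : ℕ) : Set where
  infixl 7 _*_
  infixl 6 _+_
  field
    _+_ _*_ : Fin q → Fin q → Fin q
    -_      : Fin q → Fin q
    0# 1#   : Fin q
    _⁻¹     : Fin q → Fin q
    isCommutativeRing : IsCommutativeRing _≡_ _+_ _*_ -_ 0# 1#
    0≢1     : 0# ≢ 1#
    ⁻¹-inverse : ∀ x → x ≢ 0# → x * x ⁻¹ ≡ 1#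

module FF {q : ℕ} (F : FiniteField q) where
  open FiniteField F public

  K : Set
  K = Fin q

  pow : K → ℕ → K
  pow x zero    = 1#
  pow x (suc k) = x * pow x k

  IsPrimitiveSixthRoot : K → Set
  IsPrimitiveSixthRoot e = pow e 6 ≡ 1# × pow e 2 ≢ 1# × pow e 3 ≢ 1#

  IsNonSquare : K → Set
  IsNonSquare a = a ≢ 0# × (∀ y → y * y ≢ a)

  IsFieldAut : (K → K) → Set
  IsFieldAut φ = (∀ x y → φ (x + y) ≡ φ x + φ y)
               × (∀ x y → φ (x * y) ≡ φ x * φ y)
               × φ 1# ≡ 1#
               × Injective _≡_ _≡_ φ

  sumF : ∀ {n} → (Fin n → K) → K
  sumF {zero}  f = 0#
  sumF {suc n} f = f Fin.zero + sumF (f ∘ Fin.suc)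

  Matrix : ℕ → Set
  Matrix n = Fin n → Fin n → K

  sign : ∀ {n} → Fin n → K
  sign j = if (toℕ j % 2) ≡ᵇ 0 then 1# else - 1#

  det : ∀ n → Matrix n → K
  det zero    M = 1#
  det (suc n) M = sumF (λ j → sign j * (M Fin.zero j * det n (λ i k → M (Fin.suc i) (punchIn j k))))

  _·_ : ∀ {n} → Matrix n → Vec K n → Vec K n
  A · v = tabulate (λ i → sumF (λ j → A i j * lookup v j))

  isZero : K → Bool
  isZero x = ⌊ x ≟ᶠ 0# ⌋

  firstNZ : ∀ {n} → Vec K n → K
  firstNZ []       = 0#
  firstNZ (x ∷ xs) = if isZero x then firstNZ xs else x

  norm : ∀ {n} → Vec K n → Vec K n
  norm v = Vec.map (λ x → (firstNZ v ⁻¹) * x) v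

  isPointVec : ∀ {n} → Vec K n → Bool
  isPointVec v = not (isZero (firstNZ v)) ∧ ⌊ firstNZ v ≟ᶠ 1# ⌋

  -- Points of PG(n-1,q): non-zero vectors of K^n whose first non-zero
  -- coordinate is 1 (one canonical representative per 1-dim subspace).
  Point : ℕ → Set
  Point n = Σ (Vec K n) (λ v → Data.Bool.T (isPointVec v))
    where import Data.Bool

  vec : ∀ {n} → Point n → Vec K n
  vec = proj₁

  InducedBy : ∀ {n} → Point n ↔ Point n → Matrix n → (K → K) → Set
  InducedBy {n} g A φ = ∀ p → vec (Inverse.to g p) ≡ norm (A · Vec.map φ (vec p))

  InPSL InPGL InPΣL InPΓL : ∀ {n} → Point n ↔ Point n → Set
  InPSL {n} g = ∃[ A ] det n A ≡ 1# × InducedBy g A (λ x → x)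
  InPGL {n} g = ∃[ A ] det n A ≢ 0# × InducedBy g A (λ x → x)
  InPΣL {n} g = ∃[ A ] ∃[ φ ] det n A ≡ 1# × IsFieldAut φ × InducedBy g A φ
  InPΓL {n} g = ∃[ A ] ∃[ φ ] det n A ≢ 0# × IsFieldAut φ × InducedBy g A φ

module _ {X : Set} where

  Perm : Set
  Perm = X ↔ X

  to from : Perm → X → X
  to = Inverse.to
  from = Inverse.from

  _≗ₚ_ : Perm → Perm → Set
  g ≗ₚ h = ∀ x → to g x ≡ to h x

  record IsPermGroup (G : Perm → Set) : Set where
    field
      resp  : ∀ {g h} → g ≗ₚ h → G g → G h
      ident : ∃[ e ] G e × (∀ x → to e x ≡ x)
      comp  : ∀ {g h} → G g → G h → ∃[ k ] G k × (∀ x → to k x ≡ to g (to h x))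
      inv   : ∀ {g} → G g → ∃[ k ] G k × (∀ x → to k x ≡ from g x)

  Subset : Set
  Subset = X → Bool

  _⊆_ : Subset → Subset → Set
  S ⊆ T = ∀ x → S x ≡ true → T x ≡ true

  _≐_ : Subset → Subset → Set
  S ≐ T = ∀ x → S x ≡ T x

  HasSize : Subset → ℕ → Set
  HasSize S k = Σ (Fin k → X) λ f → Injective _≡_ _≡_ f × (∀ x → (S x ≡ true) ⇔ (∃[ i ] f i ≡ x))

  image : Perm → Subset → Subset
  image g S = S ∘ from g

  record SQS : Set₁ where
    field
      Block     : Subset → Set
      resp      : ∀ {B B'} → B ≐ B' → Block B → Block B'
      blockSize : ∀ {B} → Block B → HasSize B 4
      steiner   : ∀ T → HasSize T 3 →
                  ∃[ B ] Block B × T ⊆ B × (∀ B' → Block B' → T ⊆ B' → B' ≐ B)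

  NonTrivial : SQS → Set
  NonTrivial D = ¬ HasSize (λ _ → true) 4

  IsAut : SQS → Perm → Set
  IsAut D g = ∀ B → SQS.Block D B → SQS.Block D (image g B)

  Orbit : (Perm → Set) → Subset → Subset → Set
  Orbit H base S = ∃[ h ] H h × S ≐ image h base

  -- σ transports (D,G) onto (blocks given by Blk, between H₁ and H₂):
  -- σ(D) has block set Blk and H₁ ≤ σGσ⁻¹ ≤ H₂
  Transports : Perm → SQS → (Perm → Set) → (Subset → Set) →
               (Perm → Set) → (Perm → Set) → Set
  Transports σ D G Blk H₁ H₂ =
      (∀ B → (SQS.Block D B → Blk (image σ B)) × (Blk (image σ B) → SQS.Block D B))
    × (∀ h → H₁ h → ∃[ g ] G g × (∀ x → to h x ≡ to σ (to g (from σ x))))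
    × (∀ g → G g → ∃[ h ] H₂ h × (∀ x → to h x ≡ to σ (to g (from σ x))))

-- The classification (n = 2, projective line K ∪ {∞}).
-- Identification: the point with vector (1 , a) is a ∈ K, the point (0 , 1)
-- is ∞; then matrix action is by linear fractional maps.

module _ {q : ℕ} (F : FiniteField q) where
  open FF F

  ptK : K → Vec K 2
  ptK a = 1# ∷ a ∷ []

  pt∞ : Vec K 2
  pt∞ = 0# ∷ 1# ∷ []

  setOf : List (Vec K 2) → Subset {Point 2}
  setOf L p = any (λ w → ⌊ ≡-dec _≟ᶠ_ (vec p) w ⌋) L

  open Data.List using ([]; _∷_)

  -- F_3 ∪ {∞} = {0, 1, -1, ∞}
  base₃ : Subset {Point 2}
  base₃ = setOf (ptK 0# ∷ ptK 1# ∷ ptK (- 1#) ∷ pt∞ ∷ [])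

  baseWith : K → Subset {Point 2}
  baseWith c = setOf (ptK 0# ∷ ptK 1# ∷ ptK c ∷ pt∞ ∷ [])

  Case1 Case2 Case3 : SQS {Point 2} → (Perm {Point 2} → Set) → Set
  Case1 D G = ∃[ d ] q ≡ 3 ^ d × 2 ≤ d × ∃[ σ ]
      (Transports σ D G (Orbit InPGL base₃) InPSL InPΓL
       ⊎ (d % 2 ≡ 1 × Transports σ D G (Orbit InPSL base₃) InPSL InPΓL))
  Case2 D G = q % 12 ≡ 7 × ∃[ ε ] IsPrimitiveSixthRoot ε × ∃[ σ ]
      Transports σ D G (Orbit InPSL (baseWith ε)) InPSL InPΣL
  Case3 D G = ∃[ d ] q ≡ 3 ^ (2 ℕ.* d) × 1 ≤ d × ∃[ a ] IsNonSquare a × ∃[ σ ]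
      Transports σ D G (λ S → Orbit InPSL base₃ S ⊎ Orbit InPSL (baseWith a) S) InPSL InPΣL

  Classified : (n : ℕ) → SQS {FF.Point F n} → (Perm {FF.Point F n} → Set) → Set
  Classified (suc (suc zero)) D G = Case1 D G ⊎ Case2 D G ⊎ Case3 D G
  Classified _ D G = ⊥

{-# OPTIONS --safe #-}
module Submission where

open import Defs
open import Algebra.Bundles using (CommutativeRing)
open import Algebra.Solver.Ring.AlmostCommutativeRing using (fromCommutativeRing; _-Raw-AlmostCommutative⟶_)
import Algebra.Properties.Group as GroupProperties
import Algebra.Properties.AbelianGroup as AbelianGroupProperties
import Algebra.Properties.Ring as RingProperties
import Algebra.Properties.Semiring.Mult.TCOptimised as Multiples
import Algebra.Solver.Ring as RingSolver
open import Data.Bool as Bool using (Bool; true; false; _∨_; T)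
import Data.Bool.Properties as Bool
open import Data.Empty using (⊥)
open import Data.Fin as Fin using (Fin; splitAt; join; combine; remQuot; punchIn)
open import Data.Fin.Properties as Fin using (any?; all?) renaming (_≟_ to _≟ᶠ_)
open import Data.Integer as ℤ using (ℤ; -[1+_]; _⊖_; _◃_)
import Data.Integer.Properties as ℤ
open import Data.Maybe using (Maybe; just; nothing)
open import Data.Nat as ℕ using (ℕ; zero; suc; z≤n; s≤s; _≤_)
import Data.Nat.Properties as ℕ
import Data.Nat.DivMod as ℕ
open import Data.Nat.Divisibility using (divides)
open import Data.Product using (∃-syntax; _×_; _,_; proj₁; proj₂)
open import Data.Sign as Sign using (Sign)
open import Data.Sum using (_⊎_; inj₁; inj₂; [_,_]′)
open import Data.Vec as Vec using (Vec; []; _∷_; lookup)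
import Data.Vec.Properties as Vec
open import Function using (_∘_; id)
open import Function.Bundles using (_⇔_; Inverse; Equivalence; mk⇔; mk↔ₛ′)
open import Function.Construct.Symmetry using (↔-sym)
open import Function.Definitions using (Injective)
open import Relation.Binary.PropositionalEquality as ≡ using (_≡_; _≢_; refl; sym; trans; cong; cong₂; subst; module ≡-Reasoning)
open import Relation.Nullary using (¬_; Dec; yes; no; contradiction)
open import Relation.Nullary.Decidable using (⌊_⌋; ¬?; _⊎-dec_; _→-dec_; from-yes)

-- Three points determine their block, so an automorphism fixing three points of a block fixes the fourth.
--
-- For n ≥ 3 the fourth point p of the block through e₀, e₁, e₂ lies neither on the side e₀e₁ nor on e₁e₂
-- (a transvection fixes three of the four points and moves the remaining one), and then the diagonal
-- matrices diag(a, a⁻¹, 1, …, 1) fix p only if a = 1.  Hence q = 2, and there a transvection moves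
-- the fourth point of the block through the three points of a line.
--
-- For n = 2 let {0, 1, ∞, c} be a block.  The rotation x ↦ 1/(1−x) gives c² − c + 1 = 0; if −1 is a square,
-- the reflection x ↦ 1−x is in L₂(q) too and c = 1 − c, so that 3 = 0 and c = −1.  As PGL₂(q) normalises
-- L₂(q), this applies to all PGL₂(q)-translates of the design: if 3 = 0, the blocks are the images of
-- {0, 1, −1, ∞} under PGL₂(q).  Otherwise −1 is a non-square, L₂(q) is transitive on the triples, c is a
-- primitive sixth root of unity, and q ≡ 7 (mod 12) by counting orbits of {x, −x, 1/x, −1/x} and of
-- multiplication by −c.  A permutation normalising L₂(q) and fixing 0 and ∞ is additive, because it
-- normalises the translations, and multiplicative up to a factor u on squares, hence of the form u φ(x) with φ
-- a field automorphism; in the second case φ fixes c, and a non-square u would map c to 1 − c.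
--
-- The two base blocks of case (3) share the points 0, 1, ∞, so that they cannot both belong to a Steiner
-- quadruple system: no 𝒟 satisfies (3), and for q = 3²ᵈ the only design is the one of (1).

-- A field is given only as operations on `Fin q`, so q = 3ᵈ and q ≡ 7 (mod 12) have to be extracted
-- from those operations. Both come from one greedy scheme: a set of known size, closed under some
-- maps, is enlarged until it fills the carrier. That every element is a square or minus a square,
-- when -1 is not a square, comes from the pigeonhole principle instead of the cyclicity of the
-- multiplicative group. Even q is not a separate case on the line: there -1 = 1 is a square, so the
-- reflection x ↦ 1-x is available and forces 3 = 0, which is false for even q. Hence 2 ≠ 0 wherever
-- the polarisation identity for squares is used. In the backward direction 𝒟 is already a Steiner
-- system whose image under σ has the listed blocks. The relations for the fourth point therefore
-- hold in it as well, and they decide which maps preserve the orbit. To avoid dividing by leading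
-- coordinates at every step, points are handled through arbitrary representatives, and matrices
-- through inverses up to a scalar.

-- Polynomial identities with integer coefficients in a commutative ring.

module IntegerSolver {a ℓ} (R : CommutativeRing a ℓ) where
  open CommutativeRing R renaming (refl to ≈-refl; sym to ≈-sym; trans to ≈-trans; setoid to ≈-setoid)
  open import Relation.Binary.Reasoning.Setoid ≈-setoid
  open RingProperties ring
  open GroupProperties +-group using (ε⁻¹≈ε; ⁻¹-involutive)
  open AbelianGroupProperties +-abelianGroup using (⁻¹-∙-comm)
  open Multiples semiring using (1+×; ×-homo-+; ×1-homo-*) renaming (_×_ to _×ᵐ_)

  -- With this form of multiples, 0 and 1 are sent to `0#` and `1#` by computation, so the constants
  -- of the solver are those of the ring. Integer coefficients make normal forms comparable by
  -- deciding equality in ℤ.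
  fromℤ : ℤ → Carrier
  fromℤ (ℤ.+ n)      = n ×ᵐ 1#
  fromℤ (-[1+ n ]) = - (suc n ×ᵐ 1#)

  fromℤ-⊖ : ∀ m n → fromℤ (m ⊖ n) ≈ m ×ᵐ 1# + - (n ×ᵐ 1#)
  fromℤ-⊖ m zero = begin
    m ×ᵐ 1#          ≈⟨ +-identityʳ _ ⟨
    m ×ᵐ 1# + 0#     ≈⟨ +-congˡ ε⁻¹≈ε ⟨
    m ×ᵐ 1# + - 0#   ∎
  fromℤ-⊖ zero (suc n) = ≈-sym (+-identityˡ _)
  fromℤ-⊖ (suc m) (suc n) rewrite ℤ.[1+m]⊖[1+n]≡m⊖n m n = begin
    fromℤ (m ⊖ n)                            ≈⟨ fromℤ-⊖ m n ⟩
    M + - N                                  ≈⟨ +-congʳ (+-identityʳ M) ⟨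
    M + 0# + - N                             ≈⟨ +-congʳ (+-congˡ (-‿inverseʳ 1#)) ⟨
    M + (1# + - 1#) + - N                    ≈⟨ +-congʳ (+-assoc _ _ _) ⟨
    M + 1# + - 1# + - N                      ≈⟨ +-assoc _ _ _ ⟩
    M + 1# + (- 1# + - N)                    ≈⟨ +-cong (+-comm M 1#) (⁻¹-∙-comm 1# N) ⟩
    1# + M + - (1# + N)                      ≈⟨ +-cong (1+× m 1#) (-‿cong (1+× n 1#)) ⟨
    suc m ×ᵐ 1# + - (suc n ×ᵐ 1#)            ∎
    where
    M = m ×ᵐ 1#
    N = n ×ᵐ 1#

  fromℤ-+◃ : ∀ n → fromℤ (Sign.+ ◃ n) ≈ n ×ᵐ 1#
  fromℤ-+◃ zero    = ≈-refl
  fromℤ-+◃ (suc n) = ≈-refl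

  fromℤ--◃ : ∀ n → fromℤ (Sign.- ◃ n) ≈ - (n ×ᵐ 1#)
  fromℤ--◃ zero    = ≈-sym ε⁻¹≈ε
  fromℤ--◃ (suc n) = ≈-refl

  fromℤ-+ : ∀ i j → fromℤ (i ℤ.+ j) ≈ fromℤ i + fromℤ j
  fromℤ-+ (ℤ.+ m)      (ℤ.+ n)      = ×-homo-+ 1# m n
  fromℤ-+ (ℤ.+ m)      (-[1+ n ]) = fromℤ-⊖ m (suc n)
  fromℤ-+ (-[1+ m ]) (ℤ.+ n)      = ≈-trans (fromℤ-⊖ n (suc m)) (+-comm _ _)
  fromℤ-+ (-[1+ m ]) (-[1+ n ]) = begin
    - (suc (suc (m ℕ.+ n)) ×ᵐ 1#)         ≡⟨ ≡.cong (λ k → - (suc k ×ᵐ 1#)) (ℕ.+-suc m n) ⟨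
    - ((suc m ℕ.+ suc n) ×ᵐ 1#)           ≈⟨ -‿cong (×-homo-+ 1# (suc m) (suc n)) ⟩
    - (suc m ×ᵐ 1# + suc n ×ᵐ 1#)         ≈⟨ ⁻¹-∙-comm _ _ ⟨
    - (suc m ×ᵐ 1#) + - (suc n ×ᵐ 1#)     ∎

  fromℤ-* : ∀ i j → fromℤ (i ℤ.* j) ≈ fromℤ i * fromℤ j
  fromℤ-* (ℤ.+ m)      (ℤ.+ n)      = ≈-trans (fromℤ-+◃ (m ℕ.* n)) (×1-homo-* m n)
  fromℤ-* (ℤ.+ m)      (-[1+ n ]) = begin
    fromℤ (Sign.- ◃ (m ℕ.* suc n))      ≈⟨ fromℤ--◃ (m ℕ.* suc n) ⟩
    - ((m ℕ.* suc n) ×ᵐ 1#)             ≈⟨ -‿cong (×1-homo-* m (suc n)) ⟩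
    - (m ×ᵐ 1# * (suc n ×ᵐ 1#))         ≈⟨ -‿distribʳ-* _ _ ⟩
    m ×ᵐ 1# * - (suc n ×ᵐ 1#)           ∎
  fromℤ-* (-[1+ m ]) (ℤ.+ n)      = begin
    fromℤ (Sign.- ◃ (suc m ℕ.* n))      ≈⟨ fromℤ--◃ (suc m ℕ.* n) ⟩
    - ((suc m ℕ.* n) ×ᵐ 1#)             ≈⟨ -‿cong (×1-homo-* (suc m) n) ⟩
    - (suc m ×ᵐ 1# * (n ×ᵐ 1#))         ≈⟨ -‿distribˡ-* _ _ ⟩
    - (suc m ×ᵐ 1#) * (n ×ᵐ 1#)         ∎
  fromℤ-* (-[1+ m ]) (-[1+ n ]) = begin
    fromℤ (Sign.+ ◃ (suc m ℕ.* suc n))      ≈⟨ fromℤ-+◃ (suc m ℕ.* suc n) ⟩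
    (suc m ℕ.* suc n) ×ᵐ 1#                 ≈⟨ ×1-homo-* (suc m) (suc n) ⟩
    suc m ×ᵐ 1# * (suc n ×ᵐ 1#)             ≈⟨ ⁻¹-involutive _ ⟨
    - (- (suc m ×ᵐ 1# * (suc n ×ᵐ 1#)))     ≈⟨ -‿cong (-‿distribˡ-* _ _) ⟩
    - (- (suc m ×ᵐ 1#) * (suc n ×ᵐ 1#))     ≈⟨ -‿distribʳ-* _ _ ⟩
    - (suc m ×ᵐ 1#) * - (suc n ×ᵐ 1#)       ∎

  fromℤ-neg : ∀ i → fromℤ (ℤ.- i) ≈ - fromℤ i
  fromℤ-neg (ℤ.+ zero)   = ≈-sym ε⁻¹≈ε
  fromℤ-neg (ℤ.+ suc n)  = ≈-refl
  fromℤ-neg (-[1+ n ]) = ≈-sym (⁻¹-involutive _)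

  morphism : ℤ.+-*-rawRing -Raw-AlmostCommutative⟶ fromCommutativeRing R
  morphism = record
    { ⟦_⟧    = fromℤ
    ; +-homo = fromℤ-+
    ; *-homo = fromℤ-*
    ; -‿homo = fromℤ-neg
    ; 0-homo = ≈-refl
    ; 1-homo = ≈-refl
    }

  fromℤ-≟ : ∀ i j → Maybe (fromℤ i ≈ fromℤ j)
  fromℤ-≟ i j with i ℤ.≟ j
  ... | yes i≡j = just (reflexive (≡.cong fromℤ i≡j))
  ... | no _    = nothing

  open RingSolver ℤ.+-*-rawRing (fromCommutativeRing R) morphism fromℤ-≟ public
    using (Polynomial; solve; _:+_; _:*_; :-_; _:-_; _:=_; con)

-- Pigeonhole principle and counting by orbits.

injective⇒surjective : ∀ {n} (f : Fin n → Fin n) → Injective _≡_ _≡_ f → ∀ y → ∃[ x ] f x ≡ y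
injective⇒surjective {n} f f-inj y with any? (λ x → f x ≟ᶠ y)
... | yes p = p
... | no ∄  = contradiction (Fin.injective⇒≤ g-inj) ℕ.1+n≰n
  where
  g : Fin (suc n) → Fin n
  g Fin.zero    = y
  g (Fin.suc x) = f x
  g-inj : Injective _≡_ _≡_ g
  g-inj {Fin.zero}  {Fin.zero}  _  = refl
  g-inj {Fin.zero}  {Fin.suc x} eq = contradiction (x , sym eq) ∄
  g-inj {Fin.suc x} {Fin.zero}  eq = contradiction (x , eq) ∄
  g-inj {Fin.suc x} {Fin.suc _} eq = cong Fin.suc (f-inj eq)

surjective⊎missed : ∀ {m n} (e : Fin m → Fin n) → Injective _≡_ _≡_ e →
                    m ≡ n ⊎ ∃[ y ] ∀ i → e i ≢ y
surjective⊎missed {m} {n} e e-inj with all? (λ y → any? (λ i → e i ≟ᶠ y))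
... | yes onto = inj₁ (ℕ.≤-antisym (Fin.injective⇒≤ e-inj) (Fin.injective⇒≤ section-inj))
  where
  section-inj : Injective _≡_ _≡_ (proj₁ ∘ onto)
  section-inj {x} {y} eq = trans (sym (proj₂ (onto x))) (trans (cong e eq) (proj₂ (onto y)))
... | no ¬onto with y , ∄ ← Fin.¬∀⟶∃¬ n _ (λ y → any? (λ i → e i ≟ᶠ y)) ¬onto = inj₂ (y , λ i eq → ∄ (i , eq))

-- Takes the place of choosing a maximal substructure. The recursion runs on a bound k for the room
-- q - N that is left.
grow-to : (P : ℕ → Set) (q : ℕ) → (∀ {N} → P N → N ℕ.≤ q) →
          (∀ {N} → P N → N ≡ q ⊎ ∃[ N′ ] N ℕ.< N′ × P N′) → ∀ {N} → P N → P q
grow-to P q bound step {N} = go q (ℕ.m≤m+n q N)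
  where
  go : ∀ k {N} → q ℕ.≤ k ℕ.+ N → P N → P q
  go k {N} q≤k+N p with step p
  ... | inj₁ N≡q = subst P N≡q p
  go zero {N} q≤N p | inj₂ (N′ , N<N′ , p′) = contradiction (ℕ.≤-trans N<N′ (bound p′)) (ℕ.≤⇒≯ q≤N)
  go (suc k) {N} q≤k+N p | inj₂ (N′ , N<N′ , p′) =
    go k (ℕ.≤-trans q≤k+N (ℕ.≤-trans (ℕ.≤-reflexive (sym (ℕ.+-suc k N))) (ℕ.+-monoʳ-≤ k N<N′))) p′

-- A group acting freely outside an invariant set of N₀ points.
module FreeOrbits {q m : ℕ} (τ : Fin m → Fin q → Fin q) (0<m : 0 ℕ.< m)
  (τ-comp : ∀ i j x → ∃[ k ] τ i (τ j x) ≡ τ k x)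
  (τ-back : ∀ j x → ∃[ k ] τ k (τ j x) ≡ x)
  {N₀ : ℕ} (e₀ : Fin N₀ → Fin q) (e₀-inj : Injective _≡_ _≡_ e₀)
  (e₀-closed : ∀ j i → ∃[ i′ ] e₀ i′ ≡ τ j (e₀ i))
  (free : ∀ x → (∀ i → e₀ i ≢ x) → Injective _≡_ _≡_ (λ j → τ j x))
  where

  -- `contains` keeps the exceptional points inside at every stage, so that a missed point always
  -- has a free orbit.
  record UnionOfOrbits (N : ℕ) : Set where
    field
      enum     : Fin N → Fin q
      injec    : Injective _≡_ _≡_ enum
      closed   : ∀ j i → ∃[ i′ ] enum i′ ≡ τ j (enum i)
      contains : ∀ i → ∃[ i′ ] enum i′ ≡ e₀ i
      size     : ∃[ k ] N ≡ N₀ ℕ.+ k ℕ.* m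

  addOrbit : ∀ {N} (U : UnionOfOrbits N) → (∃[ y ] ∀ i → UnionOfOrbits.enum U i ≢ y) → UnionOfOrbits (N ℕ.+ m)
  addOrbit {N} U (y , y∉) = record
    { enum     = h ∘ splitAt N
    ; injec    = λ {i} {i′} eq → trans (sym (Fin.join-splitAt N m i))
                   (trans (cong (join N m) (h-inj (splitAt N i) (splitAt N i′) eq)) (Fin.join-splitAt N m i′))
    ; closed   = λ j i → let s , eq = h-closed j (splitAt N i) in lift s eq
    ; contains = λ i → let i′ , eq = contains i in lift (inj₁ i′) eq
    ; size     = suc (proj₁ size) , trans (cong (ℕ._+ m) (proj₂ size)) (trans (ℕ.+-assoc N₀ _ m)
                   (cong (N₀ ℕ.+_) (ℕ.+-comm (proj₁ size ℕ.* m) m)))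
    }
    where
    open UnionOfOrbits U
    h : Fin N ⊎ Fin m → Fin q
    h (inj₁ i) = enum i
    h (inj₂ j) = τ j y
    lift : ∀ s {z} → h s ≡ z → ∃[ i′ ] h (splitAt N i′) ≡ z
    lift s eq = join N m s , trans (cong h (Fin.splitAt-join N m s)) eq
    -- If the orbit of y met the union, moving the common point back along `τ-back` would put y into
    -- the union.
    disjoint : ∀ i j → enum i ≢ τ j y
    disjoint i j eq with k , back ← τ-back j y with i′ , eq′ ← closed k i =
      y∉ i′ (trans eq′ (trans (cong (τ k) eq) back))
    h-inj : ∀ s t → h s ≡ h t → s ≡ t
    h-inj (inj₁ i) (inj₁ i′) eq = cong inj₁ (injec eq)
    h-inj (inj₁ i) (inj₂ j)  eq = contradiction eq (disjoint i j)
    h-inj (inj₂ j) (inj₁ i)  eq = contradiction (sym eq) (disjoint i j)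
    h-inj (inj₂ j) (inj₂ j′) eq = cong inj₂ (free y (λ i eq → let i′ , eq′ = contains i in y∉ i′ (trans eq′ eq)) eq)
    h-closed : ∀ j s → ∃[ s′ ] h s′ ≡ τ j (h s)
    h-closed j (inj₁ i)  = let i′ , eq = closed j i in inj₁ i′ , eq
    h-closed j (inj₂ j′) = let k , eq = τ-comp j j′ y in inj₂ k , sym eq

  cardinality : ∃[ k ] q ≡ N₀ ℕ.+ k ℕ.* m
  cardinality = UnionOfOrbits.size (grow-to UnionOfOrbits q (λ U → Fin.injective⇒≤ (UnionOfOrbits.injec U)) step start)
    where
    start : UnionOfOrbits N₀
    start = record
      { enum = e₀ ; injec = e₀-inj ; closed = e₀-closed ; contains = λ i → i , refl
      ; size = 0 , sym (ℕ.+-identityʳ N₀) }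
    step : ∀ {N} → UnionOfOrbits N → N ≡ q ⊎ ∃[ N′ ] N ℕ.< N′ × UnionOfOrbits N′
    step {N} U with surjective⊎missed (UnionOfOrbits.enum U) (UnionOfOrbits.injec U)
    ... | inj₁ N≡q    = inj₁ N≡q
    ... | inj₂ missed = inj₂ (N ℕ.+ m , ℕ.m<m+n N 0<m , addOrbit U missed)

-- Field arithmetic and squares.

module FieldTheory {q : ℕ} (F : FiniteField q) where
  open FF F public

  commutativeRing : CommutativeRing _ _
  commutativeRing = record { isCommutativeRing = isCommutativeRing }

  open CommutativeRing commutativeRing public
    using (+-assoc; +-comm; +-identityˡ; +-identityʳ; *-assoc; *-comm; *-identityˡ; *-identityʳ; zeroˡ; zeroʳ; -‿inverseʳ)
  open IntegerSolver commutativeRing public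

  :0 :1 : ∀ {n} → Polynomial n
  :0 = con (ℤ.+ 0)
  :1 = con (ℤ.+ 1)

  1≢0 : 1# ≢ 0#
  1≢0 eq = 0≢1 (sym eq)

  x-y≡0⇒x≡y : ∀ {x y} → x + - y ≡ 0# → x ≡ y
  x-y≡0⇒x≡y {x} {y} eq = trans (solve 2 (λ x y → x := (x :- y) :+ y) refl x y) (trans (cong (_+ y) eq) (+-identityˡ y))

  x≡y⇒x-y≡0 : ∀ {x y} → x ≡ y → x + - y ≡ 0#
  x≡y⇒x-y≡0 {x} refl = -‿inverseʳ x

  ⁻¹-inverseˡ : ∀ {x} → x ≢ 0# → x ⁻¹ * x ≡ 1#
  ⁻¹-inverseˡ {x} x≢0 = trans (*-comm _ x) (⁻¹-inverse x x≢0)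

  *-cancelˡ : ∀ {z x y} → z ≢ 0# → z * x ≡ z * y → x ≡ y
  *-cancelˡ {z} {x} {y} z≢0 eq = trans (sym (undo x)) (trans (cong (z ⁻¹ *_) eq) (undo y))
    where
    undo : ∀ x → z ⁻¹ * (z * x) ≡ x
    undo x = trans (sym (*-assoc _ z x)) (trans (cong (_* x) (⁻¹-inverseˡ z≢0)) (*-identityˡ x))

  *-cancelˡ-0 : ∀ {z x} → z ≢ 0# → z * x ≡ 0# → x ≡ 0#
  *-cancelˡ-0 {z} z≢0 eq = *-cancelˡ z≢0 (trans eq (sym (zeroʳ z)))

  *-integral : ∀ {x y} → x * y ≡ 0# → x ≡ 0# ⊎ y ≡ 0#
  *-integral {x} eq with x ≟ᶠ 0#
  ... | yes x≡0 = inj₁ x≡0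
  ... | no x≢0  = inj₂ (*-cancelˡ-0 x≢0 eq)

  *-nonzero : ∀ {x y} → x ≢ 0# → y ≢ 0# → x * y ≢ 0#
  *-nonzero x≢0 y≢0 eq = y≢0 (*-cancelˡ-0 x≢0 eq)

  *≡1⇒nonzeroˡ : ∀ {x y} → x * y ≡ 1# → x ≢ 0#
  *≡1⇒nonzeroˡ {y = y} eq refl = 0≢1 (trans (sym (zeroˡ y)) eq)

  *≡1⇒nonzeroʳ : ∀ {x y} → x * y ≡ 1# → y ≢ 0#
  *≡1⇒nonzeroʳ {x} {y} eq = *≡1⇒nonzeroˡ (trans (*-comm y x) eq)

  ⁻¹-nonzero : ∀ {x} → x ≢ 0# → x ⁻¹ ≢ 0#
  ⁻¹-nonzero x≢0 = *≡1⇒nonzeroʳ (⁻¹-inverse _ x≢0)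

  -x≡0⇒x≡0 : ∀ {x} → - x ≡ 0# → x ≡ 0#
  -x≡0⇒x≡0 {x} eq = trans (solve 1 (λ x → x := :- (:- x)) refl x) (trans (cong -_ eq) (solve 0 (:- :0 := :0) refl))

  sq≡0⇒≡0 : ∀ {x} → x * x ≡ 0# → x ≡ 0#
  sq≡0⇒≡0 eq with *-integral eq
  ... | inj₁ p = p
  ... | inj₂ p = p

  sq≡sq⇒± : ∀ {x y} → x * x ≡ y * y → x ≡ y ⊎ x ≡ - y
  sq≡sq⇒± {x} {y} eq with *-integral {x + - y} {x + y}
      (trans (solve 2 (λ x y → (x :- y) :* (x :+ y) := x :* x :- y :* y) refl x y) (x≡y⇒x-y≡0 eq))
  ... | inj₁ p = inj₁ (x-y≡0⇒x≡y p)
  ... | inj₂ p = inj₂ (x-y≡0⇒x≡y (trans (solve 2 (λ x y → x :- (:- y) := x :+ y) refl x y) p))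

  -- The solver proves only identities valid in every commutative ring. A relation e = 0 special to
  -- this field enters here, with an explicit cofactor k.
  modulo : ∀ {x y e} k → e ≡ 0# → x ≡ y + k * e → x ≡ y
  modulo {y = y} k refl eq = trans eq (solve 2 (λ y k → y :+ k :* :0 := y) refl y k)

  IsSquare : K → Set
  IsSquare x = ∃[ y ] y * y ≡ x

  -1-square⇐ratio : ∀ {x y} → y ≢ 0# → x * x ≡ - (y * y) → IsSquare (- 1#)
  -1-square⇐ratio {x} {y} y≢0 eq = x * y ⁻¹ , trans
    (solve 2 (λ x z → (x :* z) :* (x :* z) := (x :* x) :* (z :* z)) refl x (y ⁻¹)) (trans (cong (_* (y ⁻¹ * y ⁻¹)) eq)
    (trans (solve 2 (λ y z → (:- (y :* y)) :* (z :* z) := :- ((y :* z) :* (y :* z))) refl y (y ⁻¹))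
    (trans (cong (λ t → - (t * t)) (⁻¹-inverse y y≢0)) (solve 0 (:- (:1 :* :1) := :- :1) refl))))

  -- The map sending one of x, −x to x² and the other to −x² is injective, hence onto.
  module NonsquareMinusOne (-1∉□ : ¬ IsSquare (- 1#)) where

    1≢-1 : 1# ≢ - 1#
    1≢-1 eq = -1∉□ (1# , trans (*-identityˡ 1#) eq)

    2≢0 : 1# + 1# ≢ 0#
    2≢0 eq = 1≢-1 (x-y≡0⇒x≡y (trans (solve 0 (:1 :- (:- :1) := :1 :+ :1) refl) eq))

    x≡-x⇒x≡0 : ∀ {x} → x ≡ - x → x ≡ 0#
    x≡-x⇒x≡0 {x} eq = *-cancelˡ-0 2≢0 (trans (solve 1 (λ x → (:1 :+ :1) :* x := x :- (:- x)) refl x) (x≡y⇒x-y≡0 eq))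

    -- The order of `Fin q` is unrelated to the field; it merely selects one element from each pair
    -- x, -x.
    signedSquare : K → K
    signedSquare x with x Fin.≤? - x
    ... | yes _ = x * x
    ... | no _  = - (x * x)

    -- For x ≠ 0 the quotient y/x would be a square root of -1, so both elements are 0.
    -[xx]≡yy⇒x≡y : ∀ {x y} → - (x * x) ≡ y * y → x ≡ y
    -[xx]≡yy⇒x≡y {x} {y} eq with x ≟ᶠ 0#
    ... | no x≢0 = contradiction (-1-square⇐ratio x≢0 (sym eq)) -1∉□
    ... | yes refl = sym (sq≡0⇒≡0 (trans (sym eq) (solve 0 (:- (:0 :* :0) := :0) refl)))

    -- Of two opposite elements, exactly the smaller gets the sign +.
    opposite : ∀ {x y} → x ≡ - y → (x Fin.≤ - x → y Fin.≤ - y → x ≡ y) × (¬ (x Fin.≤ - x) → ¬ (y Fin.≤ - y) → x ≡ y)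
    opposite {x} {y} x≡-y =
        (λ p p′ → Fin.≤-antisym (subst (x Fin.≤_) -x≡y p) (subst (y Fin.≤_) (sym x≡-y) p′))
      , (λ p p′ → contradiction (subst (x Fin.≤_) (sym -x≡y) (ℕ.<⇒≤ (ℕ.≰⇒> (λ le → p′ (subst (y Fin.≤_) x≡-y le))))) p)
      where
      -x≡y : - x ≡ y
      -x≡y = trans (cong -_ x≡-y) (solve 1 (λ y → :- (:- y) := y) refl y)

    signedSquare-injective : Injective _≡_ _≡_ signedSquare
    signedSquare-injective {x} {y} eq with x Fin.≤? - x | y Fin.≤? - y
    ... | yes _ | no _  = sym (-[xx]≡yy⇒x≡y (sym eq))
    ... | no _  | yes _ = -[xx]≡yy⇒x≡y eq
    ... | yes p | yes p′ with sq≡sq⇒± eq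
    ...   | inj₁ x≡y  = x≡y
    ...   | inj₂ x≡-y = proj₁ (opposite x≡-y) p p′
    signedSquare-injective {x} {y} eq | no p | no p′
      with sq≡sq⇒± (trans (solve 2 (λ x y → x :* x := :- (:- (x :* x))) refl x y)
             (trans (cong -_ eq) (solve 2 (λ x y → :- (:- (y :* y)) := y :* y) refl x y)))
    ...   | inj₁ x≡y  = x≡y
    ...   | inj₂ x≡-y = proj₂ (opposite x≡-y) p p′

    square⊎neg-square : ∀ z → IsSquare z ⊎ IsSquare (- z)
    square⊎neg-square z with x , eq ← injective⇒surjective signedSquare signedSquare-injective z | x Fin.≤? - x
    ... | yes _ = inj₁ (x , eq)
    ... | no _  = inj₂ (x , trans (solve 1 (λ x → x :* x := :- (:- (x :* x))) refl x) (cong -_ eq))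

-- The order of the field modulo 3 and 4, and in characteristic 3.

module Cardinality {q : ℕ} (F : FiniteField q) where
  open FieldTheory F

  3≡0 : Set
  3≡0 = 1# + 1# + 1# ≡ 0#

  -- Multiplication by 1, ω, ω² is free outside {0}, since these three powers are distinct.
  cubeRoot⇒q≡1+3k : ∀ ω → ω * ω * ω ≡ 1# → ω ≢ 1# → ∃[ k ] q ≡ 1 ℕ.+ k ℕ.* 3
  cubeRoot⇒q≡1+3k ω ω³≡1 ω≢1 = FreeOrbits.cardinality τ (s≤s z≤n) τ-comp τ-back {N₀ = 1}
      (λ _ → 0#) (λ { {Fin.zero} {Fin.zero} _ → refl }) (λ j _ → Fin.zero , sym (τ-0 j)) free
    where
    τ : Fin 3 → K → K
    τ Fin.zero                      x = x
    τ (Fin.suc Fin.zero)            x = ω * x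
    τ (Fin.suc (Fin.suc Fin.zero))  x = ω * ω * x

    τ-0 : ∀ j → τ j 0# ≡ 0#
    τ-0 Fin.zero                     = refl
    τ-0 (Fin.suc Fin.zero)           = zeroʳ ω
    τ-0 (Fin.suc (Fin.suc Fin.zero)) = zeroʳ (ω * ω)

    e : ω * ω * ω + - 1# ≡ 0#
    e = x≡y⇒x-y≡0 ω³≡1

    τ-comp : ∀ i j x → ∃[ k ] τ i (τ j x) ≡ τ k x
    τ-comp Fin.zero j x = j , refl
    τ-comp i Fin.zero x = i , refl
    τ-comp (Fin.suc Fin.zero) (Fin.suc Fin.zero) x = Fin.suc (Fin.suc Fin.zero) , sym (*-assoc ω ω x)
    τ-comp (Fin.suc Fin.zero) (Fin.suc (Fin.suc Fin.zero)) x = Fin.zero ,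
      modulo x e (solve 2 (λ ω x → ω :* (ω :* ω :* x) := x :+ x :* (ω :* ω :* ω :- :1)) refl ω x)
    τ-comp (Fin.suc (Fin.suc Fin.zero)) (Fin.suc Fin.zero) x = Fin.zero ,
      modulo x e (solve 2 (λ ω x → ω :* ω :* (ω :* x) := x :+ x :* (ω :* ω :* ω :- :1)) refl ω x)
    τ-comp (Fin.suc (Fin.suc Fin.zero)) (Fin.suc (Fin.suc Fin.zero)) x = Fin.suc Fin.zero ,
      modulo (ω * x) e (solve 2 (λ ω x → ω :* ω :* (ω :* ω :* x) := ω :* x :+ ω :* x :* (ω :* ω :* ω :- :1)) refl ω x)

    τ-back : ∀ j x → ∃[ k ] τ k (τ j x) ≡ x
    τ-back Fin.zero x = Fin.zero , refl
    τ-back (Fin.suc Fin.zero) x = Fin.suc (Fin.suc Fin.zero) , proj₂ (τ-comp (Fin.suc (Fin.suc Fin.zero)) (Fin.suc Fin.zero) x)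
    τ-back (Fin.suc (Fin.suc Fin.zero)) x = Fin.suc Fin.zero , proj₂ (τ-comp (Fin.suc Fin.zero) (Fin.suc (Fin.suc Fin.zero)) x)

    ω²≢1 : ω * ω ≢ 1#
    ω²≢1 eq = ω≢1 (trans (sym (*-identityˡ ω)) (trans (cong (_* ω) (sym eq)) ω³≡1))

    ω²≢ω : ω * ω ≢ ω
    ω²≢ω eq = ω²≢1 (trans (cong (_* ω) (sym eq)) ω³≡1)

    cancel : ∀ {a b x} → x ≢ 0# → a * x ≡ b * x → a ≡ b
    cancel {a} {b} {x} x≢0 eq = *-cancelˡ x≢0 (trans (*-comm x a) (trans eq (*-comm b x)))

    free : ∀ x → (∀ i → 0# ≢ x) → Injective _≡_ _≡_ (λ j → τ j x)
    free x x∉ = inj _ _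
      where
      x≢0 : x ≢ 0#
      x≢0 eq = x∉ (Fin.zero {0}) (sym eq)
      inj : ∀ i j → τ i x ≡ τ j x → i ≡ j
      inj Fin.zero Fin.zero _ = refl
      inj (Fin.suc Fin.zero) (Fin.suc Fin.zero) _ = refl
      inj (Fin.suc (Fin.suc Fin.zero)) (Fin.suc (Fin.suc Fin.zero)) _ = refl
      inj Fin.zero (Fin.suc Fin.zero) eq = contradiction (cancel x≢0 (sym (trans (*-identityˡ x) eq))) ω≢1
      inj (Fin.suc Fin.zero) Fin.zero eq = contradiction (cancel x≢0 (trans eq (sym (*-identityˡ x)))) ω≢1
      inj Fin.zero (Fin.suc (Fin.suc Fin.zero)) eq = contradiction (cancel x≢0 (sym (trans (*-identityˡ x) eq))) ω²≢1
      inj (Fin.suc (Fin.suc Fin.zero)) Fin.zero eq = contradiction (cancel x≢0 (trans eq (sym (*-identityˡ x)))) ω²≢1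
      inj (Fin.suc Fin.zero) (Fin.suc (Fin.suc Fin.zero)) eq = contradiction (cancel x≢0 (sym eq)) ω²≢ω
      inj (Fin.suc (Fin.suc Fin.zero)) (Fin.suc Fin.zero) eq = contradiction (cancel x≢0 eq) ω²≢ω

  -- The orbits of x ↦ −x, 1/x outside {0, 1, −1} have four elements, since x² = −1 is impossible.
  -1-nonsquare⇒q≡3+4k : ¬ IsSquare (- 1#) → ∃[ k ] q ≡ 3 ℕ.+ k ℕ.* 4
  -1-nonsquare⇒q≡3+4k -1∉□ = FreeOrbits.cardinality τ (s≤s z≤n) τ-comp τ-back e₀ (e₀-inj _ _) e₀-closed free
    where
    open NonsquareMinusOne -1∉□

    -- The value of `0# ⁻¹` is unspecified. Setting it to 0 makes inversion an involution of the
    -- whole carrier, as the orbit count requires.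
    inv₀ : K → K
    inv₀ x with x ≟ᶠ 0#
    ... | yes _ = 0#
    ... | no _  = x ⁻¹

    inv₀-0 : inv₀ 0# ≡ 0#
    inv₀-0 with 0# ≟ᶠ 0#
    ... | yes _   = refl
    ... | no  0≢0 = contradiction refl 0≢0

    inv₀-unique : ∀ {x y} → x * y ≡ 1# → inv₀ x ≡ y
    inv₀-unique {x} eq with x ≟ᶠ 0#
    ... | yes x≡0 = contradiction x≡0 (*≡1⇒nonzeroˡ eq)
    ... | no x≢0  = *-cancelˡ x≢0 (trans (⁻¹-inverse x x≢0) (sym eq))

    inv₀-inverse : ∀ {x} → x ≢ 0# → x * inv₀ x ≡ 1#
    inv₀-inverse {x} x≢0 with x ≟ᶠ 0#
    ... | yes x≡0 = contradiction x≡0 x≢0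
    ... | no _    = ⁻¹-inverse x x≢0

    inv₀-involutive : ∀ x → inv₀ (inv₀ x) ≡ x
    inv₀-involutive x with x ≟ᶠ 0#
    ... | yes refl = inv₀-0
    ... | no x≢0   = inv₀-unique (⁻¹-inverseˡ x≢0)

    -0≡0 : - 0# ≡ 0#
    -0≡0 = solve 0 (:- :0 := :0) refl

    neg-neg : ∀ x → - (- x) ≡ x
    neg-neg = solve 1 (λ x → :- (:- x) := x) refl

    inv₀-neg : ∀ x → inv₀ (- x) ≡ - inv₀ x
    inv₀-neg x = case (x ≟ᶠ 0#)
      where
      case : Dec (x ≡ 0#) → inv₀ (- x) ≡ - inv₀ x
      case (yes refl) = trans (cong inv₀ -0≡0) (trans inv₀-0 (sym (trans (cong -_ inv₀-0) -0≡0)))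
      case (no x≢0)   = inv₀-unique (trans (solve 2 (λ x y → (:- x) :* (:- y) := x :* y) refl x (inv₀ x)) (inv₀-inverse x≢0))

    pattern one   = Fin.suc Fin.zero
    pattern two   = Fin.suc (Fin.suc Fin.zero)
    pattern three = Fin.suc (Fin.suc (Fin.suc Fin.zero))

    τ : Fin 4 → K → K
    τ Fin.zero x = x
    τ one      x = - x
    τ two      x = inv₀ x
    τ three    x = - inv₀ x

    τ-comp : ∀ i j x → ∃[ k ] τ i (τ j x) ≡ τ k x
    τ-comp Fin.zero j x = j , refl
    τ-comp i Fin.zero x = i , refl
    τ-comp one   one   x = Fin.zero , neg-neg x
    τ-comp one   two   x = three , refl
    τ-comp one   three x = two , neg-neg _
    τ-comp two   one   x = three , inv₀-neg x
    τ-comp two   two   x = Fin.zero , inv₀-involutive x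
    τ-comp two   three x = one , trans (inv₀-neg _) (cong -_ (inv₀-involutive x))
    τ-comp three one   x = two , trans (cong -_ (inv₀-neg x)) (neg-neg _)
    τ-comp three two   x = one , cong -_ (inv₀-involutive x)
    τ-comp three three x = Fin.zero , trans (cong -_ (inv₀-neg _)) (trans (neg-neg _) (inv₀-involutive x))

    τ-back : ∀ j x → ∃[ k ] τ k (τ j x) ≡ x
    τ-back Fin.zero x = Fin.zero , refl
    τ-back one      x = one , neg-neg x
    τ-back two      x = two , inv₀-involutive x
    τ-back three    x = three , proj₂ (τ-comp three three x)

    e₀ : Fin 3 → K
    e₀ Fin.zero = 0#
    e₀ one      = 1#
    e₀ two      = - 1#

    0≢-1 : 0# ≢ - 1#
    0≢-1 eq = 1≢0 (-x≡0⇒x≡0 (sym eq))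

    e₀-inj : ∀ i j → e₀ i ≡ e₀ j → i ≡ j
    e₀-inj Fin.zero Fin.zero _  = refl
    e₀-inj one      one      _  = refl
    e₀-inj two      two      _  = refl
    e₀-inj Fin.zero one      eq = contradiction eq 0≢1
    e₀-inj Fin.zero two      eq = contradiction eq 0≢-1
    e₀-inj one      Fin.zero eq = contradiction eq 1≢0
    e₀-inj one      two      eq = contradiction eq 1≢-1
    e₀-inj two      Fin.zero eq = contradiction (sym eq) 0≢-1
    e₀-inj two      one      eq = contradiction (sym eq) 1≢-1

    inv₀-1 : inv₀ 1# ≡ 1#
    inv₀-1 = inv₀-unique (*-identityˡ 1#)

    inv₀--1 : inv₀ (- 1#) ≡ - 1#
    inv₀--1 = inv₀-unique (solve 0 ((:- :1) :* (:- :1) := :1) refl)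

    e₀-closed : ∀ j i → ∃[ i′ ] e₀ i′ ≡ τ j (e₀ i)
    e₀-closed Fin.zero i        = i , refl
    e₀-closed one      Fin.zero = Fin.zero , sym -0≡0
    e₀-closed one      one      = two , refl
    e₀-closed one      two      = one , sym (neg-neg 1#)
    e₀-closed two      Fin.zero = Fin.zero , sym inv₀-0
    e₀-closed two      one      = one , sym inv₀-1
    e₀-closed two      two      = two , sym inv₀--1
    e₀-closed three    Fin.zero = Fin.zero , sym (trans (cong -_ inv₀-0) -0≡0)
    e₀-closed three    one      = two , cong -_ (sym inv₀-1)
    e₀-closed three    two      = one , sym (trans (cong -_ inv₀--1) (neg-neg 1#))

    free : ∀ x → (∀ i → e₀ i ≢ x) → Injective _≡_ _≡_ (λ j → τ j x)
    free x x∉ = inj _ _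
      where
      x≢0 : x ≢ 0#
      x≢0 eq = x∉ Fin.zero (sym eq)
      x≢-x : x ≢ - x
      x≢-x eq = x≢0 (x≡-x⇒x≡0 eq)
      x≢inv : x ≢ inv₀ x
      x≢inv eq with sq≡sq⇒± (trans (trans (cong (x *_) eq) (inv₀-inverse x≢0)) (sym (*-identityˡ 1#)))
      ... | inj₁ x≡1  = x∉ one (sym x≡1)
      ... | inj₂ x≡-1 = x∉ two (sym x≡-1)
      x≢-inv : x ≢ - inv₀ x
      x≢-inv eq = -1∉□ (x , trans (cong (x *_) eq)
        (trans (solve 2 (λ x y → x :* (:- y) := :- (x :* y)) refl x (inv₀ x)) (cong -_ (inv₀-inverse x≢0))))
      -x≢y⇐x≢-y : ∀ {y} → x ≢ - y → - x ≢ y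
      -x≢y⇐x≢-y x≢-y eq = x≢-y (trans (sym (neg-neg x)) (cong -_ eq))
      -inj : ∀ {x y} → - x ≡ - y → x ≡ y
      -inj {x} {y} eq = trans (sym (neg-neg x)) (trans (cong -_ eq) (neg-neg y))
      inv≢-inv : inv₀ x ≢ - inv₀ x
      inv≢-inv eq = x≢-x (trans (sym (inv₀-involutive x)) (trans (cong inv₀ eq) (trans (inv₀-neg _) (cong -_ (inv₀-involutive x)))))
      inj : ∀ i j → τ i x ≡ τ j x → i ≡ j
      inj Fin.zero Fin.zero _  = refl
      inj Fin.zero one      eq = contradiction eq x≢-x
      inj Fin.zero two      eq = contradiction eq x≢inv
      inj Fin.zero three    eq = contradiction eq x≢-inv
      inj one      Fin.zero eq = contradiction (sym eq) x≢-x
      inj one      one      _  = refl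
      inj one      two      eq = contradiction eq (-x≢y⇐x≢-y x≢-inv)
      inj one      three    eq = contradiction (-inj eq) x≢inv
      inj two      Fin.zero eq = contradiction (sym eq) x≢inv
      inj two      one      eq = contradiction (sym eq) (-x≢y⇐x≢-y x≢-inv)
      inj two      two      _  = refl
      inj two      three    eq = contradiction eq inv≢-inv
      inj three    Fin.zero eq = contradiction (sym eq) x≢-inv
      inj three    one      eq = contradiction (-inj (sym eq)) x≢inv
      inj three    two      eq = contradiction (sym eq) inv≢-inv
      inj three    three    _  = refl

  module Characteristic3 (3≡0# : 3≡0) where

    record AdditiveSubgroup (N : ℕ) : Set where
      field
        enum   : Fin N → K
        injec  : Injective _≡_ _≡_ enum
        closed : ∀ i j → ∃[ k ] enum k ≡ enum i + enum j
        origin : ∃[ i ] enum i ≡ 0#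
        size   : ∃[ d ] N ≡ 3 ℕ.^ d

      -- In characteristic 3, -y = y + y, so closure under sums yields differences.
      difference : ∀ i j → ∃[ k ] enum k ≡ enum i + - enum j
      difference i j with k , eq ← closed j j with l , eq′ ← closed i k =
        l , trans eq′ (trans (cong (_ +_) eq) (modulo (enum j) 3≡0#
          (solve 2 (λ x y → x :+ (y :+ y) := (x :- y) :+ y :* (:1 :+ :1 :+ :1)) refl (enum i) (enum j))))

    -- The new subgroup is the union of the cosets V, y + V and 2y + V. If two of them met, y would
    -- be a difference of elements of V.
    adjoin : ∀ {N} (V : AdditiveSubgroup N) → (∃[ y ] ∀ i → AdditiveSubgroup.enum V i ≢ y) → AdditiveSubgroup (3 ℕ.* N)
    adjoin {N} V (y , y∉) = record
      { enum   = h ∘ remQuot {3} N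
      ; injec  = λ {i} {i′} eq → trans (sym (Fin.combine-remQuot {3} N i))
                   (trans (cong (λ p → combine (proj₁ p) (proj₂ p)) (h-inj (remQuot {3} N i) (remQuot {3} N i′) eq)) (Fin.combine-remQuot {3} N i′))
      ; closed = λ i j → let p , eq = h-closed (remQuot {3} N i) (remQuot {3} N j) in lift p eq
      ; origin = lift (Fin.zero , proj₁ origin) (trans (+-identityˡ _) (proj₂ origin))
      ; size   = suc (proj₁ size) , cong (3 ℕ.*_) (proj₂ size)
      }
      where
      open AdditiveSubgroup V
      pattern one = Fin.suc Fin.zero
      pattern two = Fin.suc (Fin.suc Fin.zero)
      _∙y : Fin 3 → K
      Fin.zero ∙y = 0#
      one ∙y      = y
      two ∙y      = y + y
      h : Fin 3 × Fin N → K
      h (j , i) = (j ∙y) + enum i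
      lift : ∀ p {z} → h p ≡ z → ∃[ i ] h (remQuot {3} N i) ≡ z
      lift (j , i) eq = combine j i , trans (cong h (Fin.remQuot-combine j i)) eq
      +-cancel : ∀ {z a b} → z + a ≡ z + b → a ≡ b
      +-cancel {z} {a} {b} eq = trans (solve 2 (λ z a → a := :- z :+ (z :+ a)) refl z a)
        (trans (cong (- z +_) eq) (solve 2 (λ z a → :- z :+ (z :+ a) := a) refl z b))
      not-difference : ∀ i i′ → y ≢ enum i + - enum i′
      not-difference i i′ eq = let k , eq′ = difference i i′ in y∉ k (trans eq′ (sym eq))
      01≢ : ∀ i i′ → 0# + enum i ≢ y + enum i′
      01≢ i i′ eq = not-difference i i′ (trans (solve 2 (λ y b → y := (y :+ b) :- b) refl y (enum i′))
        (trans (cong (_+ - enum i′) (sym eq)) (cong (_+ - enum i′) (+-identityˡ _))))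
      12≢ : ∀ i i′ → y + enum i ≢ (y + y) + enum i′
      12≢ i i′ eq = 01≢ i i′ (trans (+-identityˡ _) (+-cancel (trans eq (+-assoc y y _))))
      02≢ : ∀ i i′ → 0# + enum i ≢ (y + y) + enum i′
      -- Here y = -2y, because 3y = 0.
      02≢ i i′ eq = not-difference i′ i (trans
        (modulo y 3≡0# (solve 2 (λ y b → y := (b :- ((y :+ y) :+ b)) :+ y :* (:1 :+ :1 :+ :1)) refl y (enum i′)))
        (cong (λ z → enum i′ + - z) (trans (sym eq) (+-identityˡ _))))
      h-inj : ∀ p p′ → h p ≡ h p′ → p ≡ p′
      h-inj (Fin.zero , i) (Fin.zero , i′) eq = cong (_ ,_) (injec (+-cancel eq))
      h-inj (one , i) (one , i′) eq           = cong (_ ,_) (injec (+-cancel eq))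
      h-inj (two , i) (two , i′) eq           = cong (_ ,_) (injec (+-cancel eq))
      h-inj (Fin.zero , i) (one , i′) eq      = contradiction eq (01≢ i i′)
      h-inj (Fin.zero , i) (two , i′) eq      = contradiction eq (02≢ i i′)
      h-inj (one , i) (two , i′) eq           = contradiction eq (12≢ i i′)
      h-inj (one , i) (Fin.zero , i′) eq      = contradiction (sym eq) (01≢ i′ i)
      h-inj (two , i) (Fin.zero , i′) eq      = contradiction (sym eq) (02≢ i′ i)
      h-inj (two , i) (one , i′) eq           = contradiction (sym eq) (12≢ i′ i)
      _⊕_ : ∀ j j′ → ∃[ j″ ] j″ ∙y ≡ (j ∙y) + (j′ ∙y)
      Fin.zero ⊕ j′ = j′ , sym (+-identityˡ _)
      j ⊕ Fin.zero  = j , sym (+-identityʳ _)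
      one ⊕ one     = two , refl
      one ⊕ two     = Fin.zero , sym (modulo y 3≡0# (solve 1 (λ y → y :+ (y :+ y) := :0 :+ y :* (:1 :+ :1 :+ :1)) refl y))
      two ⊕ one     = Fin.zero , sym (modulo y 3≡0# (solve 1 (λ y → (y :+ y) :+ y := :0 :+ y :* (:1 :+ :1 :+ :1)) refl y))
      two ⊕ two     = one , sym (modulo y 3≡0# (solve 1 (λ y → (y :+ y) :+ (y :+ y) := y :+ y :* (:1 :+ :1 :+ :1)) refl y))
      h-closed : ∀ p p′ → ∃[ r ] h r ≡ h p + h p′
      h-closed (j , i) (j′ , i′) with j″ , eq ← j ⊕ j′ with k , eq′ ← closed i i′ =
        (j″ , k) , trans (cong₂ _+_ eq eq′)
          (solve 4 (λ a b c d → (a :+ b) :+ (c :+ d) := (a :+ c) :+ (b :+ d)) refl (j ∙y) (j′ ∙y) (enum i) (enum i′))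

    q≡3^d : ∃[ d ] q ≡ 3 ℕ.^ d
    q≡3^d = AdditiveSubgroup.size (grow-to AdditiveSubgroup q (λ V → Fin.injective⇒≤ (AdditiveSubgroup.injec V)) step start)
      where
      start : AdditiveSubgroup 1
      start = record
        { enum   = λ _ → 0#
        ; injec  = λ { {Fin.zero} {Fin.zero} _ → refl }
        ; closed = λ _ _ → Fin.zero , sym (+-identityˡ 0#)
        ; origin = Fin.zero , refl
        ; size   = 0 , refl
        }
      N<3N : ∀ {N} → Fin N → N ℕ.< 3 ℕ.* N
      N<3N {suc N} _ = ℕ.m<m+n (suc N) (s≤s z≤n)
      step : ∀ {N} → AdditiveSubgroup N → N ≡ q ⊎ ∃[ N′ ] N ℕ.< N′ × AdditiveSubgroup N′
      step {N} V with surjective⊎missed (AdditiveSubgroup.enum V) (AdditiveSubgroup.injec V)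
      ... | inj₁ N≡q    = inj₁ N≡q
      ... | inj₂ missed = inj₂ (3 ℕ.* N , N<3N (proj₁ (AdditiveSubgroup.origin V)) , adjoin V missed)

q%12≡7 : ∀ {q} → (∃[ k ] q ≡ 1 ℕ.+ k ℕ.* 3) → (∃[ l ] q ≡ 3 ℕ.+ l ℕ.* 4) → q ℕ.% 12 ≡ 7
q%12≡7 {q} (k , q≡1+3k) (l , q≡3+4l) = residue (q ℕ.% 12) (ℕ.m%n<n q 12)
    (trans (ℕ.m∣n⇒o%n%m≡o%m 3 12 q (divides 4 refl)) (trans (cong (ℕ._% 3) q≡1+3k) (ℕ.[m+kn]%n≡m%n 1 k 3)))
    (trans (ℕ.m∣n⇒o%n%m≡o%m 4 12 q (divides 3 refl)) (trans (cong (ℕ._% 4) q≡3+4l) (ℕ.[m+kn]%n≡m%n 3 l 4)))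
  where
  residue : ∀ r → r ℕ.< 12 → r ℕ.% 3 ≡ 1 → r ℕ.% 4 ≡ 3 → r ≡ 7
  residue 0  _ () _
  residue 1  _ _ ()
  residue 2  _ () _
  residue 3  _ () _
  residue 4  _ _ ()
  residue 5  _ () _
  residue 6  _ () _
  residue 7  _ _ _ = refl
  residue 8  _ () _
  residue 9  _ () _
  residue 10 _ _ ()
  residue 11 _ () _
  residue (suc (suc (suc (suc (suc (suc (suc (suc (suc (suc (suc (suc r))))))))))))
    (s≤s (s≤s (s≤s (s≤s (s≤s (s≤s (s≤s (s≤s (s≤s (s≤s (s≤s (s≤s ())))))))))))) _ _

-- Powers of 9 ≡ 1 (mod 4). In case (3) this clashes with q ≡ 3 (mod 4).
3^[2d]%4≡1 : ∀ d → 3 ℕ.^ (2 ℕ.* d) ℕ.% 4 ≡ 1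
3^[2d]%4≡1 d = trans (cong (ℕ._% 4) (sym (ℕ.^-*-assoc 3 2 d))) (9^ d)
  where
  9^ : ∀ d → 9 ℕ.^ d ℕ.% 4 ≡ 1
  9^ zero    = refl
  9^ (suc d) = trans (ℕ.%-distribˡ-* 9 (9 ℕ.^ d) 4) (cong (λ r → (1 ℕ.* r) ℕ.% 4) (9^ d))

-- Points of projective space, their representatives, and the action of matrices.

module Projective {q : ℕ} (F : FiniteField q) where
  open FieldTheory F

  infixr 7 _•_
  _•_ : ∀ {n} → K → Vec K n → Vec K n
  c • v = Vec.map (c *_) v

  •-assoc : ∀ {n} c d (v : Vec K n) → c • d • v ≡ (c * d) • v
  •-assoc c d v = trans (sym (Vec.map-∘ (c *_) (d *_) v)) (Vec.map-cong (λ x → sym (*-assoc c d x)) v)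

  1•v≡v : ∀ {n} (v : Vec K n) → 1# • v ≡ v
  1•v≡v v = trans (Vec.map-cong *-identityˡ v) (Vec.map-id v)

  ⁻¹•c•v≡v : ∀ {n c} → c ≢ 0# → (v : Vec K n) → c ⁻¹ • c • v ≡ v
  ⁻¹•c•v≡v {c = c} c≢0 v = trans (•-assoc (c ⁻¹) c v) (trans (cong (_• v) (⁻¹-inverseˡ c≢0)) (1•v≡v v))

  •-cancel : ∀ {n c} → c ≢ 0# → {v w : Vec K n} → c • v ≡ c • w → v ≡ w
  •-cancel {c = c} c≢0 {v} {w} eq = trans (sym (⁻¹•c•v≡v c≢0 v)) (trans (cong (c ⁻¹ •_) eq) (⁻¹•c•v≡v c≢0 w))

  firstNZ-∷-0 : ∀ {n} {x} (v : Vec K n) → x ≡ 0# → firstNZ (x ∷ v) ≡ firstNZ v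
  firstNZ-∷-0 {x = x} _ x≡0 with x ≟ᶠ 0#
  ... | yes _  = refl
  ... | no x≢0 = contradiction x≡0 x≢0

  firstNZ-∷-≢0 : ∀ {n} {x} (v : Vec K n) → x ≢ 0# → firstNZ (x ∷ v) ≡ x
  firstNZ-∷-≢0 {x = x} _ x≢0 with x ≟ᶠ 0#
  ... | yes x≡0 = contradiction x≡0 x≢0
  ... | no _    = refl

  firstNZ-• : ∀ {n} {c} → c ≢ 0# → (v : Vec K n) → firstNZ (c • v) ≡ c * firstNZ v
  firstNZ-• {c = c} c≢0 [] = sym (zeroʳ c)
  firstNZ-• {c = c} c≢0 (x ∷ v) with x ≟ᶠ 0#
  ... | yes refl = trans (firstNZ-∷-0 (c • v) (zeroʳ c)) (firstNZ-• c≢0 v)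
  ... | no x≢0   = firstNZ-∷-≢0 (c • v) (*-nonzero c≢0 x≢0)

  firstNZ-0• : ∀ {n} (v : Vec K n) → firstNZ (0# • v) ≡ 0#
  firstNZ-0• []      = refl
  firstNZ-0• (x ∷ v) = trans (firstNZ-∷-0 (0# • v) (zeroˡ x)) (firstNZ-0• v)

  -- Writing the zero vector as a multiple of v lets the rules for scalars and linear maps apply to
  -- it.
  firstNZ≡0⇒≡0• : ∀ {n} (v : Vec K n) → firstNZ v ≡ 0# → v ≡ 0# • v
  firstNZ≡0⇒≡0• [] _ = refl
  firstNZ≡0⇒≡0• (x ∷ v) eq with x ≟ᶠ 0#
  ... | yes refl = cong₂ _∷_ (sym (zeroˡ 0#)) (firstNZ≡0⇒≡0• v eq)
  ... | no x≢0   = contradiction eq x≢0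

  Nonzero : ∀ {n} → Vec K n → Set
  Nonzero v = firstNZ v ≢ 0#

  module _ {n : ℕ} where

    firstNZ-vec : (p : Point n) → firstNZ (vec p) ≡ 1#
    firstNZ-vec (v , t) with firstNZ v ≟ᶠ 0# | firstNZ v ≟ᶠ 1#
    ... | no _ | yes eq = eq

    vec-nonzero : (p : Point n) → Nonzero (vec p)
    vec-nonzero p eq = 1≢0 (trans (sym (firstNZ-vec p)) eq)

    toPoint : (v : Vec K n) → firstNZ v ≡ 1# → Point n
    toPoint v eq = v , isPoint
      where
      isPoint : T (isPointVec v)
      isPoint with firstNZ v ≟ᶠ 0# | firstNZ v ≟ᶠ 1#
      ... | no _    | yes _ = _
      ... | yes eq′ | _     = contradiction (trans (sym eq) eq′) 1≢0
      ... | no _    | no ≢1 = contradiction eq ≢1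

    vec-injective : {p p′ : Point n} → vec p ≡ vec p′ → p ≡ p′
    vec-injective {v , _} refl = cong (v ,_) (Bool.T-irrelevant _ _)

    _≟ᵖ_ : (p p′ : Point n) → Dec (p ≡ p′)
    p ≟ᵖ p′ with Vec.≡-dec _≟ᶠ_ (vec p) (vec p′)
    ... | yes eq = yes (vec-injective eq)
    ... | no ≢   = no (λ eq → ≢ (cong vec eq))

    infix 4 _~_
    -- The vector v spans the point p. Computing with arbitrary spanning vectors confines `norm` to
    -- the two conversions `norm⇒~` and `~⇒norm`.
    record _~_ (v : Vec K n) (p : Point n) : Set where
      constructor rep
      field
        scalar   : K
        scalar≢0 : scalar ≢ 0#
        scaled   : v ≡ scalar • vec p

    vec~ : (p : Point n) → vec p ~ p
    vec~ p = rep 1# 1≢0 (sym (1•v≡v (vec p)))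

    ~-scale : ∀ {c v p} → c ≢ 0# → v ~ p → c • v ~ p
    ~-scale {c} c≢0 (rep d d≢0 refl) = rep (c * d) (*-nonzero c≢0 d≢0) (•-assoc c d _)

    ~-unscale : ∀ {c v p} → c ≢ 0# → c • v ~ p → v ~ p
    ~-unscale {c} {v} {p} c≢0 r = subst (_~ p) (⁻¹•c•v≡v c≢0 v) (~-scale (⁻¹-nonzero c≢0) r)

    ~-firstNZ : ∀ {c v} {p : Point n} → c ≢ 0# → v ≡ c • vec p → firstNZ v ≡ c
    ~-firstNZ {c} {p = p} c≢0 refl = trans (firstNZ-• c≢0 (vec p)) (trans (cong (c *_) (firstNZ-vec p)) (*-identityʳ c))

    -- The first nonzero coordinate of a canonical vector is 1, so the scalar is the first nonzero
    -- coordinate of v in both cases and can be cancelled.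
    ~-unique : ∀ {v p p′} → v ~ p → v ~ p′ → p ≡ p′
    ~-unique {v} {p} {p′} (rep c c≢0 eq) (rep d d≢0 eq′) = vec-injective (•-cancel c≢0
      (trans (sym eq) (trans eq′ (cong (_• vec p′) (trans (sym (~-firstNZ {p = p′} d≢0 eq′)) (~-firstNZ {p = p} c≢0 eq))))))

    represents : ∀ {v} → Nonzero v → ∃[ p ] v ~ p
    represents {v} v≢0 = toPoint (firstNZ v ⁻¹ • v) (trans (firstNZ-• (⁻¹-nonzero v≢0) v) (⁻¹-inverseˡ v≢0))
      , rep (firstNZ v) v≢0 (sym (trans (•-assoc (firstNZ v) (firstNZ v ⁻¹) v) (trans (cong (_• v) (⁻¹-inverse _ v≢0)) (1•v≡v v))))

    norm⇒~ : ∀ {v p} → vec p ≡ norm v → v ~ p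
    norm⇒~ {v} {p} eq = rep (firstNZ v) v≢0 (sym (trans (cong (firstNZ v •_) eq)
        (trans (•-assoc (firstNZ v) (firstNZ v ⁻¹) v) (trans (cong (_• v) (⁻¹-inverse _ v≢0)) (1•v≡v v)))))
      where
      -- Whatever `0# ⁻¹` is, the zero vector has norm zero, and no point has the zero vector.
      v≢0 : Nonzero v
      v≢0 fv≡0 = vec-nonzero p (trans (cong firstNZ (trans eq (trans (cong (firstNZ v ⁻¹ •_) (firstNZ≡0⇒≡0• v fv≡0))
        (trans (•-assoc _ 0# v) (cong (_• v) (zeroʳ _)))))) (firstNZ-0• v))

    ~⇒norm : ∀ {v p} → v ~ p → vec p ≡ norm v
    ~⇒norm {v} {p} (rep c c≢0 eq) = sym (trans (cong (firstNZ v ⁻¹ •_) eq)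
      (trans (cong (λ d → d ⁻¹ • c • vec p) (~-firstNZ {p = p} c≢0 eq)) (⁻¹•c•v≡v c≢0 (vec p))))

  sumF-cong : ∀ {n} {f g : Fin n → K} → (∀ i → f i ≡ g i) → sumF f ≡ sumF g
  sumF-cong {zero}  _  = refl
  sumF-cong {suc n} eq = cong₂ _+_ (eq Fin.zero) (sumF-cong (eq ∘ Fin.suc))

  sumF-* : ∀ {n} c (f : Fin n → K) → sumF (λ i → c * f i) ≡ c * sumF f
  sumF-* {zero}  c f = sym (zeroʳ c)
  sumF-* {suc n} c f = trans (cong (_ +_) (sumF-* c (f ∘ Fin.suc)))
    (solve 3 (λ c x y → c :* x :+ c :* y := c :* (x :+ y)) refl c (f Fin.zero) (sumF (f ∘ Fin.suc)))

  sumF-0 : ∀ {n} {f : Fin n → K} → (∀ i → f i ≡ 0#) → sumF f ≡ 0#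
  sumF-0 {zero}  _  = refl
  sumF-0 {suc n} eq = trans (cong₂ _+_ (eq Fin.zero) (sumF-0 (eq ∘ Fin.suc))) (+-identityˡ 0#)

  ·-• : ∀ {n} (A : Matrix n) c v → A · (c • v) ≡ c • (A · v)
  ·-• A c v = trans (Vec.tabulate-cong (λ i → trans
      (sumF-cong (λ j → trans (cong (A i j *_) (Vec.lookup-map j (c *_) v))
        (solve 3 (λ a c x → a :* (c :* x) := c :* (a :* x)) refl (A i j) c (lookup v j))))
      (sumF-* c (λ j → A i j * lookup v j))))
    (Vec.tabulate-∘ (c *_) (λ i → sumF (λ j → A i j * lookup v j)))

  -- Scalars c and d are allowed because projectively an inverse up to a scalar is enough; for 2 × 2
  -- matrices B can then be the adjugate.
  module _ {n : ℕ} (A B : Matrix n) {c d : K} (c≢0 : c ≢ 0#) (d≢0 : d ≢ 0#)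
           (BA : ∀ v → B · (A · v) ≡ c • v) (AB : ∀ v → A · (B · v) ≡ d • v) where

    private
      ·-nonzero : ∀ (A B : Matrix n) {c} → c ≢ 0# → (∀ v → B · (A · v) ≡ c • v) → ∀ {v} → Nonzero v → Nonzero (A · v)
      ·-nonzero A B {c} c≢0 BA {v} v≢0 Av≡0 = *-nonzero c≢0 v≢0 (trans (sym (firstNZ-• c≢0 v))
        (trans (cong firstNZ (trans (sym (BA v)) (trans (cong (B ·_) (firstNZ≡0⇒≡0• (A · v) Av≡0)) (·-• B 0# (A · v)))))
          (firstNZ-0• (B · (A · v)))))

      act : (A B : Matrix n) {c : K} → c ≢ 0# → (∀ v → B · (A · v) ≡ c • v) → (p : Point n) → ∃[ p′ ] A · vec p ~ p′
      act A B c≢0 BA p = represents (·-nonzero A B c≢0 BA {vec p} (vec-nonzero p))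

      act-inverse : (A B : Matrix n) {c : K} → c ≢ 0# → (∀ v → B · (A · v) ≡ c • v) →
                    ∀ {p p′ p″} → A · vec p ~ p′ → B · vec p′ ~ p″ → p″ ≡ p
      act-inverse A B {c} c≢0 BA {p} {p′} {p″} (rep k k≢0 eq) r =
        sym (~-unique (~-scale c≢0 (vec~ p)) (subst (_~ p″) (trans (sym (·-• B k (vec p′))) (trans (cong (B ·_) (sym eq)) (BA (vec p)))) (~-scale k≢0 r)))

    abstract
      matrixPerm : Perm {Point n}
      matrixPerm = mk↔ₛ′ (proj₁ ∘ act A B c≢0 BA) (proj₁ ∘ act B A d≢0 AB)
        (λ p → act-inverse B A d≢0 AB (proj₂ (act B A d≢0 AB p)) (proj₂ (act A B c≢0 BA (proj₁ (act B A d≢0 AB p)))))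
        (λ p → act-inverse A B c≢0 BA (proj₂ (act A B c≢0 BA p)) (proj₂ (act B A d≢0 AB (proj₁ (act A B c≢0 BA p)))))

      matrixPerm~ : ∀ p → A · vec p ~ to matrixPerm p
      matrixPerm~ p = proj₂ (act A B c≢0 BA p)

      matrixPerm-induced : InducedBy matrixPerm A (λ x → x)
      matrixPerm-induced p = ~⇒norm (subst (λ v → A · v ~ to matrixPerm p) (sym (Vec.map-id (vec p))) (matrixPerm~ p))

  induced~ : ∀ {n} g (A : Matrix n) → InducedBy g A (λ x → x) → ∀ {v p} → v ~ p → A · v ~ to g p
  induced~ g A ind {v} {p} (rep c c≢0 refl) = subst (_~ to g p) (sym (·-• A c (vec p)))
    (~-scale c≢0 (subst (λ w → A · w ~ to g p) (Vec.map-id (vec p)) (norm⇒~ {v = A · Vec.map (λ x → x) (vec p)} (ind p))))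

-- Steiner quadruple systems as relations on four points.

-- A quadruple system seen as a relation Q on quadruples of points, {a, b, c, d} being a block.
record IsQuadrupleSystem {X : Set} (Q : X → X → X → X → Set) : Set where
  field
    fourth   : ∀ {a b c} → a ≢ b → a ≢ c → b ≢ c → ∃[ d ] Q a b c d
    unique   : ∀ {a b c d d′} → Q a b c d → Q a b c d′ → d ≡ d′
    distinct : ∀ {a b c d} → Q a b c d → a ≢ b
    cycle    : ∀ {a b c d} → Q a b c d → Q b c d a
    swap     : ∀ {a b c d} → Q a b c d → Q b a c d

  -- A 4-cycle and a transposition generate all reorderings of a block; this one is spelled out as a
  -- word in them.
  rotate₃ : ∀ {a b c d} → Q a b c d → Q b c a d
  rotate₃ = cycle ∘ cycle ∘ swap ∘ cycle ∘ cycle ∘ cycle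

  distinct₁₄ : ∀ {a b c d} → Q a b c d → a ≢ d
  distinct₁₄ Qabcd = distinct (cycle (cycle (cycle Qabcd))) ∘ sym

  distinct₂₄ : ∀ {a b c d} → Q a b c d → b ≢ d
  distinct₂₄ = distinct₁₄ ∘ swap

  distinct₃₄ : ∀ {a b c d} → Q a b c d → c ≢ d
  distinct₃₄ = distinct ∘ cycle ∘ cycle

  fixes-fourth : ∀ {g : X → X} → (∀ {a b c d} → Q a b c d → Q (g a) (g b) (g c) (g d)) →
                 ∀ {a b c d} → Q a b c d → g a ≡ a → g b ≡ b → g c ≡ c → g d ≡ d
  fixes-fourth {g} g-aut {d = d} Qabcd ga gb gc =
    unique (subst (λ x → Q x _ _ (g d)) ga (subst (λ x → Q _ x _ (g d)) gb (subst (λ x → Q _ _ x (g d)) gc (g-aut Qabcd)))) Qabcd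

-- Used for the translates of a design under PGL₂ and for moving 𝒟 along σ.
pullback : ∀ {X : Set} {Q : X → X → X → X → Set} (h : Perm {X}) → IsQuadrupleSystem Q →
           IsQuadrupleSystem (λ a b c d → Q (to h a) (to h b) (to h c) (to h d))
pullback {Q = Q} h S = record
  { fourth   = λ a≢b a≢c b≢c → let d , Qd = fourth (a≢b ∘ to-inj) (a≢c ∘ to-inj) (b≢c ∘ to-inj) in
                 from h d , subst (Q _ _ _) (sym (Inverse.strictlyInverseˡ h d)) Qd
  ; unique   = λ Qd Qd′ → to-inj (unique Qd Qd′)
  ; distinct = λ Qd a≡b → distinct Qd (cong (to h) a≡b)
  ; cycle    = cycle
  ; swap     = swap
  }
  where
  open IsQuadrupleSystem S
  to-inj : ∀ {x y} → to h x ≡ to h y → x ≡ y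
  to-inj {x} {y} eq = trans (sym (Inverse.strictlyInverseʳ h x)) (trans (cong (from h) eq) (Inverse.strictlyInverseʳ h y))

module Quadruples {X : Set} (_≟_ : (x y : X) → Dec (x ≡ y)) where

  ∨-true : ∀ {x y} → x ∨ y ≡ true → x ≡ true ⊎ y ≡ true
  ∨-true {true}  _  = inj₁ refl
  ∨-true {false} eq = inj₂ eq

  ⌊≟⌋-true : ∀ {x y} → ⌊ x ≟ y ⌋ ≡ true → x ≡ y
  ⌊≟⌋-true {x} {y} eq with x ≟ y
  ... | yes p = p

  ⌊≟⌋-refl : ∀ x → ⌊ x ≟ x ⌋ ≡ true
  ⌊≟⌋-refl x with x ≟ x
  ... | yes _   = refl
  ... | no  x≢x = contradiction refl x≢x

  ⊆-antisym : ∀ {S S′ : Subset {X}} → S ⊆ S′ → S′ ⊆ S → S ≐ S′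
  ⊆-antisym {S} {S′} S⊆S′ S′⊆S x with S x in eq | S′ x in eq′
  ... | true  | true  = refl
  ... | false | false = refl
  ... | true  | false = trans (sym (S⊆S′ x eq)) eq′
  ... | false | true  = trans (sym eq) (S′⊆S x eq′)

  list : ∀ {k} → Vec X k → Subset {X}
  list []       x = false
  list (a ∷ as) x = ⌊ x ≟ a ⌋ ∨ list as x

  list⁻ : ∀ {k} (as : Vec X k) {x} → list as x ≡ true → ∃[ i ] lookup as i ≡ x
  list⁻ (a ∷ as) eq with ∨-true eq
  ... | inj₁ p = Fin.zero , sym (⌊≟⌋-true p)
  ... | inj₂ p = let i , eq′ = list⁻ as p in Fin.suc i , eq′

  list⁺ : ∀ {k} (as : Vec X k) i → list as (lookup as i) ≡ true
  list⁺ (a ∷ as) Fin.zero    = cong (_∨ list as a) (⌊≟⌋-refl a)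
  list⁺ (a ∷ as) (Fin.suc i) = trans (cong (⌊ lookup as i ≟ a ⌋ ∨_) (list⁺ as i)) (Bool.∨-zeroʳ _)

  list-⊆ : ∀ {k} (as : Vec X k) {S : Subset {X}} → (∀ i → S (lookup as i) ≡ true) → list as ⊆ S
  list-⊆ as {S} as⊆S x eq with i , refl ← list⁻ as eq = as⊆S i

  list-hasSize : ∀ {k} (as : Vec X k) → Injective _≡_ _≡_ (lookup as) → HasSize (list as) k
  list-hasSize as as-inj = lookup as , as-inj , λ x → mk⇔ (list⁻ as) (λ { (i , refl) → list⁺ as i })

  image-list : ∀ {k} (g : Perm {X}) (as : Vec X k) → image g (list as) ≐ list (Vec.map (to g) as)
  image-list g as = ⊆-antisym
    (λ x eq → let i , eq′ = list⁻ as eq in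
      trans (cong (list (Vec.map (to g) as)) (trans (sym (Inverse.strictlyInverseˡ g x)) (trans (cong (to g) (sym eq′)) (sym (Vec.lookup-map i (to g) as)))))
        (list⁺ (Vec.map (to g) as) i))
    (list-⊆ (Vec.map (to g) as) {image g (list as)} λ i →
      trans (cong (list as ∘ from g) (Vec.lookup-map i (to g) as))
        (trans (cong (list as) (Inverse.strictlyInverseʳ g (lookup as i))) (list⁺ as i)))

  list-cong₄ : ∀ {a b c d a′ b′ c′ d′} → a ≡ a′ → b ≡ b′ → c ≡ c′ → d ≡ d′ →
               list (a ∷ b ∷ c ∷ d ∷ []) ≐ list (a′ ∷ b′ ∷ c′ ∷ d′ ∷ [])
  list-cong₄ refl refl refl refl x = refl

  module _ (D : SQS {X}) where
    open SQS D

    Quad : X → X → X → X → Set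
    Quad a b c d = Block (list (a ∷ b ∷ c ∷ d ∷ []))

    private
      triple : X → X → X → Vec X 3
      triple a b c = a ∷ b ∷ c ∷ []

      quadruple : X → X → X → X → Vec X 4
      quadruple a b c d = a ∷ b ∷ c ∷ d ∷ []

      pattern i₀ = Fin.zero
      pattern i₁ = Fin.suc Fin.zero
      pattern i₂ = Fin.suc (Fin.suc Fin.zero)
      pattern i₃ = Fin.suc (Fin.suc (Fin.suc Fin.zero))

      triple-injective : ∀ {a b c} → a ≢ b → a ≢ c → b ≢ c → Injective _≡_ _≡_ (lookup (triple a b c))
      triple-injective a≢b a≢c b≢c {i₀} {i₀} _  = refl
      triple-injective a≢b a≢c b≢c {i₀} {i₁} eq = contradiction eq a≢b
      triple-injective a≢b a≢c b≢c {i₀} {i₂} eq = contradiction eq a≢c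
      triple-injective a≢b a≢c b≢c {i₁} {i₀} eq = contradiction (sym eq) a≢b
      triple-injective a≢b a≢c b≢c {i₁} {i₁} _  = refl
      triple-injective a≢b a≢c b≢c {i₁} {i₂} eq = contradiction eq b≢c
      triple-injective a≢b a≢c b≢c {i₂} {i₀} eq = contradiction (sym eq) a≢c
      triple-injective a≢b a≢c b≢c {i₂} {i₁} eq = contradiction (sym eq) b≢c
      triple-injective a≢b a≢c b≢c {i₂} {i₂} _  = refl

      not-three : ∀ {S : Subset {X}} → HasSize S 4 → (as : Vec X 3) → ¬ (S ⊆ list as)
      not-three (f , f-inj , f⇔) as S⊆as = ℕ.<⇒≱ (ℕ.n<1+n 3) (Fin.injective⇒≤ {f = proj₁ ∘ index} index-inj)
        where
        index : ∀ i → ∃[ j ] lookup as j ≡ f i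
        index i = list⁻ as (S⊆as (f i) (Equivalence.from (f⇔ (f i)) (i , refl)))
        index-inj : Injective _≡_ _≡_ (proj₁ ∘ index)
        index-inj {i} {j} eq = f-inj (trans (sym (proj₂ (index i))) (trans (cong (lookup as) eq) (proj₂ (index j))))

      fourthIndex : (i j k : Fin 4) → i ≢ j → i ≢ k → j ≢ k → ∃[ l ] ∀ m → m ≡ i ⊎ m ≡ j ⊎ m ≡ k ⊎ m ≡ l
      -- A statement about `Fin 4` only, settled by running through all indices.
      fourthIndex = from-yes (all? λ (i : Fin 4) → all? λ j → all? λ k → ¬? (i ≟ᶠ j) →-dec (¬? (i ≟ᶠ k) →-dec (¬? (j ≟ᶠ k) →-dec
        any? λ l → all? (λ m → (m ≟ᶠ i) ⊎-dec ((m ≟ᶠ j) ⊎-dec ((m ≟ᶠ k) ⊎-dec (m ≟ᶠ l)))))))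

    -- With a repeated entry the block would lie in a list of three points, although it has four.
    quad-distinct : ∀ {a b c d} → Quad a b c d → a ≢ b
    quad-distinct {a} {c = c} {d} Qabcd refl = not-three (blockSize Qabcd) (triple a c d)
      (list-⊆ (quadruple a a c d) {list (triple a c d)} λ where
        i₀ → list⁺ (triple a c d) i₀
        i₁ → list⁺ (triple a c d) i₀
        i₂ → list⁺ (triple a c d) i₁
        i₃ → list⁺ (triple a c d) i₂)

    block-through : ∀ {a b c} → a ≢ b → a ≢ c → b ≢ c → ∃[ d ] Quad a b c d
    block-through {a} {b} {c} a≢b a≢c b≢c
      with B , B-block , T⊆B , _ ← steiner (list (triple a b c)) (list-hasSize (triple a b c) (triple-injective a≢b a≢c b≢c))
      with f , f-inj , f⇔ ← blockSize B-block
      with i , refl ← Equivalence.to (f⇔ a) (T⊆B a (list⁺ (triple a b c) i₀))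
      with j , refl ← Equivalence.to (f⇔ b) (T⊆B b (list⁺ (triple (f i) b c) i₁))
      with k , refl ← Equivalence.to (f⇔ c) (T⊆B c (list⁺ (triple (f i) (f j) c) i₂))
      with l , all-ijkl ← fourthIndex i j k (a≢b ∘ cong f) (a≢c ∘ cong f) (b≢c ∘ cong f)
      = f l , resp (⊆-antisym {B} {list Q} B⊆Q (list-⊆ Q {B} Q⊆B)) B-block
      where
      Q : Vec X 4
      Q = quadruple (f i) (f j) (f k) (f l)
      Q⊆B : ∀ m → B (lookup Q m) ≡ true
      Q⊆B i₀ = Equivalence.from (f⇔ _) (i , refl)
      Q⊆B i₁ = Equivalence.from (f⇔ _) (j , refl)
      Q⊆B i₂ = Equivalence.from (f⇔ _) (k , refl)
      Q⊆B i₃ = Equivalence.from (f⇔ _) (l , refl)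
      B⊆Q : B ⊆ list Q
      B⊆Q x Bx with m , refl ← Equivalence.to (f⇔ x) Bx with all-ijkl m
      ... | inj₁ refl                      = list⁺ Q i₀
      ... | inj₂ (inj₁ refl)               = list⁺ Q i₁
      ... | inj₂ (inj₂ (inj₁ refl))        = list⁺ Q i₂
      ... | inj₂ (inj₂ (inj₂ refl))        = list⁺ Q i₃

    quad-permute : ∀ {as bs : Vec X 4} → (∀ i → ∃[ j ] lookup bs j ≡ lookup as i) → (∀ i → ∃[ j ] lookup as j ≡ lookup bs i) →
                   Block (list as) → Block (list bs)
    quad-permute {as} {bs} as⊆bs bs⊆as = resp (⊆-antisym
      (list-⊆ as {list bs} (λ i → let j , eq = as⊆bs i in trans (cong (list bs) (sym eq)) (list⁺ bs j)))
      (list-⊆ bs {list as} (λ i → let j , eq = bs⊆as i in trans (cong (list as) (sym eq)) (list⁺ as j))))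

    quad-cycle : ∀ {a b c d} → Quad a b c d → Quad b c d a
    quad-cycle {a} {b} {c} {d} = quad-permute {quadruple a b c d} {quadruple b c d a}
      (λ { i₀ → i₃ , refl ; i₁ → i₀ , refl ; i₂ → i₁ , refl ; i₃ → i₂ , refl })
      (λ { i₀ → i₁ , refl ; i₁ → i₂ , refl ; i₂ → i₃ , refl ; i₃ → i₀ , refl })

    quad-swap : ∀ {a b c d} → Quad a b c d → Quad b a c d
    quad-swap {a} {b} {c} {d} = quad-permute {quadruple a b c d} {quadruple b a c d}
      (λ { i₀ → i₁ , refl ; i₁ → i₀ , refl ; i₂ → i₂ , refl ; i₃ → i₃ , refl })
      (λ { i₀ → i₁ , refl ; i₁ → i₀ , refl ; i₂ → i₂ , refl ; i₃ → i₃ , refl })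

    block-unique : ∀ {B B′} → Block B → Block B′ → ∀ {a b c} → a ≢ b → a ≢ c → b ≢ c →
                   (∀ i → B (lookup (triple a b c) i) ≡ true) → (∀ i → B′ (lookup (triple a b c) i) ≡ true) → B ≐ B′
    block-unique {B} {B′} B-block B′-block {a} {b} {c} a≢b a≢c b≢c T⊆B T⊆B′
      with _ , _ , _ , uniq ← steiner (list (triple a b c)) (list-hasSize (triple a b c) (triple-injective a≢b a≢c b≢c))
      = λ x → trans (uniq B B-block (list-⊆ (triple a b c) {B} T⊆B) x) (sym (uniq B′ B′-block (list-⊆ (triple a b c) {B′} T⊆B′) x))

    -- The two blocks share a, b, c and so coincide; d then lies in {a, b, c, d′} but differs from
    -- a, b and c.
    quad-unique : ∀ {a b c d d′} → Quad a b c d → Quad a b c d′ → d ≡ d′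
    quad-unique {a} {b} {c} {d} {d′} Qd Qd′
      with list⁻ (quadruple a b c d′) (trans (sym (block-unique Qd Qd′ (quad-distinct Qd)
             (quad-distinct (quad-cycle (quad-swap Qd)))
             (quad-distinct (quad-cycle Qd)) (T⊆ d) (T⊆ d′) d)) (list⁺ (quadruple a b c d) i₃))
      where
      T⊆ : ∀ d i → list (quadruple a b c d) (lookup (triple a b c) i) ≡ true
      T⊆ d i₀ = list⁺ (quadruple a b c d) i₀
      T⊆ d i₁ = list⁺ (quadruple a b c d) i₁
      T⊆ d i₂ = list⁺ (quadruple a b c d) i₂
    ... | i₀ , refl = contradiction refl (quad-distinct (quad-cycle (quad-cycle (quad-cycle Qd))))
    ... | i₁ , refl = contradiction refl (quad-distinct (quad-cycle (quad-cycle (quad-cycle (quad-swap Qd)))))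
    ... | i₂ , refl = contradiction refl (quad-distinct (quad-cycle (quad-cycle Qd)))
    ... | i₃ , refl = refl

    isQuadrupleSystem : IsQuadrupleSystem Quad
    isQuadrupleSystem = record
      { fourth = block-through ; unique = quad-unique ; distinct = quad-distinct
      ; cycle = quad-cycle ; swap = quad-swap }

    block⇒quad : ∀ {B} → Block B → ∃[ a ] ∃[ b ] ∃[ c ] ∃[ d ] Quad a b c d × B ≐ list (a ∷ b ∷ c ∷ d ∷ [])
    block⇒quad {B} B-block with f , f-inj , f⇔ ← blockSize B-block
      = f i₀ , f i₁ , f i₂ , f i₃ , resp B≐ B-block , B≐
      where
      Q : Vec X 4
      Q = quadruple (f i₀) (f i₁) (f i₂) (f i₃)
      lookup-Q : ∀ i → lookup Q i ≡ f i
      lookup-Q i₀ = refl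
      lookup-Q i₁ = refl
      lookup-Q i₂ = refl
      lookup-Q i₃ = refl
      B≐ : B ≐ list Q
      B≐ = ⊆-antisym {B} {list Q}
        (λ x Bx → let i , eq = Equivalence.to (f⇔ x) Bx in trans (cong (list Q) (trans (sym eq) (sym (lookup-Q i)))) (list⁺ Q i))
        (list-⊆ Q {B} (λ i → Equivalence.from (f⇔ _) (i , sym (lookup-Q i))))

    aut-quad : ∀ g → IsAut D g → ∀ {a b c d} → Quad a b c d → Quad (to g a) (to g b) (to g c) (to g d)
    aut-quad g g-aut {a} {b} {c} {d} Qabcd = resp (image-list g (quadruple a b c d)) (g-aut _ Qabcd)

-- Determinants and actions of elementary matrices.

module Determinants {q : ℕ} (F : FiniteField q) where
  open FieldTheory F
  open Projective F

  private
    cofactor : ∀ n → Matrix (suc n) → Fin (suc n) → K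
    cofactor n M j = sign j * (M Fin.zero j * det n (λ i k → M (Fin.suc i) (punchIn j k)))

    cofactor-minor≡0 : ∀ n M j → det n (λ i k → M (Fin.suc i) (punchIn j k)) ≡ 0# → cofactor n M j ≡ 0#
    cofactor-minor≡0 n M j eq = trans (cong (λ d → sign j * (M Fin.zero j * d)) eq)
      (solve 2 (λ s x → s :* (x :* :0) := :0) refl (sign j) (M Fin.zero j))

    cofactor-entry≡0 : ∀ n M j → M Fin.zero j ≡ 0# → cofactor n M j ≡ 0#
    cofactor-entry≡0 n M j eq = trans (cong (λ x → sign j * (x * d)) eq) (solve 2 (λ s d → s :* (:0 :* d) := :0) refl (sign j) d)
      where d = det n (λ i k → M (Fin.suc i) (punchIn j k))

  -- In the expansion along the first row, the first term has a zero entry, and every other minor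
  -- retains the zero column as its first column.
  det-zeroColumn : ∀ n (M : Matrix (suc n)) → (∀ i → M i Fin.zero ≡ 0#) → det (suc n) M ≡ 0#
  det-zeroColumn n M col≡0 = sumF-0 {f = cofactor n M} (term n M col≡0)
    where
    term : ∀ n M → (∀ i → M i Fin.zero ≡ 0#) → ∀ j → cofactor n M j ≡ 0#
    term n       M col≡0 Fin.zero    = cofactor-entry≡0 n M Fin.zero (col≡0 Fin.zero)
    term (suc n) M col≡0 (Fin.suc j) = cofactor-minor≡0 (suc n) M (Fin.suc j)
      (det-zeroColumn n (λ i k → M (Fin.suc i) (punchIn (Fin.suc j) k)) (λ i → col≡0 (Fin.suc i)))

  private
    det-single : ∀ n (M : Matrix (suc n)) → (∀ j → cofactor n M (Fin.suc j) ≡ 0#) →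
                 det (suc n) M ≡ M Fin.zero Fin.zero * det n (λ i k → M (Fin.suc i) (Fin.suc k))
    det-single n M rest≡0 = trans (cong (1# * x +_) (sumF-0 {f = cofactor n M ∘ Fin.suc} rest≡0)) (solve 1 (λ x → :1 :* x :+ :0 := x) refl x)
      where x = M Fin.zero Fin.zero * det n (λ i k → M (Fin.suc i) (Fin.suc k))

  det-upper : ∀ n (M : Matrix (suc n)) → (∀ i → M (Fin.suc i) Fin.zero ≡ 0#) →
              det (suc n) M ≡ M Fin.zero Fin.zero * det n (λ i k → M (Fin.suc i) (Fin.suc k))
  det-upper n M col≡0 = det-single n M (term n M col≡0)
    where
    term : ∀ n M → (∀ i → M (Fin.suc i) Fin.zero ≡ 0#) → ∀ j → cofactor n M (Fin.suc j) ≡ 0#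
    term (suc n) M col≡0 j = cofactor-minor≡0 (suc n) M (Fin.suc j)
      (det-zeroColumn n (λ i k → M (Fin.suc i) (punchIn (Fin.suc j) k)) col≡0)

  det-lower : ∀ n (M : Matrix (suc n)) → (∀ j → M Fin.zero (Fin.suc j) ≡ 0#) →
              det (suc n) M ≡ M Fin.zero Fin.zero * det n (λ i k → M (Fin.suc i) (Fin.suc k))
  det-lower n M row≡0 = det-single n M (λ j → cofactor-entry≡0 n M (Fin.suc j) (row≡0 j))

  -- Block form with corner a, row r and column c. If r or c is zero, the determinant and the action
  -- follow by peeling off the corner.
  bordered : ∀ {n} → K → (Fin n → K) → (Fin n → K) → Matrix n → Matrix (suc n)
  bordered a r c M Fin.zero    Fin.zero    = a
  bordered a r c M Fin.zero    (Fin.suc j) = r j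
  bordered a r c M (Fin.suc i) Fin.zero    = c i
  bordered a r c M (Fin.suc i) (Fin.suc j) = M i j

  0ʳ : ∀ {n} → Fin n → K
  0ʳ _ = 0#

  δ : ∀ {n} → Matrix n
  δ {suc n} = bordered 1# 0ʳ 0ʳ δ

  det-δ : ∀ n → det n δ ≡ 1#
  det-δ zero    = refl
  det-δ (suc n) = trans (det-lower n (δ) (λ _ → refl)) (trans (*-identityˡ _) (det-δ n))

  sumF-0ʳ : ∀ {n} (v : Fin n → K) → sumF (λ j → 0# * v j) ≡ 0#
  sumF-0ʳ v = sumF-0 (λ j → zeroˡ (v j))

  sumF-δ : ∀ {n} i (v : Fin n → K) → sumF (λ j → δ i j * v j) ≡ v i
  sumF-δ Fin.zero    v = trans (cong (1# * v Fin.zero +_) (sumF-0ʳ (v ∘ Fin.suc))) (solve 1 (λ x → :1 :* x :+ :0 := x) refl (v Fin.zero))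
  sumF-δ (Fin.suc i) v = trans (cong (0# * v Fin.zero +_) (sumF-δ i (v ∘ Fin.suc)))
    (solve 2 (λ x y → :0 :* x :+ y := y) refl (v Fin.zero) (v (Fin.suc i)))

  δ-· : ∀ {n} (v : Vec K n) → δ · v ≡ v
  δ-· v = trans (Vec.tabulate-cong (λ i → sumF-δ i (lookup v))) (Vec.tabulate∘lookup v)

  0x+y≡y : ∀ x y → 0# * x + y ≡ y
  0x+y≡y = solve 2 (λ x y → :0 :* x :+ y := y) refl

  diagonal-· : ∀ {n} a (M : Matrix n) x v → bordered a 0ʳ 0ʳ M · (x ∷ v) ≡ a * x ∷ M · v
  diagonal-· a M x v = cong₂ _∷_
    (trans (cong (a * x +_) (sumF-0ʳ (lookup v))) (+-identityʳ _))
    (Vec.tabulate-cong (λ i → 0x+y≡y x (sumF (λ j → M i j * lookup v j))))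

  -- x₀ ↦ x₀ + s xₖ₊₁
  transvection : ∀ {n} → Fin n → K → Matrix (suc n)
  transvection k s = bordered 1# (λ j → s * δ k j) 0ʳ δ

  transvection-· : ∀ {n} (k : Fin n) s x v → transvection k s · (x ∷ v) ≡ (x + s * lookup v k) ∷ v
  transvection-· k s x v = cong₂ _∷_
    (cong₂ _+_ (*-identityˡ x) (trans (sumF-cong (λ j → *-assoc s (δ k j) (lookup v j)))
      (trans (sumF-* s (λ j → δ k j * lookup v j)) (cong (s *_) (sumF-δ k (lookup v))))))
    (trans (Vec.tabulate-cong (λ i → 0x+y≡y x (sumF (λ j → δ i j * lookup v j)))) (δ-· v))

  det-transvection : ∀ {n} (k : Fin n) s → det (suc n) (transvection k s) ≡ 1#
  det-transvection {n} k s = trans (det-upper n (transvection k s) (λ _ → refl)) (trans (*-identityˡ _) (det-δ n))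

  -- x₁ ↦ x₁ + s x₀
  shear : ∀ {n} → K → Matrix (suc (suc n))
  shear s = bordered 1# 0ʳ (λ i → s * δ Fin.zero i) δ

  shear-· : ∀ {n} s x y (v : Vec K n) → shear s · (x ∷ y ∷ v) ≡ x ∷ (s * x + y) ∷ v
  shear-· s x y v = cong₂ _∷_
    (trans (cong₂ _+_ (*-identityˡ x) (sumF-0ʳ (lookup (y ∷ v)))) (+-identityʳ x))
    (trans (Vec.tabulate-cong (λ i → cong (s * δ Fin.zero i * x +_) (sumF-δ i (lookup (y ∷ v))))) (cong₂ _∷_
      (cong (λ t → t * x + y) (*-identityʳ s))
      (trans (Vec.tabulate-cong (λ i → solve 3 (λ s x z → s :* :0 :* x :+ z := z) refl s x (lookup v i))) (Vec.tabulate∘lookup v))))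

  det-shear : ∀ {n} s → det (suc (suc n)) (shear s) ≡ 1#
  det-shear {n} s = trans (det-lower (suc n) (shear s) (λ _ → refl)) (trans (*-identityˡ _) (det-δ (suc n)))

  torus : ∀ {n} → K → K → Matrix (suc (suc n))
  torus a b = bordered a 0ʳ 0ʳ (bordered b 0ʳ 0ʳ δ)

  torus-· : ∀ {n} a b x y (v : Vec K n) → torus a b · (x ∷ y ∷ v) ≡ a * x ∷ b * y ∷ v
  torus-· a b x y v = trans (diagonal-· a (bordered b 0ʳ 0ʳ δ) x (y ∷ v))
    (cong (a * x ∷_) (trans (diagonal-· b δ y v) (cong (b * y ∷_) (δ-· v))))

  det-torus : ∀ {n} a b → det (suc (suc n)) (torus a b) ≡ a * b
  det-torus {n} a b = trans (det-lower (suc n) (torus a b) (λ _ → refl))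
    (cong (a *_) (trans (det-lower n (bordered b 0ʳ 0ʳ δ) (λ _ → refl)) (trans (cong (b *_) (det-δ n)) (*-identityʳ b))))

-- Non-existence in projective dimension at least two.

module PSLInvariant {q : ℕ} (F : FiniteField q) {n : ℕ} {Q : FF.Point F n → FF.Point F n → FF.Point F n → FF.Point F n → Set}
  (S : IsQuadrupleSystem Q)
  (psl-aut : ∀ g → FF.InPSL F g → ∀ {a b c d} → Q a b c d → Q (to g a) (to g b) (to g c) (to g d)) where
  open FieldTheory F
  open Projective F
  open IsQuadrupleSystem S

  -- The conclusion is an eigenvector equation for the fourth point, ready to be compared coordinate
  -- by coordinate.
  fixed⇒eigenvector : ∀ (A B : Matrix n) → det n A ≡ 1# → (∀ v → B · (A · v) ≡ v) → (∀ v → A · (B · v) ≡ v) →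
    ∀ {a b c d} → Q a b c d → A · vec a ~ a → A · vec b ~ b → A · vec c ~ c → A · vec d ~ d
  fixed⇒eigenvector A B det≡1 BA AB {d = d} Qabcd a-fix b-fix c-fix =
    subst (A · vec d ~_) (fixes-fourth {to g} (psl-aut g (A , det≡1 , matrixPerm-induced A B 1≢0 1≢0 BA′ AB′)) Qabcd
      (fixed a-fix) (fixed b-fix) (fixed c-fix)) (g~ d)
    where
    BA′ : ∀ v → B · (A · v) ≡ 1# • v
    BA′ v = trans (BA v) (sym (1•v≡v v))
    AB′ : ∀ v → A · (B · v) ≡ 1# • v
    AB′ v = trans (AB v) (sym (1•v≡v v))
    g : Perm {Point n}
    g = matrixPerm A B 1≢0 1≢0 BA′ AB′
    g~ : ∀ p → A · vec p ~ to g p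
    g~ = matrixPerm~ A B 1≢0 1≢0 BA′ AB′
    fixed : ∀ {p} → A · vec p ~ p → to g p ≡ p
    fixed {p} = ~-unique (g~ p)

module HigherDimension {q : ℕ} (F : FiniteField q) (m : ℕ) where
  open FieldTheory F
  open Projective F
  open Determinants F

  n : ℕ
  n = suc (suc (suc m))

  module _ {Q : Point n → Point n → Point n → Point n → Set} (S : IsQuadrupleSystem Q)
           (psl-aut : ∀ g → InPSL g → ∀ {a b c d} → Q a b c d → Q (to g a) (to g b) (to g c) (to g d)) where
    open IsQuadrupleSystem S
    open PSLInvariant F S psl-aut

    ≡⇒~ : ∀ {v : Vec K n} {p} → v ≡ vec p → v ~ p
    ≡⇒~ {p = p} eq = subst (_~ p) (sym eq) (vec~ p)

    transvection-inverse : ∀ (k : Fin (suc (suc m))) s v → transvection k (- s) · (transvection k s · v) ≡ v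
    transvection-inverse k s (x ∷ v) = trans (cong (transvection k (- s) ·_) (transvection-· k s x v))
      (trans (transvection-· k (- s) _ v) (cong (_∷ v) (solve 3 (λ x s y → x :+ s :* y :+ (:- s) :* y := x) refl x s (lookup v k))))

    -- A transvection fixing three points of a block has the fourth one on its hyperplane.
    on-hyperplane : ∀ (k : Fin (suc (suc m))) {a b c d} → Q a b c d →
      lookup (Vec.tail (vec a)) k ≡ 0# → lookup (Vec.tail (vec b)) k ≡ 0# → lookup (Vec.tail (vec c)) k ≡ 0# →
      lookup (Vec.tail (vec d)) k ≡ 0#
    on-hyperplane k {a} {b} {c} {d} Qabcd a₀ b₀ c₀ = eigen d (fixed⇒eigenvector (transvection k 1#) (transvection k (- 1#))
        (det-transvection k 1#) (transvection-inverse k 1#)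
        (λ v → subst (λ s → transvection k s · (transvection k (- 1#) · v) ≡ v) (solve 0 (:- (:- :1) := :1) refl) (transvection-inverse k (- 1#) v))
        Qabcd (≡⇒~ (fix (vec a) a₀)) (≡⇒~ (fix (vec b) b₀)) (≡⇒~ (fix (vec c) c₀)))
      where
      fix : ∀ (v : Vec K n) → lookup (Vec.tail v) k ≡ 0# → transvection k 1# · v ≡ v
      fix (x ∷ v) eq = trans (transvection-· k 1# x v)
        (cong (_∷ v) (trans (cong (λ t → x + 1# * t) eq) (solve 1 (λ x → x :+ :1 :* :0 := x) refl x)))
      -- If y = `lookup v k` is nonzero, this unchanged coordinate shows that the eigenvalue is 1,
      -- and coordinate 0 then reads x + y = x.
      eigen : ∀ d → transvection k 1# · vec d ~ d → lookup (Vec.tail (vec d)) k ≡ 0#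
      eigen (x ∷ v , _) (rep c _ eq) with lookup v k ≟ᶠ 0#
      ... | yes p = p
      ... | no  vₖ≢0 = begin
          y                 ≡⟨ solve 2 (λ x y → y := (x :+ :1 :* y) :- x) refl x y ⟩
          x + 1# * y + - x  ≡⟨ cong (_+ - x) (cong Vec.head eq′) ⟩
          c * x + - x       ≡⟨ cong (λ t → t * x + - x) c≡1 ⟩
          1# * x + - x      ≡⟨ solve 1 (λ x → :1 :* x :- x := :0) refl x ⟩
          0#                ∎
        where
        open ≡-Reasoning
        y = lookup v k
        eq′ : (x + 1# * y) ∷ v ≡ c • (x ∷ v)
        eq′ = trans (sym (transvection-· k 1# x v)) eq
        c≡1 : c ≡ 1#
        c≡1 = *-cancelˡ vₖ≢0 (trans (*-comm y c) (trans (sym (Vec.lookup-map k (c *_) v))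
          (trans (cong (λ w → lookup (Vec.tail w) k) (sym eq′)) (sym (*-identityʳ y)))))

    0ᵛ : Vec K m
    0ᵛ = Vec.replicate m 0#

    e₀ e₁ e₂ e₀₁ : Point n
    e₀  = toPoint (1# ∷ 0# ∷ 0# ∷ 0ᵛ) (firstNZ-∷-≢0 (0# ∷ 0# ∷ 0ᵛ) 1≢0)
    e₁  = toPoint (0# ∷ 1# ∷ 0# ∷ 0ᵛ) (trans (firstNZ-∷-0 (1# ∷ 0# ∷ 0ᵛ) refl) (firstNZ-∷-≢0 (0# ∷ 0ᵛ) 1≢0))
    e₂  = toPoint (0# ∷ 0# ∷ 1# ∷ 0ᵛ) (trans (firstNZ-∷-0 (0# ∷ 1# ∷ 0ᵛ) refl)
            (trans (firstNZ-∷-0 (1# ∷ 0ᵛ) refl) (firstNZ-∷-≢0 0ᵛ 1≢0)))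
    e₀₁ = toPoint (1# ∷ 1# ∷ 0# ∷ 0ᵛ) (firstNZ-∷-≢0 (1# ∷ 0# ∷ 0ᵛ) 1≢0)

    coordinate : Fin n → Point n → K
    coordinate i p = lookup (vec p) i

    differ : ∀ i {a b : Point n} → coordinate i a ≢ coordinate i b → a ≢ b
    differ i ≢ refl = ≢ refl

    pattern i₀ = Fin.zero
    pattern i₁ = Fin.suc Fin.zero
    pattern i₂ = Fin.suc (Fin.suc Fin.zero)

    shear-inverse : ∀ s (v : Vec K n) → shear (- s) · (shear s · v) ≡ v
    shear-inverse s (x ∷ y ∷ v) = trans (cong (shear (- s) ·_) (shear-· s x y v))
      (trans (shear-· (- s) x _ v) (cong (λ t → x ∷ t ∷ v) (solve 3 (λ x s y → (:- s) :* x :+ (s :* x :+ y) := y) refl x s y)))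

    -- The vanishing of coordinate i places p on the side of the triangle e₀ e₁ e₂ opposite to eᵢ.
    off-side₂ : ∀ {p} → Q e₀ e₁ e₂ p → coordinate i₂ p ≢ 0#
    off-side₂ {p@(x ∷ y ∷ z ∷ w , _)} Qp z≡0 =
      -- `on-hyperplane` indexes the tail, so `i₁` is coordinate 2 here. With `p` on the side e₀e₁,
      -- the point e₂ would be forced onto it too.
      1≢0 (on-hyperplane i₁ {e₀} {e₁} {p} {e₂} (cycle (cycle (swap (cycle (cycle Qp))))) refl refl z≡0)

    off-side₀ : ∀ {p} → Q e₀ e₁ e₂ p → coordinate i₀ p ≢ 0#
    -- The axis of a `transvection` is never x₀ = 0; `shear` fixes that hyperplane pointwise and
    -- moves e₀.
    off-side₀ {p@(x ∷ y ∷ z ∷ w , _)} Qp x≡0 = moved (fixed⇒eigenvector (shear 1#) (shear (- 1#)) (det-shear {suc m} 1#) (shear-inverse 1#)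
        (λ v → subst (λ s → shear s · (shear (- 1#) · v) ≡ v) (solve 0 (:- (:- :1) := :1) refl) (shear-inverse (- 1#) v))
        {e₁} {e₂} {p} {e₀} (cycle Qp) (≡⇒~ (fix 0# 1# (0# ∷ 0ᵛ) refl)) (≡⇒~ (fix 0# 0# (1# ∷ 0ᵛ) refl)) (≡⇒~ (fix x y (z ∷ w) x≡0)))
      where
      fix : ∀ x y v → x ≡ 0# → shear 1# · (x ∷ y ∷ v) ≡ x ∷ y ∷ v
      fix x y v refl = trans (shear-· 1# 0# y v) (cong (λ t → 0# ∷ t ∷ v) (solve 1 (λ y → :1 :* :0 :+ y := y) refl y))
      moved : ¬ (shear 1# · vec e₀ ~ e₀)
      moved (rep c _ eq) = 1≢0 (begin
        1#             ≡⟨ solve 0 (:1 := :1 :* :1 :+ :0) refl ⟩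
        1# * 1# + 0#   ≡⟨ cong (λ v → lookup v i₁) (trans (sym (shear-· 1# 1# 0# (0# ∷ 0ᵛ))) eq) ⟩
        c * 0#         ≡⟨ zeroʳ c ⟩
        0#             ∎)
        where open ≡-Reasoning

    zero-• : ∀ c → c • (0# ∷ 0ᵛ) ≡ 0# ∷ 0ᵛ
    zero-• c = cong₂ _∷_ (zeroʳ c) (trans (Vec.map-replicate (c *_) 0# m) (cong (Vec.replicate m) (zeroʳ c)))

    torus-inverse : ∀ a b → b * a ≡ 1# → ∀ (v : Vec K n) → torus b a · (torus a b · v) ≡ v
    torus-inverse a b ba≡1 (x ∷ y ∷ v) = trans (cong (torus b a ·_) (torus-· a b x y v)) (trans (torus-· b a (a * x) (b * y) v)
      (cong₂ _∷_ (undo b a x ba≡1) (cong (_∷ v) (undo a b y (trans (*-comm a b) ba≡1)))))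
      where
      undo : ∀ b a x → b * a ≡ 1# → b * (a * x) ≡ x
      undo b a x ba≡1 = trans (sym (*-assoc b a x)) (trans (cong (_* x) ba≡1) (*-identityˡ x))

    -- The torus element fixes e₀, e₁, e₂, hence p. Coordinate 2 of p is nonzero and untouched, so
    -- the eigenvalue is 1; the nonzero coordinate 0 then gives a = 1.
    inside⇒two-elements : ∀ {p} → Q e₀ e₁ e₂ p → ∀ a → a ≢ 0# → a ≡ 1#
    inside⇒two-elements {p@(x ∷ y ∷ z ∷ w , _)} Qp a a≢0 =
      conclude (fixed⇒eigenvector (torus a b) (torus b a) (trans (det-torus {suc m} a b) (⁻¹-inverse a a≢0))
             (torus-inverse a b (⁻¹-inverseˡ a≢0)) (torus-inverse b a (⁻¹-inverse a a≢0)) {e₀} {e₁} {e₂} {p} Qp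
             (rep a a≢0 (trans (torus-· a b 1# 0# (0# ∷ 0ᵛ)) (cong (a * 1# ∷_) (cong₂ _∷_ (trans (zeroʳ b) (sym (zeroʳ a))) (sym (zero-• a))))))
             (rep b (⁻¹-nonzero a≢0) (trans (torus-· a b 0# 1# (0# ∷ 0ᵛ))
               (cong₂ _∷_ (trans (zeroʳ a) (sym (zeroʳ b))) (cong (b * 1# ∷_) (sym (zero-• b))))))
             (≡⇒~ (trans (torus-· a b 0# 0# (1# ∷ 0ᵛ)) (cong₂ _∷_ (zeroʳ a) (cong (_∷ 1# ∷ 0ᵛ) (zeroʳ b))))))
      where
      b = a ⁻¹
      conclude : torus a b · vec p ~ p → a ≡ 1#
      conclude (rep c _ eq) = *-cancelˡ (off-side₀ Qp) (begin
          x * a   ≡⟨ *-comm x a ⟩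
          a * x   ≡⟨ cong Vec.head eq′ ⟩
          c * x   ≡⟨ cong (_* x) c≡1 ⟩
          1# * x  ≡⟨ *-comm 1# x ⟩
          x * 1#  ∎)
        where
        open ≡-Reasoning
        eq′ : a * x ∷ b * y ∷ z ∷ w ≡ c • (x ∷ y ∷ z ∷ w)
        eq′ = trans (sym (torus-· a b x y (z ∷ w))) eq
        c≡1 : c ≡ 1#
        c≡1 = *-cancelˡ (off-side₂ Qp) (trans (*-comm z c) (trans (cong (λ v → lookup v i₂) (sym eq′)) (sym (*-identityʳ z))))

    -- Over 𝔽₂ the line through e₀ and e₁ has only three points.
    line-full : (∀ a → a ≢ 0# → a ≡ 1#) → ∀ {p} → ¬ Q e₀ e₁ e₀₁ p
    line-full two-elements {p@(x ∷ y ∷ v , t)} Qp = case (x ≟ᶠ 0#) (y ≟ᶠ 0#)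
      where
      v≡0 : v ≡ 0# ∷ 0ᵛ
      -- Tail index `suc k` is coordinate k + 2, which vanishes at all three given points; over all
      -- k this puts `p` on their line.
      v≡0 = trans (sym (Vec.tabulate∘lookup v)) (trans (Vec.tabulate-cong (λ k → trans
          (on-hyperplane (Fin.suc k) {e₀} {e₁} {e₀₁} {p} Qp (vanishes k) (vanishes k) (vanishes k)) (sym (vanishes k))))
          (Vec.tabulate∘lookup (0# ∷ 0ᵛ)))
        where
        vanishes : ∀ k → lookup (0# ∷ 0ᵛ) k ≡ 0#
        vanishes k = Vec.lookup-replicate k 0#
      case : Dec (x ≡ 0#) → Dec (y ≡ 0#) → ⊥
      case (yes refl) (yes refl) = vec-nonzero p (trans (firstNZ-∷-0 (0# ∷ v) refl) (trans (firstNZ-∷-0 v refl)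
        (trans (cong firstNZ (trans v≡0 (sym (zero-• 0#)))) (firstNZ-0• (0# ∷ 0ᵛ)))))
      case (no x≢0) (yes refl) = distinct₁₄ Qp (vec-injective (sym (cong₂ _∷_ (two-elements x x≢0) (cong (0# ∷_) v≡0))))
      case (yes refl) (no y≢0) = distinct₂₄ Qp (vec-injective (sym (cong (0# ∷_) (cong₂ _∷_ (two-elements y y≢0) v≡0))))
      case (no x≢0) (no y≢0)   = distinct₃₄ Qp (vec-injective (sym (cong₂ _∷_ (two-elements x x≢0) (cong₂ _∷_ (two-elements y y≢0) v≡0))))

    no-quadrupleSystem : ⊥
    no-quadrupleSystem
      with _ , Qp ← fourth {e₀} {e₁} {e₂} (differ i₀ 1≢0) (differ i₀ 1≢0) (differ i₁ 1≢0)
      with _ , Qp′ ← fourth {e₀} {e₁} {e₀₁} (differ i₀ 1≢0) (differ i₁ 0≢1) (differ i₀ 0≢1)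
      = line-full (inside⇒two-elements Qp) Qp′

-- Homographies of the projective line and the fourth point of {0, 1, ∞}.

module ProjectiveLine {q : ℕ} (F : FiniteField q) where
  open FieldTheory F
  open Projective F

  pattern i₀ = Fin.zero
  pattern i₁ = Fin.suc Fin.zero

  -- As x stands for (1, x) and ∞ for (0, 1), this is the map x ↦ (c + d x)/(a + b x): the numerator
  -- sits in the second row.
  mat : K → K → K → K → Matrix 2
  mat a b c d i₀ i₀ = a
  mat a b c d i₀ i₁ = b
  mat a b c d i₁ i₀ = c
  mat a b c d i₁ i₁ = d

  ·-expand : ∀ (A : Matrix 2) x y → A · (x ∷ y ∷ []) ≡ (A i₀ i₀ * x + A i₀ i₁ * y) ∷ (A i₁ i₀ * x + A i₁ i₁ * y) ∷ []
  ·-expand A x y = cong₂ _∷_ (row (A i₀ i₀) (A i₀ i₁)) (cong (_∷ []) (row (A i₁ i₀) (A i₁ i₁)))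
    where
    row : ∀ a b → a * x + (b * y + 0#) ≡ a * x + b * y
    row a b = cong (a * x +_) (+-identityʳ (b * y))

  det-expand : ∀ (A : Matrix 2) → det 2 A ≡ A i₀ i₀ * A i₁ i₁ + - (A i₀ i₁ * A i₁ i₀)
  det-expand A = solve 4 (λ a b c d → :1 :* (a :* (:1 :* (d :* :1) :+ :0)) :+ ((:- :1) :* (b :* (:1 :* (c :* :1) :+ :0)) :+ :0)
      := a :* d :- b :* c) refl (A i₀ i₀) (A i₀ i₁) (A i₁ i₀) (A i₁ i₁)

  _⊗_ : Matrix 2 → Matrix 2 → Matrix 2
  (A ⊗ B) i j = A i i₀ * B i₀ j + A i i₁ * B i₁ j

  ⊗-· : ∀ A B v → (A ⊗ B) · v ≡ A · (B · v)
  ⊗-· A B (x ∷ y ∷ []) = trans (·-expand (A ⊗ B) x y) (sym (trans (cong (A ·_) (·-expand B x y))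
      (trans (·-expand A _ _) (cong₂ _∷_ (row (A i₀ i₀) (A i₀ i₁)) (cong (_∷ []) (row (A i₁ i₀) (A i₁ i₁)))))))
    where
    row : ∀ a b → a * (B i₀ i₀ * x + B i₀ i₁ * y) + b * (B i₁ i₀ * x + B i₁ i₁ * y) ≡
                  (a * B i₀ i₀ + b * B i₁ i₀) * x + (a * B i₀ i₁ + b * B i₁ i₁) * y
    row a b = solve 8 (λ a b e f g h x y → a :* (e :* x :+ f :* y) :+ b :* (g :* x :+ h :* y)
        := (a :* e :+ b :* g) :* x :+ (a :* f :+ b :* h) :* y) refl a b (B i₀ i₀) (B i₀ i₁) (B i₁ i₀) (B i₁ i₁) x y

  det-⊗ : ∀ A B → det 2 (A ⊗ B) ≡ det 2 A * det 2 B
  det-⊗ A B = trans (det-expand (A ⊗ B)) (trans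
    (solve 8 (λ a b c d e f g h → (a :* e :+ b :* g) :* (c :* f :+ d :* h) :- (a :* f :+ b :* h) :* (c :* e :+ d :* g)
        := (a :* d :- b :* c) :* (e :* h :- f :* g)) refl
      (A i₀ i₀) (A i₀ i₁) (A i₁ i₀) (A i₁ i₁) (B i₀ i₀) (B i₀ i₁) (B i₁ i₀) (B i₁ i₁))
    (sym (cong₂ _*_ (det-expand A) (det-expand B))))

  _⊙_ : K → Matrix 2 → Matrix 2
  (s ⊙ A) i j = s * A i j

  ⊙-· : ∀ s A v → (s ⊙ A) · v ≡ s • (A · v)
  ⊙-· s A (x ∷ y ∷ []) = trans (·-expand (s ⊙ A) x y)
      (trans (cong₂ _∷_ (row (A i₀ i₀) (A i₀ i₁)) (cong (_∷ []) (row (A i₁ i₀) (A i₁ i₁)))) (cong (s •_) (sym (·-expand A x y))))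
    where
    row : ∀ a b → s * a * x + s * b * y ≡ s * (a * x + b * y)
    row a b = solve 5 (λ s a b x y → s :* a :* x :+ s :* b :* y := s :* (a :* x :+ b :* y)) refl s a b x y

  det-⊙ : ∀ s A → det 2 (s ⊙ A) ≡ s * s * det 2 A
  det-⊙ s A = trans (det-expand (s ⊙ A)) (trans
    (solve 5 (λ s a b c d → (s :* a) :* (s :* d) :- (s :* b) :* (s :* c) := s :* s :* (a :* d :- b :* c)) refl
      s (A i₀ i₀) (A i₀ i₁) (A i₁ i₀) (A i₁ i₁))
    (cong (s * s *_) (sym (det-expand A))))

  adj : Matrix 2 → Matrix 2
  adj A = mat (A i₁ i₁) (- A i₀ i₁) (- A i₁ i₀) (A i₀ i₀)

  det-adj : ∀ A → det 2 (adj A) ≡ det 2 A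
  det-adj A = trans (det-expand (adj A)) (trans
    (solve 4 (λ a b c d → d :* a :- (:- b) :* (:- c) := a :* d :- b :* c) refl (A i₀ i₀) (A i₀ i₁) (A i₁ i₀) (A i₁ i₁))
    (sym (det-expand A)))

  adj-A· : ∀ A v → adj A · (A · v) ≡ det 2 A • v
  adj-A· A (x ∷ y ∷ []) = trans (cong (adj A ·_) (·-expand A x y)) (trans (·-expand (adj A) _ _) (cong₂ _∷_
    (trans (solve 6 (λ a b c d x y → d :* (a :* x :+ b :* y) :+ (:- b) :* (c :* x :+ d :* y) := (a :* d :- b :* c) :* x) refl a b c d x y)
      (cong (_* x) (sym (det-expand A))))
    (cong (_∷ []) (trans (solve 6 (λ a b c d x y → (:- c) :* (a :* x :+ b :* y) :+ a :* (c :* x :+ d :* y) := (a :* d :- b :* c) :* y) refl a b c d x y)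
      (cong (_* y) (sym (det-expand A)))))))
    where
    a = A i₀ i₀
    b = A i₀ i₁
    c = A i₁ i₀
    d = A i₁ i₁

  A·adj : ∀ A v → A · (adj A · v) ≡ det 2 A • v
  A·adj A (x ∷ y ∷ []) = trans (cong (A ·_) (·-expand (adj A) x y)) (trans (·-expand A _ _) (cong₂ _∷_
    (trans (solve 6 (λ a b c d x y → a :* (d :* x :+ (:- b) :* y) :+ b :* ((:- c) :* x :+ a :* y) := (a :* d :- b :* c) :* x) refl a b c d x y)
      (cong (_* x) (sym (det-expand A))))
    (cong (_∷ []) (trans (solve 6 (λ a b c d x y → c :* (d :* x :+ (:- b) :* y) :+ d :* ((:- c) :* x :+ a :* y) := (a :* d :- b :* c) :* y) refl a b c d x y)
      (cong (_* y) (sym (det-expand A)))))))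
    where
    a = A i₀ i₀
    b = A i₀ i₁
    c = A i₁ i₀
    d = A i₁ i₁

  homography : (A : Matrix 2) → det 2 A ≢ 0# → Perm {Point 2}
  homography A detA≢0 = matrixPerm A (adj A) detA≢0 detA≢0 (adj-A· A) (A·adj A)

  homography~ : ∀ A (detA≢0 : det 2 A ≢ 0#) p → A · vec p ~ to (homography A detA≢0) p
  homography~ A detA≢0 = matrixPerm~ A (adj A) detA≢0 detA≢0 (adj-A· A) (A·adj A)

  homography-induced : ∀ A (detA≢0 : det 2 A ≢ 0#) → InducedBy (homography A detA≢0) A (λ x → x)
  homography-induced A detA≢0 = matrixPerm-induced A (adj A) detA≢0 detA≢0 (adj-A· A) (A·adj A)

  ≡1⇒≢0 : ∀ {x} → x ≡ 1# → x ≢ 0#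
  ≡1⇒≢0 eq eq′ = 1≢0 (trans (sym eq) eq′)

  ·~ : ∀ (A : Matrix 2) {v p p′} → v ~ p → A · vec p ~ p′ → A · v ~ p′
  ·~ A {p = p} {p′} (rep c c≢0 refl) r = subst (_~ p′) (sym (·-• A c (vec p))) (~-scale c≢0 r)

  pt : K → Point 2
  pt c = toPoint (1# ∷ c ∷ []) (firstNZ-∷-≢0 (c ∷ []) 1≢0)

  ∞ : Point 2
  ∞ = toPoint (0# ∷ 1# ∷ []) (trans (firstNZ-∷-0 (1# ∷ []) refl) (firstNZ-∷-≢0 [] 1≢0))

  pt-injective : ∀ {c d} → pt c ≡ pt d → c ≡ d
  pt-injective eq = cong (λ p → lookup (vec p) i₁) eq

  pt≢∞ : ∀ {c} → pt c ≢ ∞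
  pt≢∞ eq = 1≢0 (cong (λ p → lookup (vec p) i₀) eq)

  point-cases : ∀ p → p ≡ ∞ ⊎ ∃[ c ] p ≡ pt c
  point-cases p@(x ∷ y ∷ [] , _) = case (x ≟ᶠ 0#) (firstNZ-vec p)
    where
    case : Dec (x ≡ 0#) → firstNZ (x ∷ y ∷ []) ≡ 1# → p ≡ ∞ ⊎ ∃[ c ] p ≡ pt c
    case (no x≢0)  eq = inj₂ (y , vec-injective (cong (_∷ y ∷ []) (trans (sym (firstNZ-∷-≢0 (y ∷ []) x≢0)) eq)))
    case (yes refl) eq = inj₁ (vec-injective (cong (λ t → 0# ∷ t ∷ []) (trans (sym (firstNZ-single y)) (trans (sym (firstNZ-∷-0 (y ∷ []) refl)) eq))))
      where
      firstNZ-single : ∀ y → firstNZ (y ∷ []) ≡ y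
      firstNZ-single y with y ≟ᶠ 0#
      ... | yes y≡0 = sym y≡0
      ... | no _    = refl

  ~pt : ∀ {x y c} → x ≢ 0# → y ≡ x * c → (x ∷ y ∷ []) ~ pt c
  ~pt {x} {c = c} x≢0 refl = rep x x≢0 (cong (_∷ x * c ∷ []) (sym (*-identityʳ x)))

  ~∞ : ∀ {x y} → x ≡ 0# → y ≢ 0# → (x ∷ y ∷ []) ~ ∞
  ~∞ {y = y} refl y≢0 = rep y y≢0 (cong₂ _∷_ (sym (zeroʳ y)) (cong (_∷ []) (sym (*-identityʳ y))))

  ~pt⁻ : ∀ {x y c} → (x ∷ y ∷ []) ~ pt c → x ≢ 0# × y ≡ x * c
  ~pt⁻ {c = c} (rep k k≢0 refl) = (λ eq → k≢0 (trans (sym (*-identityʳ k)) eq)) , cong (_* c) (sym (*-identityʳ k))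

  ~∞⁻ : ∀ {x y} → (x ∷ y ∷ []) ~ ∞ → x ≡ 0# × y ≢ 0#
  ~∞⁻ (rep k k≢0 refl) = zeroʳ k , (λ eq → k≢0 (trans (sym (*-identityʳ k)) eq))

  ·pt : ∀ A {c d} → A i₀ i₀ + A i₀ i₁ * c ≢ 0# → A i₁ i₀ + A i₁ i₁ * c ≡ (A i₀ i₀ + A i₀ i₁ * c) * d → A · vec (pt c) ~ pt d
  ·pt A {c} {d} ≢0 eq = subst (_~ pt d) (sym (·-expand A 1# c)) (~pt
    (λ z → ≢0 (trans (cong (_+ A i₀ i₁ * c) (sym (*-identityʳ _))) z))
    (trans (cong (_+ A i₁ i₁ * c) (*-identityʳ _)) (trans eq (cong (λ t → (t + A i₀ i₁ * c) * d) (sym (*-identityʳ _))))))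

  ·pt⁻ : ∀ A {c d} → A · vec (pt c) ~ pt d → A i₁ i₀ + A i₁ i₁ * c ≡ (A i₀ i₀ + A i₀ i₁ * c) * d
  ·pt⁻ A {c} {d} r = trans (cong (_+ A i₁ i₁ * c) (sym (*-identityʳ _))) (trans (proj₂ (~pt⁻ (subst (_~ pt d) (·-expand A 1# c) r)))
    (cong (λ t → (t + A i₀ i₁ * c) * d) (*-identityʳ _)))

  ·pt-∞ : ∀ A {c} → A i₀ i₀ + A i₀ i₁ * c ≡ 0# → A i₁ i₀ + A i₁ i₁ * c ≢ 0# → A · vec (pt c) ~ ∞
  ·pt-∞ A {c} eq ≢0 = subst (_~ ∞) (sym (·-expand A 1# c)) (~∞ (trans (cong (_+ A i₀ i₁ * c) (*-identityʳ _)) eq)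
    (λ z → ≢0 (trans (cong (_+ A i₁ i₁ * c) (sym (*-identityʳ _))) z)))

  private
    second-column : ∀ A → A · (0# ∷ 1# ∷ []) ≡ A i₀ i₁ ∷ A i₁ i₁ ∷ []
    second-column A = trans (·-expand A 0# 1#) (cong₂ _∷_ (column (A i₀ i₀) (A i₀ i₁)) (cong (_∷ []) (column (A i₁ i₀) (A i₁ i₁))))
      where
      column : ∀ a b → a * 0# + b * 1# ≡ b
      column = solve 2 (λ a b → a :* :0 :+ b :* :1 := b) refl

  ·∞ : ∀ A {p} → (A i₀ i₁ ∷ A i₁ i₁ ∷ []) ~ p → A · vec ∞ ~ p
  ·∞ A {p} = subst (_~ p) (sym (second-column A))

  ·∞⁻ : ∀ A {p} → A · vec ∞ ~ p → (A i₀ i₁ ∷ A i₁ i₁ ∷ []) ~ p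
  ·∞⁻ A {p} = subst (_~ p) (second-column A)

  -- The determinant of the two canonical vectors, a difference extended to ∞: for `pt c` and `pt d`
  -- it is d - c.
  bracket : Point 2 → Point 2 → K
  bracket a b = lookup (vec a) i₀ * lookup (vec b) i₁ + - (lookup (vec a) i₁ * lookup (vec b) i₀)

  bracket≢0 : ∀ {a b} → a ≢ b → bracket a b ≢ 0#
  bracket≢0 {a} {b} a≢b eq with point-cases a | point-cases b
  ... | inj₁ refl       | inj₁ refl       = a≢b refl
  ... | inj₁ refl       | inj₂ (d , refl) = 1≢0 (-x≡0⇒x≡0 (trans (solve 1 (λ d → :- :1 := :0 :* d :- :1 :* :1) refl d) eq))
  ... | inj₂ (c , refl) | inj₁ refl       = 1≢0 (trans (solve 1 (λ c → :1 := :1 :* :1 :- c :* :0) refl c) eq)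
  ... | inj₂ (c , refl) | inj₂ (d , refl) = a≢b (cong pt (sym (x-y≡0⇒x≡y (trans
        (solve 2 (λ c d → d :- c := :1 :* d :- c :* :1) refl c d) eq))))

  bracket-swap : ∀ a b → bracket b a ≡ - bracket a b
  bracket-swap a b = solve 4 (λ x y z w → z :* y :- w :* x := :- (x :* w :- y :* z)) refl
    (lookup (vec a) i₀) (lookup (vec a) i₁) (lookup (vec b) i₀) (lookup (vec b) i₁)

  -- The homography taking 0, 1, ∞ to a, b, e; by Cramer's rule [b e] a + [a b] e = [a e] b.
  frame : Point 2 → Point 2 → Point 2 → Matrix 2
  frame a b e = mat (bracket b e * lookup (vec a) i₀) (bracket a b * lookup (vec e) i₀)
                    (bracket b e * lookup (vec a) i₁) (bracket a b * lookup (vec e) i₁)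

  det-frame : ∀ a b e → det 2 (frame a b e) ≡ bracket a b * (bracket b e * bracket a e)
  det-frame a b e = trans (det-expand (frame a b e))
    (solve 6 (λ m n x y z w → (m :* x) :* (n :* w) :- (n :* z) :* (m :* y) := n :* (m :* (x :* w :- y :* z))) refl
      (bracket b e) (bracket a b) (lookup (vec a) i₀) (lookup (vec a) i₁) (lookup (vec e) i₀) (lookup (vec e) i₁))

  vec-η : ∀ p → vec p ≡ lookup (vec p) i₀ ∷ lookup (vec p) i₁ ∷ []
  vec-η (x ∷ y ∷ [] , _) = refl

  frame-0 : ∀ {a b e} → b ≢ e → frame a b e · vec (pt 0#) ~ a
  frame-0 {a} {b} {e} b≢e = rep (bracket b e) (bracket≢0 b≢e) (trans (·-expand (frame a b e) 1# 0#)
      (trans (cong₂ _∷_ (column _ _) (cong (_∷ []) (column _ _))) (cong (bracket b e •_) (sym (vec-η a)))))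
    where
    column : ∀ x y → x * 1# + y * 0# ≡ x
    column = solve 2 (λ x y → x :* :1 :+ y :* :0 := x) refl

  frame-∞ : ∀ {a b e} → a ≢ b → frame a b e · vec ∞ ~ e
  frame-∞ {a} {b} {e} a≢b = ·∞ (frame a b e) (rep (bracket a b) (bracket≢0 a≢b) (cong (bracket a b •_) (sym (vec-η e))))

  frame-1 : ∀ {a b e} → a ≢ e → frame a b e · vec (pt 1#) ~ b
  frame-1 {a} {b} {e} a≢e = rep (bracket a e) (bracket≢0 a≢e) (trans (·-expand (frame a b e) 1# 1#)
      (trans (cong₂ _∷_
        (solve 6 (λ x y z w s t → (z :* t :- w :* s) :* x :* :1 :+ (x :* w :- y :* z) :* s :* :1 := (x :* t :- y :* s) :* z) refl
          (lookup (vec a) i₀) (lookup (vec a) i₁) (lookup (vec b) i₀) (lookup (vec b) i₁) (lookup (vec e) i₀) (lookup (vec e) i₁))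
        (cong (_∷ []) (solve 6 (λ x y z w s t → (z :* t :- w :* s) :* y :* :1 :+ (x :* w :- y :* z) :* t :* :1 := (x :* t :- y :* s) :* w) refl
          (lookup (vec a) i₀) (lookup (vec a) i₁) (lookup (vec b) i₀) (lookup (vec b) i₁) (lookup (vec e) i₀) (lookup (vec e) i₁))))
      (cong (bracket a e •_) (sym (vec-η b)))))

  det-frame≢0 : ∀ {a b e} → a ≢ b → a ≢ e → b ≢ e → det 2 (frame a b e) ≢ 0#
  det-frame≢0 {a} {b} {e} a≢b a≢e b≢e eq = *-nonzero (bracket≢0 a≢b) (*-nonzero (bracket≢0 b≢e) (bracket≢0 a≢e))
    (trans (sym (det-frame a b e)) eq)

  -- Stated for matrices and spanned points, so that conjugating by a further matrix reduces to
  -- matrix products.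
  Invariant : (Point 2 → Point 2 → Point 2 → Point 2 → Set) → Set
  Invariant Q = ∀ A → det 2 A ≡ 1# → ∀ {a b c d a′ b′ c′ d′} →
    A · vec a ~ a′ → A · vec b ~ b′ → A · vec c ~ c′ → A · vec d ~ d′ → Q a b c d → Q a′ b′ c′ d′

  psl-aut⇒invariant : ∀ {Q} → (∀ g → InPSL g → ∀ {a b c d} → Q a b c d → Q (to g a) (to g b) (to g c) (to g d)) → Invariant Q
  psl-aut⇒invariant {Q} psl-aut A det≡1 {a} {b} {c} {d} a~ b~ c~ d~ Qabcd =
    transport (at a~) (at b~) (at c~) (at d~) (psl-aut g (A , det≡1 , homography-induced A (≡1⇒≢0 det≡1)) Qabcd)
    where
    g : Perm {Point 2}
    g = homography A (≡1⇒≢0 det≡1)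
    at : ∀ {p p′} → A · vec p ~ p′ → to g p ≡ p′
    at {p} = ~-unique (homography~ A (≡1⇒≢0 det≡1) p)
    transport : ∀ {a a′ b b′ c c′ d d′} → a ≡ a′ → b ≡ b′ → c ≡ c′ → d ≡ d′ → Q a b c d → Q a′ b′ c′ d′
    transport refl refl refl refl Qabcd = Qabcd

  -- PGL normalises PSL.
  pullback-invariant : ∀ {Q h} (M : Matrix 2) → det 2 M ≢ 0# → (∀ p → M · vec p ~ to h p) → Invariant Q →
                       Invariant (λ a b c d → Q (to h a) (to h b) (to h c) (to h d))
  pullback-invariant {h = h} M m≢0 M~h inv A det≡1 a~ b~ c~ d~ = inv conj det-conj (conj~ a~) (conj~ b~) (conj~ c~) (conj~ d~)
    where
    m = det 2 M
    conj : Matrix 2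
    -- Since `adj M` is m M⁻¹, this is M A M⁻¹, of determinant 1.
    conj = (m ⁻¹) ⊙ (M ⊗ (A ⊗ adj M))
    det-conj : det 2 conj ≡ 1#
    det-conj = trans (det-⊙ (m ⁻¹) (M ⊗ (A ⊗ adj M))) (trans (cong (m ⁻¹ * m ⁻¹ *_) (trans (det-⊗ M (A ⊗ adj M))
      (cong (m *_) (trans (det-⊗ A (adj M)) (cong₂ _*_ det≡1 (det-adj M))))))
      (trans (solve 2 (λ n m → n :* n :* (m :* (:1 :* m)) := (n :* m) :* (n :* m)) refl (m ⁻¹) m)
        (trans (cong (λ t → t * t) (⁻¹-inverseˡ m≢0)) (*-identityˡ 1#))))
    conj~ : ∀ {p p′} → A · vec p ~ p′ → conj · vec (to h p) ~ to h p′
    conj~ {p} {p′} r with rep k k≢0 eq ← M~h p = ~-unscale k≢0 (subst (_~ to h p′) (sym expand) (·~ M r (M~h p′)))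
      where
      expand : k • (conj · vec (to h p)) ≡ M · (A · vec p)
      expand = begin
        k • (conj · vec (to h p))               ≡⟨ ·-• conj k (vec (to h p)) ⟨
        conj · (k • vec (to h p))               ≡⟨ cong (conj ·_) eq ⟨
        conj · (M · vec p)                      ≡⟨ ⊙-· (m ⁻¹) (M ⊗ (A ⊗ adj M)) (M · vec p) ⟩
        m ⁻¹ • ((M ⊗ (A ⊗ adj M)) · (M · vec p)) ≡⟨ cong (m ⁻¹ •_) (trans (⊗-· M (A ⊗ adj M) (M · vec p)) (cong (M ·_) (⊗-· A (adj M) (M · vec p)))) ⟩
        m ⁻¹ • (M · (A · (adj M · (M · vec p)))) ≡⟨ cong (λ w → m ⁻¹ • (M · (A · w))) (adj-A· M (vec p)) ⟩
        m ⁻¹ • (M · (A · (m • vec p)))           ≡⟨ cong (m ⁻¹ •_) (trans (cong (M ·_) (·-• A m (vec p))) (·-• M m (A · vec p))) ⟩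
        m ⁻¹ • m • (M · (A · vec p))             ≡⟨ ⁻¹•c•v≡v m≢0 (M · (A · vec p)) ⟩
        M · (A · vec p)                          ∎
        where open ≡-Reasoning

  module FourthPoint {Q : Point 2 → Point 2 → Point 2 → Point 2 → Set} (S : IsQuadrupleSystem Q) (inv : Invariant Q) where
    open IsQuadrupleSystem S

    -- x ↦ 1/(1−x) permutes 0, 1, ∞ cyclically, hence fixes c.
    rotation-fixes : ∀ {c} → Q (pt 0#) (pt 1#) ∞ (pt c) → c * c + - c + 1# ≡ 0#
    rotation-fixes {c} Qc = trans (solve 1 (λ c → c :* c :- c :+ :1 := (:1 :+ :0 :* c) :- (:1 :+ (:- :1) :* c) :* c) refl c)
        (x≡y⇒x-y≡0 (·pt⁻ R (subst (R · vec (pt c) ~_) gc≡c (homography~ R (≡1⇒≢0 det-R) (pt c)))))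
      where
      R : Matrix 2
      R = mat 1# (- 1#) 1# 0#
      det-R : det 2 R ≡ 1#
      det-R = trans (det-expand R) (solve 0 (:1 :* :0 :- (:- :1) :* :1 := :1) refl)
      gc≡c : to (homography R (≡1⇒≢0 det-R)) (pt c) ≡ pt c
      gc≡c = unique (rotate₃ (rotate₃ (inv R det-R
        (·pt R (λ eq → 1≢0 (trans (solve 0 (:1 := :1 :+ (:- :1) :* :0) refl) eq)) (solve 0 (:1 :+ :0 :* :0 := (:1 :+ (:- :1) :* :0) :* :1) refl))
        (·pt-∞ R (solve 0 (:1 :+ (:- :1) :* :1 := :0) refl) (λ eq → 1≢0 (trans (solve 0 (:1 := :1 :+ :0 :* :1) refl) eq)))
        (·∞ R (~pt (λ eq → 1≢0 (-x≡0⇒x≡0 eq)) (solve 0 (:0 := (:- :1) :* :0) refl)))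
        (homography~ R (≡1⇒≢0 det-R) (pt c)) Qc))) Qc

    -- If −1 = i², then x ↦ 1−x is induced by a matrix of determinant 1 and swaps 0 and 1, hence fixes c.
    reflection-fixes : IsSquare (- 1#) → ∀ {c} → Q (pt 0#) (pt 1#) ∞ (pt c) → c ≡ 1# + - c
    reflection-fixes (i , i²≡-1) {c} Qc = pt-injective (unique Qc (swap (inv A det-A
        (·pt A i≢ (solve 1 (λ i → i :+ (:- i) :* :0 := (i :+ :0 :* :0) :* :1) refl i))
        (·pt A i≢ (solve 1 (λ i → i :+ (:- i) :* :1 := (i :+ :0 :* :1) :* :0) refl i))
        (·∞ A (~∞ refl (λ eq → i≢0 (-x≡0⇒x≡0 eq))))
        (·pt A i≢ (solve 2 (λ i c → i :+ (:- i) :* c := (i :+ :0 :* c) :* (:1 :- c)) refl i c)) Qc)))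
      where
      A : Matrix 2
      A = mat i 0# i (- i)
      det-A : det 2 A ≡ 1#
      det-A = trans (det-expand A) (trans (solve 1 (λ i → i :* (:- i) :- :0 :* i := :- (i :* i)) refl i)
        (trans (cong -_ i²≡-1) (solve 0 (:- (:- :1) := :1) refl)))
      i≢0 : i ≢ 0#
      i≢0 eq = 1≢0 (-x≡0⇒x≡0 (trans (sym i²≡-1) (trans (cong (_* i) eq) (zeroˡ i))))
      i≢ : ∀ {c} → i + 0# * c ≢ 0#
      i≢ {c} eq = i≢0 (trans (solve 2 (λ i c → i := i :+ :0 :* c) refl i c) eq)

    fourthPoint : ∃[ c ] Q (pt 0#) (pt 1#) ∞ (pt c)
    fourthPoint with fourth {pt 0#} {pt 1#} {∞} (λ eq → 0≢1 (pt-injective eq)) pt≢∞ pt≢∞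
    ... | d , Qd with point-cases d
    ...   | inj₁ refl       = contradiction refl (distinct₃₄ Qd)
    ...   | inj₂ (c , refl) = c , Qd

  -- Modulo 3, c² - c + 1 = (c + 1)².
  3≡0⇒c≡-1 : 1# + 1# + 1# ≡ 0# → ∀ {c} → c * c + - c + 1# ≡ 0# → c ≡ - 1#
  3≡0⇒c≡-1 3≡0 {c} rel = x-y≡0⇒x≡y (sq≡0⇒≡0 (trans
    (modulo c 3≡0 (solve 1 (λ c → (c :- (:- :1)) :* (c :- (:- :1)) := (c :* c :- c :+ :1) :+ c :* (:1 :+ :1 :+ :1)) refl c)) rel))

  -- Complete the square: 4(c² - c + 1) = (2c - 1)² + 3, and 2c - 1 = 0.
  c≡1-c⇒3≡0 : ∀ {c} → c * c + - c + 1# ≡ 0# → c ≡ 1# + - c → 1# + 1# + 1# ≡ 0#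
  c≡1-c⇒3≡0 {c} rel c≡1-c = trans (modulo (- (c + - (1# + - c))) (x≡y⇒x-y≡0 c≡1-c)
    (solve 1 (λ c → :1 :+ :1 :+ :1 := (:1 :+ :1 :+ :1 :+ :1) :* (c :* c :- c :+ :1) :+ (:- (c :- (:1 :- c))) :* (c :- (:1 :- c))) refl c))
    (trans (cong ((1# + 1# + 1# + 1#) *_) rel) (zeroʳ _))

-- Orbits of base blocks under linear and semilinear maps.

module LineOrbits {q : ℕ} (F : FiniteField q) where
  open FieldTheory F
  open Projective F
  open ProjectiveLine F
  open Quadruples (_≟ᵖ_ {2})

  baseWith≐ : ∀ c → baseWith F c ≐ list (pt 0# ∷ pt 1# ∷ pt c ∷ ∞ ∷ [])
  baseWith≐ c x = cong₂ _∨_ (agree (pt 0#)) (cong₂ _∨_ (agree (pt 1#)) (cong₂ _∨_ (agree (pt c)) (cong₂ _∨_ (agree ∞) refl)))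
    where
    agree : ∀ p → ⌊ Vec.≡-dec _≟ᶠ_ (vec x) (vec p) ⌋ ≡ ⌊ x ≟ᵖ p ⌋
    agree p with Vec.≡-dec _≟ᶠ_ (vec x) (vec p)
    ... | yes _ = refl
    ... | no _  = refl

  -- Covers PSL₂ and PGL₂ at once, through the conditions `_≡ 1#` and `_≢ 0#` on the determinant.
  InL : (K → Set) → Perm {Point 2} → Set
  InL P g = ∃[ A ] P (det 2 A) × InducedBy g A (λ x → x)

  image-baseWith : ∀ h c → image h (baseWith F c) ≐ list (to h (pt 0#) ∷ to h (pt 1#) ∷ to h (pt c) ∷ to h ∞ ∷ [])
  image-baseWith h c x = trans (baseWith≐ c (from h x)) (image-list h (pt 0# ∷ pt 1# ∷ pt c ∷ ∞ ∷ []) x)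

  id-isFieldAut : IsFieldAut (λ x → x)
  id-isFieldAut = (λ _ _ → refl) , (λ _ _ → refl) , refl , (λ eq → eq)

  module FieldAut {φ : K → K} (φ-aut : IsFieldAut φ) where
    φ-+ : ∀ x y → φ (x + y) ≡ φ x + φ y
    φ-+ = proj₁ φ-aut
    φ-* : ∀ x y → φ (x * y) ≡ φ x * φ y
    φ-* = proj₁ (proj₂ φ-aut)
    φ-1 : φ 1# ≡ 1#
    φ-1 = proj₁ (proj₂ (proj₂ φ-aut))
    φ-injective : Injective _≡_ _≡_ φ
    φ-injective = proj₂ (proj₂ (proj₂ φ-aut))

    φ-0 : φ 0# ≡ 0#
    φ-0 = trans (solve 1 (λ x → x := (x :+ x) :- x) refl (φ 0#)) (trans (cong (_+ - φ 0#) (trans (sym (φ-+ 0# 0#)) (cong φ (+-identityˡ 0#)))) (-‿inverseʳ (φ 0#)))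

    φ-neg : ∀ x → φ (- x) ≡ - φ x
    φ-neg x = trans (solve 2 (λ x y → y := (:- x) :+ (x :+ y)) refl (φ x) (φ (- x)))
      (trans (cong (- φ x +_) (trans (sym (φ-+ x (- x))) (trans (cong φ (-‿inverseʳ x)) φ-0))) (+-identityʳ _))

    φ≢0 : ∀ {x} → x ≢ 0# → φ x ≢ 0#
    φ≢0 x≢0 eq = x≢0 (φ-injective (trans eq (sym φ-0)))

    φ-• : ∀ {n} c (v : Vec K n) → Vec.map φ (c • v) ≡ φ c • Vec.map φ v
    φ-• c v = trans (sym (Vec.map-∘ φ (c *_) v)) (trans (Vec.map-cong (φ-* c) v) (Vec.map-∘ (φ c *_) φ v))

    φᵐ : Matrix 2 → Matrix 2
    φᵐ B i j = φ (B i j)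

    φ-· : ∀ B v → Vec.map φ (B · v) ≡ φᵐ B · Vec.map φ v
    φ-· B (x ∷ y ∷ []) = trans (cong (Vec.map φ) (·-expand B x y)) (trans
        (cong₂ _∷_ (row (B i₀ i₀) (B i₀ i₁)) (cong (_∷ []) (row (B i₁ i₀) (B i₁ i₁)))) (sym (·-expand (φᵐ B) (φ x) (φ y))))
      where
      row : ∀ a b → φ (a * x + b * y) ≡ φ a * φ x + φ b * φ y
      row a b = trans (φ-+ _ _) (cong₂ _+_ (φ-* a x) (φ-* b y))

    det-φ : ∀ B → det 2 (φᵐ B) ≡ φ (det 2 B)
    det-φ B = sym (trans (cong φ (det-expand B)) (trans (φ-+ _ _) (trans
      (cong₂ _+_ (φ-* _ _) (trans (φ-neg _) (cong -_ (φ-* _ _)))) (sym (det-expand (φᵐ B))))))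

    semilinear~ : ∀ g (A : Matrix 2) → InducedBy g A φ → ∀ {v p} → v ~ p → A · Vec.map φ v ~ to g p
    semilinear~ g A ind {p = p} (rep c c≢0 refl) =
      subst (_~ to g p) (sym (trans (cong (A ·_) (φ-• c (vec p))) (·-• A (φ c) (Vec.map φ (vec p))))) (~-scale (φ≢0 c≢0) (norm⇒~ {v = A · Vec.map φ (vec p)} (ind p)))

    fixed-pt : ∀ {c} → φ c ≡ c → Vec.map φ (vec (pt c)) ≡ vec (pt c)
    fixed-pt eq = cong₂ _∷_ φ-1 (cong (_∷ []) eq)

    fixed-∞ : Vec.map φ (vec ∞) ≡ vec ∞
    fixed-∞ = cong₂ _∷_ φ-0 (cong (_∷ []) φ-1)

    orbit-semilinear : (P : K → Set) → (∀ {x y} → P x → P y → P (x * φ y)) → (∀ {x} → P x → x ≢ 0#) →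
      ∀ g A {c} → P (det 2 A) → InducedBy g A φ → φ c ≡ c →
      ∀ S → Orbit (InL P) (baseWith F c) S → Orbit (InL P) (baseWith F c) (image g S)
    orbit-semilinear P P-* P⇒≢0 g A {c} PA g-ind φc≡c S (h , (B , PB , h-ind) , S≐) =
        k , (C , PC , homography-induced C (P⇒≢0 PC)) , λ x → begin
          S (from g x)                                                             ≡⟨ S≐ (from g x) ⟩
          image h (baseWith F c) (from g x)                                        ≡⟨ image-baseWith h c (from g x) ⟩
          image g (list (to h (pt 0#) ∷ to h (pt 1#) ∷ to h (pt c) ∷ to h ∞ ∷ [])) x ≡⟨ image-list g (to h (pt 0#) ∷ to h (pt 1#) ∷ to h (pt c) ∷ to h ∞ ∷ []) x ⟩
          list (to g (to h (pt 0#)) ∷ to g (to h (pt 1#)) ∷ to g (to h (pt c)) ∷ to g (to h ∞) ∷ []) x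
            ≡⟨ list-cong₄ (gh≡k (pt 0#) (fixed-pt φ-0)) (gh≡k (pt 1#) (fixed-pt φ-1)) (gh≡k (pt c) (fixed-pt φc≡c)) (gh≡k ∞ fixed-∞) x ⟩
          list (to k (pt 0#) ∷ to k (pt 1#) ∷ to k (pt c) ∷ to k ∞ ∷ []) x           ≡⟨ image-baseWith k c x ⟨
          image k (baseWith F c) x                                                 ∎
      where
      open ≡-Reasoning
      C : Matrix 2
      -- The product g h is only semilinear, but it agrees with the linear map of `C` on the base
      -- points, because φ fixes 0, 1, c and ∞.
      C = A ⊗ φᵐ B
      PC : P (det 2 C)
      PC = subst P (sym (trans (det-⊗ A (φᵐ B)) (cong (det 2 A *_) (det-φ B)))) (P-* PA PB)
      k : Perm {Point 2}
      k = homography C (P⇒≢0 PC)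
      gh≡k : ∀ p → Vec.map φ (vec p) ≡ vec p → to g (to h p) ≡ to k p
      gh≡k p fix = ~-unique (semilinear~ g A g-ind (induced~ h B h-ind (vec~ p)))
        (subst (_~ to k p) (trans (⊗-· A (φᵐ B) (vec p)) (cong (A ·_) (sym (trans (φ-· B (vec p)) (cong (φᵐ B ·_) fix)))))
          (homography~ C (P⇒≢0 PC) p))

  psl-orbit-invariant : ∀ {c} g → InPSL g → ∀ S → Orbit InPSL (baseWith F c) S → Orbit InPSL (baseWith F c) (image g S)
  psl-orbit-invariant g (A , det≡1 , ind) = FieldAut.orbit-semilinear id-isFieldAut (_≡ 1#)
    (λ p p′ → trans (cong₂ _*_ p p′) (*-identityˡ 1#)) ≡1⇒≢0 g A det≡1 ind refl

  orbit-resp : ∀ (H : Perm {Point 2} → Set) B S {S′} → S ≐ S′ → Orbit H B S → Orbit H B S′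
  orbit-resp H B S S≐S′ (h , Hh , S≐) = h , Hh , λ x → trans (sym (S≐S′ x)) (S≐ x)

  identity∈PSL : ∃[ g ] InPSL g × (∀ p → to g p ≡ p)
  identity∈PSL = homography I (≡1⇒≢0 det-I) , (I , det-I , homography-induced I (≡1⇒≢0 det-I)) ,
      λ p → ~-unique (homography~ I (≡1⇒≢0 det-I) p) (subst (_~ p) (sym (I-· (vec p))) (vec~ p))
    where
    I : Matrix 2
    I = mat 1# 0# 0# 1#
    det-I : det 2 I ≡ 1#
    det-I = trans (det-expand I) (solve 0 (:1 :* :1 :- :0 :* :0 := :1) refl)
    I-· : ∀ v → I · v ≡ v
    I-· (x ∷ y ∷ []) = trans (·-expand I x y) (cong₂ _∷_ (solve 2 (λ x y → :1 :* x :+ :0 :* y := x) refl x y)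
      (cong (_∷ []) (solve 2 (λ x y → :0 :* x :+ :1 :* y := y) refl x y)))

  base∈orbit : ∀ c → Orbit InPSL (baseWith F c) (list (pt 0# ∷ pt 1# ∷ pt c ∷ ∞ ∷ []))
  base∈orbit c = fromIdentity identity∈PSL
    where
    fromIdentity : (∃[ g ] InPSL g × (∀ p → to g p ≡ p)) → Orbit InPSL (baseWith F c) (list (pt 0# ∷ pt 1# ∷ pt c ∷ ∞ ∷ []))
    fromIdentity (e , e∈PSL , e-id) = e , e∈PSL , λ x → sym (trans (image-baseWith e c x)
      (list-cong₄ (e-id (pt 0#)) (e-id (pt 1#)) (e-id (pt c)) (e-id ∞) x))

-- Transport of a design along σ.

module Transport {X : Set} (_≟_ : (x y : X) → Dec (x ≡ y)) (σ : Perm {X}) (D : SQS {X}) (G : Perm {X} → Set)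
  (Blk : Subset {X} → Set) {H₁ H₂ : Perm {X} → Set} (trs : Transports σ D G Blk H₁ H₂)
  (Blk-resp : ∀ S {S′} → S ≐ S′ → Blk S → Blk S′) where
  open Quadruples _≟_

  -- The design σ(𝒟), on which the listed blocks and the groups H₁ and H₂ live.
  Quadᵗ : X → X → X → X → Set
  Quadᵗ a b c d = Quad D (from σ a) (from σ b) (from σ c) (from σ d)

  quadᵗ-system : IsQuadrupleSystem Quadᵗ
  quadᵗ-system = pullback (↔-sym σ) (isQuadrupleSystem D)

  private
    σ-list : ∀ a b c d → image σ (list (from σ a ∷ from σ b ∷ from σ c ∷ from σ d ∷ [])) ≐ list (a ∷ b ∷ c ∷ d ∷ [])
    σ-list a b c d x = trans (image-list σ (from σ a ∷ from σ b ∷ from σ c ∷ from σ d ∷ []) x)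
        (list-cong₄ (inverse a) (inverse b) (inverse c) (inverse d) x)
      where inverse = Inverse.strictlyInverseˡ σ

  quadᵗ⇒Blk : ∀ {a b c d} → Quadᵗ a b c d → Blk (list (a ∷ b ∷ c ∷ d ∷ []))
  quadᵗ⇒Blk {a} {b} {c} {d} Q = Blk-resp (image σ (list σ⁻¹abcd)) (σ-list a b c d) (proj₁ (proj₁ trs (list σ⁻¹abcd)) Q)
    where σ⁻¹abcd = from σ a ∷ from σ b ∷ from σ c ∷ from σ d ∷ []

  Blk⇒quadᵗ : ∀ {a b c d} → Blk (list (a ∷ b ∷ c ∷ d ∷ [])) → Quadᵗ a b c d
  Blk⇒quadᵗ {a} {b} {c} {d} B = proj₂ (proj₁ trs (list (from σ a ∷ from σ b ∷ from σ c ∷ from σ d ∷ [])))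
    (Blk-resp (list (a ∷ b ∷ c ∷ d ∷ [])) (λ x → sym (σ-list a b c d x)) B)

  Blk-invariant⇒quadᵗ-invariant : ∀ {g} → (∀ S → Blk S → Blk (image g S)) →
    ∀ {a b c d} → Quadᵗ a b c d → Quadᵗ (to g a) (to g b) (to g c) (to g d)
  Blk-invariant⇒quadᵗ-invariant {g} inv {a} {b} {c} {d} Q =
    Blk⇒quadᵗ (Blk-resp (image g (list (a ∷ b ∷ c ∷ d ∷ []))) (image-list g (a ∷ b ∷ c ∷ d ∷ [])) (inv (list (a ∷ b ∷ c ∷ d ∷ [])) (quadᵗ⇒Blk Q)))

  -- For g in G, σ g σ⁻¹ is some h in H₂, so preserving σ(𝒟) under h is preserving 𝒟 under g.
  Blk-invariant⇒aut : (∀ h → H₂ h → ∀ S → Blk S → Blk (image h S)) → ∀ g → G g → IsAut D g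
  Blk-invariant⇒aut inv g g∈G B B-block with h , h∈H₂ , h≡ ← proj₂ (proj₂ trs) g g∈G =
    proj₂ (proj₁ trs (image g B)) (Blk-resp (image h (image σ B)) (λ x → cong B (conjugate x)) (inv h h∈H₂ (image σ B) (proj₁ (proj₁ trs B) B-block)))
    where
    open ≡-Reasoning
    conjugate : ∀ x → from σ (from h x) ≡ from g (from σ x)
    conjugate x = begin
      from σ (from h x)                       ≡⟨ cong (from σ ∘ from h) hy≡x ⟨
      from σ (from h (to h y))                ≡⟨ cong (from σ) (Inverse.strictlyInverseʳ h y) ⟩
      from σ (to σ (from g (from σ x)))       ≡⟨ Inverse.strictlyInverseʳ σ _ ⟩
      from g (from σ x)                       ∎
      where
      y : X
      y = to σ (from g (from σ x))
      hy≡x : to h y ≡ x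
      hy≡x = trans (h≡ y) (trans (cong (to σ ∘ to g) (Inverse.strictlyInverseʳ σ _))
        (trans (cong (to σ) (Inverse.strictlyInverseˡ g _)) (Inverse.strictlyInverseˡ σ x)))

-- Permutations of the line normalising PSL₂.

module Normalizer {q : ℕ} (F : FiniteField q) where
  open FieldTheory F
  open Projective F
  open ProjectiveLine F
  open LineOrbits F

  to-injective : (g : Perm {Point 2}) → ∀ {p p′} → to g p ≡ to g p′ → p ≡ p′
  to-injective g {p} {p′} eq = trans (sym (Inverse.strictlyInverseʳ g p)) (trans (cong (from g) eq) (Inverse.strictlyInverseʳ g p′))

  -- Since 2xy = (x+1)²y − x²y − y, multiplicativity on squares suffices.
  square-multiplicative⇒multiplicative : 1# + 1# ≢ 0# → (f : K → K) → (∀ x y → f (x + y) ≡ f x + f y) → f 1# ≡ 1# →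
    (∀ a x → f (a * a * x) ≡ f (a * a) * f x) → ∀ x y → f (x * y) ≡ f x * f y
  square-multiplicative⇒multiplicative 2≢0 f f-+ f-1 f-sq x y = *-cancelˡ 2≢0 (begin
      (1# + 1#) * f (x * y)
        ≡⟨ solve 3 (λ s xy y → (:1 :+ :1) :* xy := (s :+ ((xy :+ xy) :+ y)) :- (s :+ y)) refl (f (x * x * y)) (f (x * y)) (f y) ⟩
      (f (x * x * y) + ((f (x * y) + f (x * y)) + f y)) + - (f (x * x * y) + f y)
        ≡⟨ cong₂ (λ s t → s + - (t + f y)) expandˡ (f-sq x y) ⟩
      f ((x + 1#) * (x + 1#)) * f y + - (f (x * x) * f y + f y)
        ≡⟨ cong (λ s → s * f y + - (f (x * x) * f y + f y)) expandʳ ⟩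
      (f (x * x) + ((f x + f x) + 1#)) * f y + - (f (x * x) * f y + f y)
        ≡⟨ solve 3 (λ s x y → (s :+ ((x :+ x) :+ :1)) :* y :- (s :* y :+ y) := (:1 :+ :1) :* (x :* y)) refl (f (x * x)) (f x) (f y) ⟩
      (1# + 1#) * (f x * f y) ∎)
    where
    open ≡-Reasoning
    f-+₄ : ∀ a b c → f (a + ((b + b) + c)) ≡ f a + ((f b + f b) + f c)
    f-+₄ a b c = trans (f-+ a _) (cong (f a +_) (trans (f-+ _ c) (cong (_+ f c) (f-+ b b))))
    expandˡ : f (x * x * y) + ((f (x * y) + f (x * y)) + f y) ≡ f ((x + 1#) * (x + 1#)) * f y
    expandˡ = trans (sym (f-+₄ (x * x * y) (x * y) y)) (trans
      (cong f (solve 2 (λ x y → x :* x :* y :+ ((x :* y :+ x :* y) :+ y) := (x :+ :1) :* (x :+ :1) :* y) refl x y)) (f-sq (x + 1#) y))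
    expandʳ : f ((x + 1#) * (x + 1#)) ≡ f (x * x) + ((f x + f x) + 1#)
    expandʳ = trans (cong f (solve 1 (λ x → (x :+ :1) :* (x :+ :1) := x :* x :+ ((x :+ x) :+ :1)) refl x))
      (trans (f-+₄ (x * x) x 1#) (cong (λ t → f (x * x) + ((f x + f x) + t)) f-1))

  -- The form in which G ≤ Aut(N) is used for a group acting on the points.
  Normalizes : Perm {Point 2} → Set
  Normalizes g = ∀ h → InPSL h → ∃[ k ] InPSL k × (∀ x → to k x ≡ to g (to h (from g x)))

  module FixingZeroInfinity (2≢0 : 1# + 1# ≢ 0#) (g : Perm {Point 2}) (normal : Normalizes g)
    (g-0 : to g (pt 0#) ≡ pt 0#) (g-∞ : to g ∞ ≡ ∞) where

    abstract
      ψ-exists : ∀ x → ∃[ y ] to g (pt x) ≡ pt y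
      ψ-exists x with point-cases (to g (pt x))
      ... | inj₂ p  = p
      ... | inj₁ eq = contradiction (to-injective g (trans eq (sym g-∞))) pt≢∞

      ψ : K → K
      ψ x = proj₁ (ψ-exists x)

      g-pt : ∀ x → to g (pt x) ≡ pt (ψ x)
      g-pt x = proj₂ (ψ-exists x)

    ψ-injective : Injective _≡_ _≡_ ψ
    ψ-injective {x} {y} eq = pt-injective (to-injective g (trans (g-pt x) (trans (cong pt eq) (sym (g-pt y)))))

    ψ-0 : ψ 0# ≡ 0#
    ψ-0 = pt-injective (trans (sym (g-pt 0#)) g-0)

    ψ-surjective : ∀ y → ∃[ x ] ψ x ≡ y
    ψ-surjective = injective⇒surjective ψ ψ-injective

    -- A is the matrix of the conjugate g H g⁻¹.
    conjugate : ∀ (H : Matrix 2) → det 2 H ≡ 1# → H · vec ∞ ~ ∞ → (t : K → K) → (∀ x → H · vec (pt x) ~ pt (t x)) →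
      ∃[ A ] A i₀ i₀ * A i₁ i₁ ≡ 1# × (∀ x → A i₁ i₀ + A i₁ i₁ * ψ x ≡ A i₀ i₀ * ψ (t x))
    conjugate H det-H H-∞ t H-t = result (normal h (H , det-H , homography-induced H (≡1⇒≢0 det-H)))
      where
      h : Perm {Point 2}
      h = homography H (≡1⇒≢0 det-H)
      result : (∃[ k ] InPSL k × (∀ x → to k x ≡ to g (to h (from g x)))) →
               ∃[ A ] A i₀ i₀ * A i₁ i₁ ≡ 1# × (∀ x → A i₁ i₀ + A i₁ i₁ * ψ x ≡ A i₀ i₀ * ψ (t x))
      result (k , (A , det-A , k-ind) , k≡) = A
        , trans (solve 3 (λ a c d → a :* d := a :* d :- :0 :* c) refl (A i₀ i₀) (A i₁ i₀) (A i₁ i₁))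
            (trans (cong (λ b → A i₀ i₀ * A i₁ i₁ + - (b * A i₁ i₀)) (sym A₀₁≡0)) (trans (sym (det-expand A)) det-A))
        , λ x → trans (·pt⁻ A (acts (g-pt x) (g-pt (t x)) (H-t x)))
            (cong (_* ψ (t x)) (trans (cong (λ b → A i₀ i₀ + b * ψ x) A₀₁≡0)
              (solve 2 (λ a y → a :+ :0 :* y := a) refl (A i₀ i₀) (ψ x))))
        where
        acts : ∀ {p p′ y y′} → to g p ≡ y → to g p′ ≡ y′ → H · vec p ~ p′ → A · vec y ~ y′
        acts {p} {p′} refl refl r = subst (A · vec (to g p) ~_) (trans (k≡ (to g p))
          (cong (to g) (trans (cong (to h) (Inverse.strictlyInverseʳ g p)) (~-unique (homography~ H (≡1⇒≢0 det-H) p) r))))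
          (induced~ k A k-ind (vec~ (to g p)))
        -- The conjugate fixes ∞ = (0, 1), so it is the affine map y ↦ (c + d y)/a.
        A₀₁≡0 : A i₀ i₁ ≡ 0#
        A₀₁≡0 = proj₁ (~∞⁻ (·∞⁻ A (acts g-∞ g-∞ H-∞)))

    -- Translations are the elements of PSL fixing only ∞.
    ψ-+ : ∀ x b → ψ (x + b) ≡ ψ x + ψ b
    ψ-+ x b = case (b ≟ᶠ 0#)
      where
      H : Matrix 2
      H = mat 1# 0# b 1#
      det-H : det 2 H ≡ 1#
      det-H = trans (det-expand H) (solve 1 (λ b → :1 :* :1 :- :0 :* b := :1) refl b)
      H-∞ : H · vec ∞ ~ ∞
      H-∞ = ·∞ H (~∞ refl 1≢0)
      H-t : ∀ x → H · vec (pt x) ~ pt (x + b)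
      H-t x = ·pt H (λ eq → 1≢0 (trans (solve 1 (λ x → :1 := :1 :+ :0 :* x) refl x) eq))
        (solve 2 (λ x b → b :+ :1 :* x := (:1 :+ :0 :* x) :* (x :+ b)) refl x b)
      translation : b ≢ 0# → (∃[ A ] A i₀ i₀ * A i₁ i₁ ≡ 1# × (∀ x → A i₁ i₀ + A i₁ i₁ * ψ x ≡ A i₀ i₀ * ψ (x + b))) →
                    ψ (x + b) ≡ ψ x + ψ b
      translation b≢0 (A , ad≡1 , eqs) = *-cancelˡ a≢0 (begin
          a * ψ (x + b)                     ≡⟨ eqs x ⟨
          c + d * ψ x                       ≡⟨ cong₂ (λ s t → s + t * ψ x) c≡ (sym a≡d) ⟩
          a * ψ b + a * ψ x                 ≡⟨ solve 3 (λ a x b → a :* b :+ a :* x := a :* (x :+ b)) refl a (ψ x) (ψ b) ⟩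
          a * (ψ x + ψ b)                   ∎)
        where
        open ≡-Reasoning
        a = A i₀ i₀
        c = A i₁ i₀
        d = A i₁ i₁
        a≢0 : a ≢ 0#
        a≢0 = *≡1⇒nonzeroˡ ad≡1
        c≡ : c ≡ a * ψ b
        c≡ = trans (solve 2 (λ c d → c := c :+ d :* :0) refl c d) (trans (cong (λ t → c + d * t) (sym ψ-0))
          (trans (eqs 0#) (cong (λ t → a * ψ t) (+-identityˡ b))))
        a≡d : a ≡ d
        a≡d with a ≟ᶠ d
        ... | yes eq  = eq
        -- For a ≠ d the affine map y ↦ (c + d y)/a has the fixed point c/(a - d); its preimage
        -- under ψ would be fixed by x ↦ x + b with b ≠ 0.
        ... | no  a≢d with x₀ , ψx₀≡ ← ψ-surjective (c * (a + - d) ⁻¹) =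
          contradiction (trans (solve 2 (λ x b → b := (x :+ b) :- x) refl x₀ b) (x≡y⇒x-y≡0 (ψ-injective (*-cancelˡ a≢0 (begin
            a * ψ (x₀ + b)                ≡⟨ eqs x₀ ⟨
            c + d * ψ x₀                  ≡⟨ cong (_+ d * ψ x₀) c≡y ⟩
            (a + - d) * ψ x₀ + d * ψ x₀   ≡⟨ solve 3 (λ a d y → (a :- d) :* y :+ d :* y := a :* y) refl a d (ψ x₀) ⟩
            a * ψ x₀                      ∎))))) b≢0
          where
          a-d≢0 : a + - d ≢ 0#
          a-d≢0 eq = a≢d (x-y≡0⇒x≡y eq)
          c≡y : c ≡ (a + - d) * ψ x₀
          c≡y = sym (trans (cong ((a + - d) *_) ψx₀≡) (trans
            (solve 3 (λ e c f → e :* (c :* f) := c :* (e :* f)) refl (a + - d) c ((a + - d) ⁻¹))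
            (trans (cong (c *_) (⁻¹-inverse _ a-d≢0)) (*-identityʳ c))))
      case : Dec (b ≡ 0#) → ψ (x + b) ≡ ψ x + ψ b
      case (yes refl) = trans (cong ψ (+-identityʳ x)) (sym (trans (cong (ψ x +_) ψ-0) (+-identityʳ (ψ x))))
      case (no b≢0)   = translation b≢0 (conjugate H det-H H-∞ (_+ b) H-t)

    u : K
    u = ψ 1#

    u≢0 : u ≢ 0#
    u≢0 eq = 1≢0 (ψ-injective (trans eq (sym ψ-0)))

    -- The dilation by a² is diag(a⁻¹, a) in PSL₂. Its conjugate fixes 0 and ∞, hence is again a
    -- dilation, whose factor is read off at x = 1 as ψ(a²)/u.
    ψ-square : ∀ a x → u * ψ (a * a * x) ≡ ψ (a * a) * ψ x
    ψ-square a x = case (a ≟ᶠ 0#)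
      where
      H : Matrix 2
      H = mat (a ⁻¹) 0# 0# a
      dilation : (∃[ A ] A i₀ i₀ * A i₁ i₁ ≡ 1# × (∀ x → A i₁ i₀ + A i₁ i₁ * ψ x ≡ A i₀ i₀ * ψ (a * a * x))) →
                 u * ψ (a * a * x) ≡ ψ (a * a) * ψ x
      dilation (A , sd≡1 , eqs) = *-cancelˡ s≢0 (begin
          s * (u * ψ (a * a * x))         ≡⟨ solve 3 (λ s u y → s :* (u :* y) := u :* (s :* y)) refl s u (ψ (a * a * x)) ⟩
          u * (s * ψ (a * a * x))         ≡⟨ cong (u *_) (scaled x) ⟩
          u * (d * ψ x)                   ≡⟨ solve 3 (λ u d y → u :* (d :* y) := (d :* u) :* y) refl u d (ψ x) ⟩
          (d * u) * ψ x                   ≡⟨ cong (_* ψ x) (scaled 1#) ⟨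
          (s * ψ (a * a * 1#)) * ψ x      ≡⟨ cong (λ t → (s * ψ t) * ψ x) (*-identityʳ (a * a)) ⟩
          (s * ψ (a * a)) * ψ x           ≡⟨ *-assoc s (ψ (a * a)) (ψ x) ⟩
          s * (ψ (a * a) * ψ x)           ∎)
        where
        open ≡-Reasoning
        s = A i₀ i₀
        c = A i₁ i₀
        d = A i₁ i₁
        s≢0 : s ≢ 0#
        s≢0 = *≡1⇒nonzeroˡ sd≡1
        c≡0 : c ≡ 0#
        c≡0 = trans (solve 2 (λ c d → c := c :+ d :* :0) refl c d) (trans (cong (λ t → c + d * t) (sym ψ-0))
          (trans (eqs 0#) (trans (cong (s *_) (trans (cong ψ (zeroʳ (a * a))) ψ-0)) (zeroʳ s))))
        scaled : ∀ x → s * ψ (a * a * x) ≡ d * ψ x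
        scaled x = trans (sym (eqs x)) (trans (cong (_+ d * ψ x) c≡0) (+-identityˡ _))
      case : Dec (a ≡ 0#) → u * ψ (a * a * x) ≡ ψ (a * a) * ψ x
      case (yes refl) = trans (cong (u *_) (vanish (trans (cong (_* x) (zeroˡ 0#)) (zeroˡ x)))) (trans (zeroʳ u)
          (sym (trans (cong (_* ψ x) (vanish (zeroˡ 0#))) (zeroˡ (ψ x)))))
        where
        vanish : ∀ {z} → z ≡ 0# → ψ z ≡ 0#
        vanish refl = ψ-0
      case (no a≢0) = dilation (conjugate H det-H (·∞ H (~∞ refl a≢0)) (λ x → a * a * x)
          (λ x → ·pt H (λ eq → ⁻¹-nonzero a≢0 (trans (solve 2 (λ b x → b := b :+ :0 :* x) refl (a ⁻¹) x) eq))
            (trans (trans (solve 2 (λ a x → :0 :+ a :* x := :1 :* (a :* x)) refl a x) (cong (_* (a * x)) (sym (⁻¹-inverseˡ a≢0))))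
              (solve 3 (λ b a x → b :* a :* (a :* x) := (b :+ :0 :* x) :* (a :* a :* x)) refl (a ⁻¹) a x))))
        where
        det-H : det 2 H ≡ 1#
        det-H = trans (det-expand H) (trans (solve 2 (λ b a → b :* a :- :0 :* :0 := b :* a) refl (a ⁻¹) a) (⁻¹-inverseˡ a≢0))

    φ : K → K
    φ x = u ⁻¹ * ψ x

    uφ≡ψ : ∀ x → u * φ x ≡ ψ x
    uφ≡ψ x = trans (sym (*-assoc u (u ⁻¹) (ψ x))) (trans (cong (_* ψ x) (⁻¹-inverse u u≢0)) (*-identityˡ (ψ x)))

    g-pt-φ : ∀ x → to g (pt x) ≡ pt (u * φ x)
    g-pt-φ x = trans (g-pt x) (cong pt (sym (uφ≡ψ x)))

    φ-isFieldAut : IsFieldAut φ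
    φ-isFieldAut = φ-+ , square-multiplicative⇒multiplicative 2≢0 φ φ-+ φ-1 φ-sq , φ-1 ,
        λ {x} {y} eq → ψ-injective (*-cancelˡ (⁻¹-nonzero u≢0) eq)
      where
      φ-+ : ∀ x y → φ (x + y) ≡ φ x + φ y
      φ-+ x y = trans (cong (u ⁻¹ *_) (ψ-+ x y)) (solve 3 (λ s x y → s :* (x :+ y) := s :* x :+ s :* y) refl (u ⁻¹) (ψ x) (ψ y))
      φ-1 : φ 1# ≡ 1#
      φ-1 = ⁻¹-inverseˡ u≢0
      φ-sq : ∀ a x → φ (a * a * x) ≡ φ (a * a) * φ x
      φ-sq a x = *-cancelˡ (*-nonzero u≢0 u≢0) (begin
        u * u * φ (a * a * x)             ≡⟨ *-assoc u u _ ⟩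
        u * (u * φ (a * a * x))           ≡⟨ cong (u *_) (uφ≡ψ (a * a * x)) ⟩
        u * ψ (a * a * x)                 ≡⟨ ψ-square a x ⟩
        ψ (a * a) * ψ x                   ≡⟨ cong₂ _*_ (uφ≡ψ (a * a)) (uφ≡ψ x) ⟨
        u * φ (a * a) * (u * φ x)         ≡⟨ solve 3 (λ u s t → u :* s :* (u :* t) := u :* u :* (s :* t)) refl u (φ (a * a)) (φ x) ⟩
        u * u * (φ (a * a) * φ x)         ∎)
        where open ≡-Reasoning

  -- Every element of G is an element of PSL times some g′ ∈ G acting on the line as x ↦ u φ(x).
  record Decomposition (G : Perm {Point 2} → Set) (g : Perm {Point 2}) : Set where
    field
      M       : Matrix 2
      det-M   : det 2 M ≡ 1#
      g′      : Perm {Point 2}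
      g′∈G    : G g′
      u       : K
      u≢0     : u ≢ 0#
      φ       : K → K
      φ-aut   : IsFieldAut φ
      g′-pt   : ∀ x → to g′ (pt x) ≡ pt (u * φ x)
      g′-∞    : to g′ ∞ ≡ ∞
      g≡Mg′   : ∀ p → M · vec (to g′ p) ~ to g p

    -- Every diag(s, su) induces multiplication by u. The free s adjusts the determinant: s = 1
    -- serves for PΓL, and s = w⁻¹ with w² = u gives determinant 1.
    induced : ∀ {s t} → s ≢ 0# → t ≡ s * u → InducedBy g (M ⊗ mat s 0# 0# t) φ
    induced {s} {t} s≢0 t≡su p = ~⇒norm (subst (_~ to g p) (sym (⊗-· M U (Vec.map φ (vec p)))) (·~ M (U~ (point-cases p)) (g≡Mg′ p)))
      where
      open FieldAut φ-aut
      U : Matrix 2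
      U = mat s 0# 0# t
      U~ : p ≡ ∞ ⊎ ∃[ x ] p ≡ pt x → U · Vec.map φ (vec p) ~ to g′ p
      U~ (inj₁ refl) = subst (U · Vec.map φ (vec ∞) ~_) (sym g′-∞) (subst (λ w → U · w ~ ∞) (sym fixed-∞)
        (·∞ U (~∞ refl (subst (_≢ 0#) (sym t≡su) (*-nonzero s≢0 u≢0)))))
      U~ (inj₂ (x , refl)) = subst (U · Vec.map φ (vec (pt x)) ~_) (sym (g′-pt x))
        (subst (λ z → U · (z ∷ φ x ∷ []) ~ pt (u * φ x)) (sym φ-1)
        (·pt U (λ eq → s≢0 (trans (solve 2 (λ s y → s := s :+ :0 :* y) refl s (φ x)) eq))
          (trans (cong (λ t → 0# + t * φ x) t≡su)
            (solve 3 (λ s u y → :0 :+ s :* u :* y := (s :+ :0 :* y) :* (u :* y)) refl s u (φ x)))))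

    det-induced : ∀ s t → det 2 (M ⊗ mat s 0# 0# t) ≡ s * t
    det-induced s t = trans (det-⊗ M U) (trans (cong₂ _*_ det-M (det-expand U))
      (solve 2 (λ s t → :1 :* (s :* t :- :0 :* :0) := s :* t) refl s t))
      where U = mat s 0# 0# t

    ∈PΓL : InPΓL g
    ∈PΓL = M ⊗ mat 1# 0# 0# u , φ , (λ eq → u≢0 (trans (sym (trans (det-induced 1# u) (*-identityˡ u))) eq)) , φ-aut ,
      induced 1≢0 (sym (*-identityˡ u))

    square⇒∈PΣL : IsSquare u → InPΣL g
    square⇒∈PΣL (w , w²≡u) = M ⊗ mat (w ⁻¹) 0# 0# w , φ , trans (det-induced (w ⁻¹) w) (⁻¹-inverseˡ w≢0) , φ-aut ,
      induced (⁻¹-nonzero w≢0) (sym (trans (cong (w ⁻¹ *_) (sym w²≡u)) (trans (sym (*-assoc (w ⁻¹) w w))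
        (trans (cong (_* w) (⁻¹-inverseˡ w≢0)) (*-identityˡ w)))))
      where
      w≢0 : w ≢ 0#
      w≢0 refl = u≢0 (trans (sym w²≡u) (zeroˡ 0#))

  -- PSL₂ is transitive on ordered pairs of points: take the two vectors as columns and divide the
  -- second by their bracket.
  unimodular-frame : ∀ {a e} → a ≢ e → ∃[ M ] det 2 M ≡ 1# × M · vec (pt 0#) ~ a × M · vec ∞ ~ e
  unimodular-frame {a} {e} a≢e = M , det-M , M-0 , ·∞ M (rep s (⁻¹-nonzero (bracket≢0 a≢e)) (cong (s •_) (sym (vec-η e))))
    where
    s : K
    s = bracket a e ⁻¹
    M : Matrix 2
    M = mat (lookup (vec a) i₀) (s * lookup (vec e) i₀) (lookup (vec a) i₁) (s * lookup (vec e) i₁)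
    det-M : det 2 M ≡ 1#
    det-M = trans (det-expand M) (trans
      (solve 5 (λ s x y z w → x :* (s :* w) :- (s :* z) :* y := s :* (x :* w :- y :* z)) refl
        s (lookup (vec a) i₀) (lookup (vec a) i₁) (lookup (vec e) i₀) (lookup (vec e) i₁))
      (⁻¹-inverseˡ (bracket≢0 a≢e)))
    column : ∀ x y → x * 1# + y * 0# ≡ x
    column = solve 2 (λ x y → x :* :1 :+ y :* :0 := x) refl
    M-0 : M · vec (pt 0#) ~ a
    M-0 = subst (_~ a) (sym (trans (·-expand M 1# 0#) (trans
      (cong₂ _∷_ (column (lookup (vec a) i₀) (s * lookup (vec e) i₀)) (cong (_∷ []) (column (lookup (vec a) i₁) (s * lookup (vec e) i₁))))
      (sym (vec-η a))))) (vec~ a)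

  adj-inverse~ : ∀ M → det 2 M ≢ 0# → ∀ {p p′} → adj M · vec p ~ p′ → M · vec p′ ~ p
  adj-inverse~ M detM≢0 {p} {p′} (rep k k≢0 eq) = ~-unscale k≢0 (subst (_~ p)
    (trans (sym (A·adj M (vec p))) (trans (cong (M ·_) eq) (·-• M k (vec p′)))) (~-scale detM≢0 (vec~ p)))

  homography-reflects : ∀ M → det 2 M ≢ 0# → ∀ {p p′ y} → M · vec p ~ y → M · vec p′ ~ y → p ≡ p′
  homography-reflects M detM≢0 {p} {p′} r r′ = to-injective (homography M detM≢0)
    (trans (~-unique (homography~ M detM≢0 p) r) (sym (~-unique (homography~ M detM≢0 p′) r′)))

  -- With M taking 0, ∞ to g(0), g(∞), the product M⁻¹g fixes 0 and ∞. It stays in G because PSL₂ ≤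
  -- G, and therefore still normalises PSL₂.
  decompose : 1# + 1# ≢ 0# → ∀ {G} → IsPermGroup G → (∀ h → InPSL h → G h) → (∀ g → G g → Normalizes g) →
              ∀ g → G g → Decomposition G g
  decompose 2≢0 {G} G-group PSL≤G G-normal g g∈G = straighten (unimodular-frame (λ eq → pt≢∞ (to-injective g eq)))
    where
    straighten : (∃[ M ] det 2 M ≡ 1# × M · vec (pt 0#) ~ to g (pt 0#) × M · vec ∞ ~ to g ∞) → Decomposition G g
    straighten (M , det-M , M-0 , M-∞) =
        result (IsPermGroup.comp G-group (PSL≤G m⁻¹ (adj M , det-adj≡1 , homography-induced (adj M) (≡1⇒≢0 det-adj≡1))) g∈G)
      where
      det-adj≡1 : det 2 (adj M) ≡ 1#
      det-adj≡1 = trans (det-adj M) det-M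
      m⁻¹ : Perm {Point 2}
      m⁻¹ = homography (adj M) (≡1⇒≢0 det-adj≡1)
      result : (∃[ k ] G k × (∀ x → to k x ≡ to m⁻¹ (to g x))) → Decomposition G g
      result (k , k∈G , k≡) = record
        { M = M ; det-M = det-M ; g′ = k ; g′∈G = k∈G ; u = N.u ; u≢0 = N.u≢0 ; φ = N.φ ; φ-aut = N.φ-isFieldAut
        ; g′-pt = N.g-pt-φ ; g′-∞ = k-∞ ; g≡Mg′ = M-k }
        where
        M-k : ∀ p → M · vec (to k p) ~ to g p
        M-k p = subst (λ y → M · vec y ~ to g p) (sym (k≡ p))
          (adj-inverse~ M (≡1⇒≢0 det-M) (homography~ (adj M) (≡1⇒≢0 det-adj≡1) (to g p)))
        k-∞ : to k ∞ ≡ ∞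
        k-∞ = homography-reflects M (≡1⇒≢0 det-M) (M-k ∞) M-∞
        k-0 : to k (pt 0#) ≡ pt 0#
        k-0 = homography-reflects M (≡1⇒≢0 det-M) (M-k (pt 0#)) M-0
        module N = FixingZeroInfinity 2≢0 k (G-normal k k∈G) k-0 k-∞

-- Classification on the projective line.

module LineClassification {q : ℕ} (F : FiniteField q) where
  open FieldTheory F
  open Projective F
  open Cardinality F
  open ProjectiveLine F
  open LineOrbits F
  open Normalizer F
  open Quadruples (_≟ᵖ_ {2})

  list-swap : ∀ a b c d → list (a ∷ b ∷ c ∷ d ∷ []) ≐ list (b ∷ a ∷ c ∷ d ∷ [])
  list-swap a b c d x = ∨-left-comm ⌊ x ≟ᵖ a ⌋ ⌊ x ≟ᵖ b ⌋
    where
    ∨-left-comm : ∀ s t {r} → s ∨ (t ∨ r) ≡ t ∨ (s ∨ r)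
    ∨-left-comm true  true  = refl
    ∨-left-comm true  false = refl
    ∨-left-comm false true  = refl
    ∨-left-comm false false = refl

  orbit-list : ∀ {H : Perm {Point 2} → Set} {c} h → H h → ∀ {B a b d e} → B ≐ list (a ∷ b ∷ d ∷ e ∷ []) →
    to h (pt 0#) ≡ a → to h (pt 1#) ≡ b → to h (pt c) ≡ d → to h ∞ ≡ e → Orbit H (baseWith F c) B
  orbit-list {c = c} h h∈H B≐ refl refl refl refl = h , h∈H , λ x → trans (B≐ x) (sym (image-baseWith h c x))

  -- Mediates between the order 0, 1, c, ∞ of the base blocks and the order 0, 1, ∞, c with the
  -- unknown point last.
  swap₃₄ : ∀ {Q : Point 2 → Point 2 → Point 2 → Point 2 → Set} → IsQuadrupleSystem Q → ∀ {a b c d} → Q a b c d → Q a b d c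
  swap₃₄ S = cycle ∘ cycle ∘ swap ∘ cycle ∘ cycle
    where open IsQuadrupleSystem S

  unique₃ : ∀ {Q : Point 2 → Point 2 → Point 2 → Point 2 → Set} → IsQuadrupleSystem Q → ∀ {a b c c′ d} → Q a b c d → Q a b c′ d → c ≡ c′
  unique₃ S Qc Qc′ = IsQuadrupleSystem.unique S (swap₃₄ S Qc) (swap₃₄ S Qc′)

  module _ {Q : Point 2 → Point 2 → Point 2 → Point 2 → Set} (S : IsQuadrupleSystem Q) (inv : Invariant Q) where
    open IsQuadrupleSystem S

    -- In characteristic 3 the fourth point is forced also on the triples not in the PSL-orbit of {0, 1, ∞}.
    pgl-harmonic : 3≡0 → ∀ h → InPGL h → Q (to h (pt 0#)) (to h (pt 1#)) (to h (pt (- 1#))) (to h ∞)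
    pgl-harmonic 3≡0# h (A , detA≢0 , h-ind) = conclude (FourthPoint.fourthPoint Sʰ invʰ)
      where
      Qʰ : Point 2 → Point 2 → Point 2 → Point 2 → Set
      Qʰ a b c d = Q (to h a) (to h b) (to h c) (to h d)
      Sʰ : IsQuadrupleSystem Qʰ
      Sʰ = pullback h S
      invʰ : Invariant Qʰ
      invʰ = pullback-invariant {Q} {h} A detA≢0 (λ p → induced~ h A h-ind (vec~ p)) inv
      conclude : ∃[ c ] Qʰ (pt 0#) (pt 1#) ∞ (pt c) → Qʰ (pt 0#) (pt 1#) (pt (- 1#)) ∞
      conclude (c , Qc) = swap₃₄ Sʰ (subst (λ c → Qʰ (pt 0#) (pt 1#) ∞ (pt c)) (3≡0⇒c≡-1 3≡0# (FourthPoint.rotation-fixes Sʰ invʰ Qc)) Qc)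

  frame-pgl : ∀ {a b e} → a ≢ b → a ≢ e → b ≢ e → ∃[ h ] InPGL h × to h (pt 0#) ≡ a × to h (pt 1#) ≡ b × to h ∞ ≡ e
  frame-pgl {a} {b} {e} a≢b a≢e b≢e =
    homography M M≢0 , (M , M≢0 , homography-induced M M≢0) , at (frame-0 b≢e) , at (frame-1 a≢e) , at (frame-∞ a≢b)
    where
    M : Matrix 2
    M = frame a b e
    M≢0 : det 2 M ≢ 0#
    M≢0 = det-frame≢0 a≢b a≢e b≢e
    at : ∀ {p p′} → M · vec p ~ p′ → to (homography M M≢0) p ≡ p′
    at {p} = ~-unique (homography~ M M≢0 p)

  -- Dividing a 2 × 2 matrix by a square root of its determinant makes the determinant 1 without
  -- changing the homography.
  frame-psl : ∀ {a b e} → a ≢ b → a ≢ e → b ≢ e → IsSquare (det 2 (frame a b e)) →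
              ∃[ h ] InPSL h × to h (pt 0#) ≡ a × to h (pt 1#) ≡ b × to h ∞ ≡ e
  frame-psl {a} {b} {e} a≢b a≢e b≢e (w , w²≡det) =
    homography M M≢0 , (M , det-M , homography-induced M M≢0) , at (frame-0 b≢e) , at (frame-1 a≢e) , at (frame-∞ a≢b)
    where
    w≢0 : w ≢ 0#
    w≢0 refl = det-frame≢0 a≢b a≢e b≢e (trans (sym w²≡det) (zeroˡ 0#))
    M : Matrix 2
    M = (w ⁻¹) ⊙ frame a b e
    det-M : det 2 M ≡ 1#
    det-M = trans (det-⊙ (w ⁻¹) (frame a b e)) (trans (cong (w ⁻¹ * w ⁻¹ *_) (sym w²≡det))
      (trans (solve 2 (λ v w → v :* v :* (w :* w) := (v :* w) :* (v :* w)) refl (w ⁻¹) w)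
        (trans (cong (λ t → t * t) (⁻¹-inverseˡ w≢0)) (*-identityˡ 1#))))
    M≢0 : det 2 M ≢ 0#
    M≢0 = ≡1⇒≢0 det-M
    at : ∀ {p p′} → frame a b e · vec p ~ p′ → to (homography M M≢0) p ≡ p′
    at {p} {p′} r = ~-unique (homography~ M M≢0 p)
      (subst (_~ p′) (sym (⊙-· (w ⁻¹) (frame a b e) (vec p))) (~-scale (⁻¹-nonzero w≢0) r))

  det-frame-swap : ∀ a b e → det 2 (frame b a e) ≡ - det 2 (frame a b e)
  det-frame-swap a b e = trans (det-frame b a e) (trans (cong (_* (bracket a e * bracket b e)) (bracket-swap a b)) (trans
    (solve 3 (λ x y z → (:- x) :* (y :* z) := :- (x :* (z :* y))) refl (bracket a b) (bracket a e) (bracket b e))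
    (cong -_ (sym (det-frame a b e)))))

  -- (2c − 1)² = −3 and one of ±(2c − 1) is a square, which no automorphism can send to its opposite.
  aut-fixes-root : ¬ 3≡0 → ¬ IsSquare (- 1#) → ∀ {c} → c * c + - c + 1# ≡ 0# → ∀ {φ} → IsFieldAut φ → φ c ≡ c
  aut-fixes-root 3≢0 -1∉□ {c} rel {φ} φ-aut = case (sq≡sq⇒± φs²≡s²)
    where
    open FieldAut φ-aut
    open NonsquareMinusOne -1∉□
    s : K
    s = c + c + - 1#
    s²≡-3 : s * s ≡ - (1# + 1# + 1#)
    s²≡-3 = modulo (1# + 1# + 1# + 1#) rel (solve 1 (λ c → (c :+ c :- :1) :* (c :+ c :- :1) :=
      :- (:1 :+ :1 :+ :1) :+ (:1 :+ :1 :+ :1 :+ :1) :* (c :* c :- c :+ :1)) refl c)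
    φs²≡s² : φ s * φ s ≡ s * s
    φs²≡s² = trans (sym (φ-* s s)) (trans (cong φ s²≡-3) (trans (φ-neg _) (trans (cong -_ (trans (φ-+ _ _)
      (cong₂ _+_ (trans (φ-+ 1# 1#) (cong₂ _+_ φ-1 φ-1)) φ-1))) (sym s²≡-3))))
    s≢0 : s ≢ 0#
    s≢0 s≡0 = 3≢0 (-x≡0⇒x≡0 (trans (sym s²≡-3) (trans (cong (_* s) s≡0) (zeroˡ s))))
    not-negated : ∀ y → y * y ≢ 0# → φ (y * y) ≢ - (y * y)
    not-negated y y²≢0 eq = -1∉□ (-1-square⇐ratio (λ { refl → y²≢0 (zeroˡ 0#) }) (trans (sym (φ-* y y)) eq))
    case : φ s ≡ s ⊎ φ s ≡ - s → φ c ≡ c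
    case (inj₁ φs≡s) = *-cancelˡ 2≢0 (trans (solve 1 (λ x → (:1 :+ :1) :* x := (x :+ x :- :1) :+ :1) refl (φ c))
      (trans (cong (_+ 1#) (trans (sym φs≡) φs≡s)) (solve 1 (λ x → (x :+ x :- :1) :+ :1 := (:1 :+ :1) :* x) refl c)))
      where
      φs≡ : φ s ≡ φ c + φ c + - 1#
      φs≡ = trans (φ-+ _ _) (cong₂ _+_ (φ-+ c c) (trans (φ-neg 1#) (cong -_ φ-1)))
    case (inj₂ φs≡-s) with square⊎neg-square s
    ... | inj₁ (y , y²≡s)  = contradiction (trans (cong φ y²≡s) (trans φs≡-s (cong -_ (sym y²≡s))))
                               (not-negated y (λ eq → s≢0 (trans (sym y²≡s) eq)))
    ... | inj₂ (y , y²≡-s) = contradiction (trans (cong φ y²≡-s) (trans (φ-neg s) (cong -_ (trans φs≡-s (sym y²≡-s)))))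
                               (not-negated y (λ eq → s≢0 (-x≡0⇒x≡0 (trans (sym y²≡-s) eq))))

  module _ {c : K} (rel : c * c + - c + 1# ≡ 0#) (3≢0 : ¬ 3≡0) where

    -- The relation gives c³ = -1, so -c is a cube root of unity; for -c = 1 the relation would read
    -- 3 = 0.
    root⇒q≡1+3k : ∃[ k ] q ≡ 1 ℕ.+ k ℕ.* 3
    root⇒q≡1+3k = cubeRoot⇒q≡1+3k (- c)
      (modulo (- c + - 1#) rel (solve 1 (λ c → (:- c) :* (:- c) :* (:- c) := :1 :+ (:- c :- :1) :* (c :* c :- c :+ :1)) refl c))
      (λ -c≡1 → 3≢0 (trans (modulo (c + - 1# + - 1#) (x≡y⇒x-y≡0 -c≡1)
        (solve 1 (λ c → :1 :+ :1 :+ :1 := (c :* c :- c :+ :1) :+ (c :- :1 :- :1) :* (:- c :- :1)) refl c)) rel))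

    -- The cofactors come from c⁶ - 1 = (c³ - 1)(c + 1)(c² - c + 1) and from Bézout relations
    -- expressing 3 by c² - c + 1 and c² - 1, and 2 by c² - c + 1 and c³ - 1.
    root-primitive : 1# + 1# ≢ 0# → IsPrimitiveSixthRoot c
    root-primitive 2≢0 =
        modulo ((c * c * c + - 1#) * (c + 1#)) rel (solve 1 (λ c → c :* (c :* (c :* (c :* (c :* (c :* :1))))) :=
          :1 :+ ((c :* c :* c :- :1) :* (c :+ :1)) :* (c :* c :- c :+ :1)) refl c)
      , (λ c²≡1 → 3≢0 (trans (modulo (1# + - (c + 1# + 1#)) (x≡y⇒x-y≡0 c²≡1)
          (solve 1 (λ c → :1 :+ :1 :+ :1 := (c :+ :1 :+ :1) :* (c :* c :- c :+ :1) :+ (:1 :- (c :+ :1 :+ :1)) :* (c :* (c :* :1) :- :1)) refl c))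
          (trans (cong ((c + 1# + 1#) *_) rel) (zeroʳ _))))
      , (λ c³≡1 → 2≢0 (trans (solve 1 (λ c → :1 :+ :1 := (c :+ :1) :* (c :* c :- c :+ :1) :- (c :* (c :* (c :* :1)) :- :1)) refl c)
          (trans (cong₂ (λ s t → (c + 1#) * s + - t) rel (x≡y⇒x-y≡0 c³≡1)) (solve 1 (λ s → s :* :0 :- :0 := :0) refl (c + 1#)))))

  module Forward (q≢3 : q ≢ 3) {G : Perm {Point 2} → Set} (G-group : IsPermGroup G) (PSL≤G : ∀ h → InPSL h → G h)
    (G-normal : ∀ g → G g → Normalizes g) (D : SQS {Point 2}) (G-aut : ∀ g → G g → IsAut D g) where
    open SQS D

    S : IsQuadrupleSystem (Quad D)
    S = isQuadrupleSystem D
    open IsQuadrupleSystem S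

    inv : Invariant (Quad D)
    inv = psl-aut⇒invariant (λ g g∈PSL → aut-quad D g (G-aut g (PSL≤G g g∈PSL)))

    identity : Perm {Point 2}
    identity = mk↔ₛ′ id id (λ _ → refl) (λ _ → refl)

    ≤-refl : ∀ {H : Perm {Point 2} → Set} → (∀ h → H h → G h) → ∀ h → H h → ∃[ g ] G g × (∀ x → to h x ≡ to g x)
    ≤-refl H≤G h h∈H = h , H≤G h h∈H , λ _ → refl

    orbit⇒block : ∀ {H : Perm {Point 2} → Set} {c} → (∀ h → H h → Quad D (to h (pt 0#)) (to h (pt 1#)) (to h (pt c)) (to h ∞)) →
                  ∀ B → Orbit H (baseWith F c) B → Block B
    orbit⇒block {c = c} H-quad B (h , h∈H , B≐) = resp (λ x → sym (trans (B≐ x) (image-baseWith h c x))) (H-quad h h∈H)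

    characteristic3 : 3≡0 → Case1 F D G
    characteristic3 3≡0# = size (Characteristic3.q≡3^d 3≡0#)
      where
      2≢0 : 1# + 1# ≢ 0#
      2≢0 eq = 1≢0 (trans (sym (+-identityˡ 1#)) (trans (cong (_+ 1#) (sym eq)) 3≡0#))
      -- Three points of the block are the images of 0, 1, ∞ under some h in PGL₂, and the remaining
      -- one must be h(-1).
      block⇒orbit : ∀ B → Block B → Orbit InPGL (baseWith F (- 1#)) B
      block⇒orbit B B-block = listed (block⇒quad D B-block)
        where
        framed : ∀ {a b d e} → Quad D a b d e → B ≐ list (a ∷ b ∷ d ∷ e ∷ []) →
                 (∃[ h ] InPGL h × to h (pt 0#) ≡ a × to h (pt 1#) ≡ b × to h ∞ ≡ e) → Orbit InPGL (baseWith F (- 1#)) B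
        framed Q B≐ (h , h∈PGL , refl , refl , refl) =
          orbit-list h h∈PGL {B} B≐ refl refl (unique₃ S (pgl-harmonic S inv 3≡0# h h∈PGL) Q) refl
        listed : (∃[ a ] ∃[ b ] ∃[ d ] ∃[ e ] Quad D a b d e × B ≐ list (a ∷ b ∷ d ∷ e ∷ [])) → Orbit InPGL (baseWith F (- 1#)) B
        listed (a , b , d , e , Q , B≐) = framed Q B≐ (frame-pgl (distinct Q) (distinct₁₄ Q) (distinct₂₄ Q))
      transports : Transports identity D G (Orbit InPGL (base₃ F)) InPSL InPΓL
      transports = (λ B → block⇒orbit B , orbit⇒block (pgl-harmonic S inv 3≡0#) B) , ≤-refl PSL≤G ,
        λ g g∈G → g , Decomposition.∈PΓL (decompose 2≢0 G-group PSL≤G G-normal g g∈G) , λ _ → refl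
      size : (∃[ d ] q ≡ 3 ℕ.^ d) → Case1 F D G
      size (zero , q≡1)        = contradiction (Fin1-trivial q≡1 0# 1#) 0≢1
        where
        Fin1-trivial : ∀ {n} → n ≡ 1 → (i j : Fin n) → i ≡ j
        Fin1-trivial refl Fin.zero Fin.zero = refl
      size (suc zero , q≡3)    = contradiction q≡3 q≢3
      size (suc (suc d) , q≡) = suc (suc d) , q≡ , s≤s (s≤s z≤n) , identity , inj₁ transports

    other-characteristic : ¬ 3≡0 → Case2 F D G
    other-characteristic 3≢0 = conclude (FourthPoint.fourthPoint S inv)
      where
      conclude : ∃[ c ] Quad D (pt 0#) (pt 1#) ∞ (pt c) → Case2 F D G
      conclude (c , Qc) = q%12≡7 (root⇒q≡1+3k rel 3≢0) (-1-nonsquare⇒q≡3+4k -1∉□) , c , root-primitive rel 3≢0 2≢0 , identity ,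
          (λ B → block⇒orbit B , orbit⇒block (λ h h∈PSL → aut-quad D h (G-aut h (PSL≤G h h∈PSL)) (swap₃₄ S Qc)) B) , ≤-refl PSL≤G ,
          λ g g∈G → g , in-PΣL (decompose 2≢0 G-group PSL≤G G-normal g g∈G) , λ _ → refl
        where
        rel : c * c + - c + 1# ≡ 0#
        rel = FourthPoint.rotation-fixes S inv Qc
        -1∉□ : ¬ IsSquare (- 1#)
        -1∉□ -1∈□ = 3≢0 (c≡1-c⇒3≡0 rel (FourthPoint.reflection-fixes S inv -1∈□ Qc))
        open NonsquareMinusOne -1∉□
        block⇒orbit : ∀ B → Block B → Orbit InPSL (baseWith F c) B
        block⇒orbit B B-block = listed (block⇒quad D B-block)
          where
          framed : ∀ {a b d e} → Quad D a b d e → B ≐ list (a ∷ b ∷ d ∷ e ∷ []) →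
                   (∃[ h ] InPSL h × to h (pt 0#) ≡ a × to h (pt 1#) ≡ b × to h ∞ ≡ e) → Orbit InPSL (baseWith F c) B
          framed Q B≐ (h , h∈PSL , refl , refl , refl) =
            orbit-list h h∈PSL {B} B≐ refl refl (unique₃ S (aut-quad D h (G-aut h (PSL≤G h h∈PSL)) (swap₃₄ S Qc)) Q) refl
          square-framed : ∀ {a b d e} → Quad D a b d e → B ≐ list (a ∷ b ∷ d ∷ e ∷ []) → IsSquare (det 2 (frame a b e)) → Orbit InPSL (baseWith F c) B
          square-framed Q B≐ square = framed Q B≐ (frame-psl (distinct Q) (distinct₁₄ Q) (distinct₂₄ Q) square)
          listed : (∃[ a ] ∃[ b ] ∃[ d ] ∃[ e ] Quad D a b d e × B ≐ list (a ∷ b ∷ d ∷ e ∷ [])) → Orbit InPSL (baseWith F c) B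
          -- Exchanging the first two points negates the frame determinant, so one of the two orders
          -- has a square determinant.
          listed (a , b , d , e , Q , B≐) = [ square-framed Q B≐
            , (λ neg-square → square-framed (swap Q) (λ x → trans (B≐ x) (list-swap a b d e x))
                (subst IsSquare (sym (det-frame-swap a b e)) neg-square)) ]′ (square⊎neg-square (det 2 (frame a b e)))
        -- If −u = w², then x ↦ 1 − x/u is in PSL and composes with g′ to a map exchanging 0 and 1, fixing ∞ and moving c to 1 − c.
        in-PΣL : ∀ {g} → Decomposition G g → InPΣL g
        in-PΣL dec = case (square⊎neg-square u)
          where
          open Decomposition dec
          open FieldAut φ-aut using (φ-0; φ-1)
          case : IsSquare u ⊎ IsSquare (- u) → _
          case (inj₁ square) = square⇒∈PΣL square
          case (inj₂ (w , w²≡-u)) = contradiction (c≡1-c⇒3≡0 rel (pt-injective (unique Qc (swap moved)))) 3≢0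
            where
            w≢0 : w ≢ 0#
            w≢0 refl = u≢0 (-x≡0⇒x≡0 (trans (sym w²≡-u) (zeroˡ 0#)))
            v : K
            v = w ⁻¹
            A : Matrix 2
            A = mat w 0# w v
            det-A : det 2 A ≡ 1#
            det-A = trans (det-expand A) (trans (solve 2 (λ w v → w :* v :- :0 :* w := w :* v) refl w v) (⁻¹-inverse w w≢0))
            A~ : ∀ x y → to g′ (pt x) ≡ pt (u * y) → A · vec (to g′ (pt x)) ~ pt (1# + - y)
            A~ x y eq = subst (λ p → A · vec p ~ pt (1# + - y)) (sym eq) (·pt A
              (λ eq → w≢0 (trans (solve 2 (λ w z → w := w :+ :0 :* z) refl w (u * y)) eq)) (begin
                w + v * (u * y)                 ≡⟨ solve 4 (λ w v u y → w :+ v :* (u :* y) := w :- v :* (:- u) :* y) refl w v u y ⟩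
                w + - (v * - u * y)             ≡⟨ cong (λ t → w + - (v * t * y)) (sym w²≡-u) ⟩
                w + - (v * (w * w) * y)         ≡⟨ solve 3 (λ w v y → w :- v :* (w :* w) :* y := w :- (v :* w) :* (w :* y)) refl w v y ⟩
                w + - (v * w * (w * y))         ≡⟨ cong (λ t → w + - (t * (w * y))) (⁻¹-inverseˡ w≢0) ⟩
                w + - (1# * (w * y))            ≡⟨ solve 3 (λ w y z → w :- :1 :* (w :* y) := (w :+ :0 :* z) :* (:1 :- y)) refl w y (u * y) ⟩
                (w + 0# * (u * y)) * (1# + - y) ∎))
              where open ≡-Reasoning
            at : ∀ x {y z} → φ x ≡ y → 1# + - y ≡ z → A · vec (to g′ (pt x)) ~ pt z
            at x refl refl = A~ x (φ x) (g′-pt x)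
            moved : Quad D (pt 1#) (pt 0#) ∞ (pt (1# + - c))
            moved = inv A det-A
              (at 0# φ-0 (solve 0 (:1 :- :0 := :1) refl))
              (at 1# φ-1 (solve 0 (:1 :- :1 := :0) refl))
              (subst (λ p → A · vec p ~ ∞) (sym g′-∞) (·∞ A (~∞ refl (⁻¹-nonzero w≢0))))
              (at c (aut-fixes-root 3≢0 -1∉□ rel φ-aut) refl)
              (aut-quad D g′ (G-aut g′ g′∈G) Qc)

  module Backward {G : Perm {Point 2} → Set} (D : SQS {Point 2}) where

    module PSLOrbit (c : K) (H₂ : Perm {Point 2} → Set) (σ : Perm {Point 2}) (trs : Transports σ D G (Orbit InPSL (baseWith F c)) InPSL H₂) where
      open Transport _≟ᵖ_ σ D G (Orbit InPSL (baseWith F c)) {InPSL} {H₂} trs (orbit-resp InPSL (baseWith F c)) public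

      inv : Invariant Quadᵗ
      inv = psl-aut⇒invariant (λ g g∈PSL → Blk-invariant⇒quadᵗ-invariant {g} (psl-orbit-invariant g g∈PSL))

      Qc : Quadᵗ (pt 0#) (pt 1#) ∞ (pt c)
      Qc = swap₃₄ quadᵗ-system (Blk⇒quadᵗ (base∈orbit c))

      rel : c * c + - c + 1# ≡ 0#
      rel = FourthPoint.rotation-fixes quadᵗ-system inv Qc

    pgl-orbit-invariant : ∀ h → InPΓL h → ∀ B → Orbit InPGL (base₃ F) B → Orbit InPGL (base₃ F) (image h B)
    pgl-orbit-invariant h (A , φ , detA≢0 , φ-aut , h-ind) = orbit-semilinear (_≢ 0#) (λ x≢0 y≢0 → *-nonzero x≢0 (φ≢0 y≢0)) id
        h A detA≢0 h-ind (trans (φ-neg 1#) (cong -_ φ-1))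
      where open FieldAut φ-aut

    case1-aut : Case1 F D G → ∀ g → G g → IsAut D g
    case1-aut (_ , _ , _ , σ , inj₁ trs) = 
      Transport.Blk-invariant⇒aut _≟ᵖ_ σ D G (Orbit InPGL (base₃ F)) {InPSL} {InPΓL} trs (orbit-resp InPGL (base₃ F)) pgl-orbit-invariant
    case1-aut (_ , _ , _ , σ , inj₂ (_ , trs)) = Blk-invariant⇒aut invariant
      where
      open PSLOrbit (- 1#) InPΓL σ trs
      3≡0# : 3≡0
      3≡0# = trans (solve 0 (:1 :+ :1 :+ :1 := (:- :1) :* (:- :1) :- (:- :1) :+ :1) refl) rel
      -- The PSL₂-orbit is the block set of the Steiner system σ(𝒟), and `pgl-harmonic` forces every
      -- PGL₂-image of the base block into that system.
      pgl⇒psl : ∀ B → Orbit InPGL (base₃ F) B → Orbit InPSL (base₃ F) B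
      pgl⇒psl B (h , h∈PGL , B≐) = orbit-resp InPSL (base₃ F) (list hs) (λ x → sym (trans (B≐ x) (image-baseWith h (- 1#) x)))
          (quadᵗ⇒Blk (pgl-harmonic quadᵗ-system inv 3≡0# h h∈PGL))
        where hs = to h (pt 0#) ∷ to h (pt 1#) ∷ to h (pt (- 1#)) ∷ to h ∞ ∷ []
      invariant : ∀ h → InPΓL h → ∀ B → Orbit InPSL (base₃ F) B → Orbit InPSL (base₃ F) (image h B)
      invariant h h∈PΓL B (k , (A , det≡1 , k-ind) , B≐) =
        pgl⇒psl (image h B) (pgl-orbit-invariant h h∈PΓL B (k , (A , ≡1⇒≢0 det≡1 , k-ind) , B≐))

    case2-aut : Case2 F D G → ∀ g → G g → IsAut D g
    case2-aut (_ , ε , (_ , ε²≢1 , _) , σ , trs) = Blk-invariant⇒aut invariant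
      where
      open PSLOrbit ε InPΣL σ trs
      3≢0 : ¬ 3≡0
      -- In characteristic 3 the relation would give ε = -1, whose square is 1.
      3≢0 3≡0# = ε²≢1 (trans (cong (λ x → x * (x * 1#)) (3≡0⇒c≡-1 3≡0# rel)) (solve 0 ((:- :1) :* ((:- :1) :* :1) := :1) refl))
      -1∉□ : ¬ IsSquare (- 1#)
      -1∉□ -1∈□ = 3≢0 (c≡1-c⇒3≡0 rel (FourthPoint.reflection-fixes quadᵗ-system inv -1∈□ Qc))
      invariant : ∀ h → InPΣL h → ∀ B → Orbit InPSL (baseWith F ε) B → Orbit InPSL (baseWith F ε) (image h B)
      invariant h (A , φ , det≡1 , φ-aut , h-ind) = orbit-semilinear (_≡ 1#)
          (λ p p′ → trans (cong₂ (λ x y → x * φ y) p p′) (trans (*-identityˡ _) φ-1)) ≡1⇒≢0 h A det≡1 h-ind (aut-fixes-root 3≢0 -1∉□ rel φ-aut)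
        where open FieldAut φ-aut

    -- Both base blocks contain 0, 1 and ∞.
    ¬case3 : ¬ Case3 F D G
    ¬case3 (d , q≡9^d , _ , a , (_ , a∉□) , σ , trs) = absurd (trans (sym (3^[2d]%4≡1 d)) (trans (cong (ℕ._% 4) (trans (sym q≡9^d) q≡3+4k)) (ℕ.[m+kn]%n≡m%n 3 k 4)))
      where
      open Transport _≟ᵖ_ σ D G (λ S → Orbit InPSL (base₃ F) S ⊎ Orbit InPSL (baseWith F a) S) {InPSL} {InPΣL} trs
        (λ S S≐ → [ inj₁ ∘ orbit-resp InPSL (base₃ F) S S≐ , inj₂ ∘ orbit-resp InPSL (baseWith F a) S S≐ ]′)
      a≡-1 : a ≡ - 1#
      a≡-1 = pt-injective (unique₃ quadᵗ-system (Blk⇒quadᵗ (inj₂ (base∈orbit a))) (Blk⇒quadᵗ (inj₁ (base∈orbit (- 1#)))))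
      -- As a = -1 is a non-square, q ≡ 3 (mod 4), whereas q = 9ᵈ ≡ 1.
      count : ∃[ k ] q ≡ 3 ℕ.+ k ℕ.* 4
      count = -1-nonsquare⇒q≡3+4k (λ (y , y²≡-1) → a∉□ y (trans y²≡-1 (sym a≡-1)))
      k : ℕ
      k = proj₁ count
      q≡3+4k : q ≡ 3 ℕ.+ k ℕ.* 4
      q≡3+4k = proj₂ count
      absurd : 1 ≢ 3
      absurd ()

mainTheorem1 : ∀ {q : ℕ} (F : FiniteField q) (n : ℕ) → 2 ≤ n → ¬ (n ≡ 2 × (q ≡ 2 ⊎ q ≡ 3)) →
    (G : Perm {FF.Point F n} → Set) → IsPermGroup G →
    (∀ h → FF.InPSL F h → G h) →
    (∀ g → G g → ∀ h → FF.InPSL F h →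
    ∃[ k ] FF.InPSL F k × (∀ x → to k x ≡ to g (to h (from g x)))) →
    (D : SQS {FF.Point F n}) → NonTrivial D →
    ((∀ g → G g → IsAut D g) ⇔ Classified F n D G)
mainTheorem1 F (suc (suc zero)) _ q∉ G G-group PSL≤G G-normal D _ = mk⇔ forward backward
  where
  open FF F
  open LineClassification F
  forward : (∀ g → G g → IsAut D g) → Classified F 2 D G
  forward G-aut with 1# + 1# + 1# ≟ᶠ 0#
  ... | yes 3≡0 = inj₁ (Forward.characteristic3 (λ q≡3 → q∉ (refl , inj₂ q≡3)) G-group PSL≤G G-normal D G-aut 3≡0)
  ... | no  3≢0 = inj₂ (inj₁ (Forward.other-characteristic (λ q≡3 → q∉ (refl , inj₂ q≡3)) G-group PSL≤G G-normal D G-aut 3≢0))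
  backward : Classified F 2 D G → ∀ g → G g → IsAut D g
  backward (inj₁ case1)        = Backward.case1-aut D case1
  backward (inj₂ (inj₁ case2)) = Backward.case2-aut D case2
  backward (inj₂ (inj₂ case3)) = contradiction case3 (Backward.¬case3 D)
mainTheorem1 F (suc (suc (suc m))) _ _ G _ PSL≤G _ D _ = mk⇔
  (λ G-aut → HigherDimension.no-quadrupleSystem F m (isQuadrupleSystem D) (λ g g∈PSL → aut-quad D g (G-aut g (PSL≤G g g∈PSL))))
  (λ ())
  where open Quadruples (Projective._≟ᵖ_ F {suc (suc (suc m))})
mainTheorem1 F (suc zero) (s≤s ()) _
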